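{- (i) $\mathrm{MC}(\cap,+,/)\in\mathrm{P}$. (ii) $\mathrm{MC}(\cap,+,\times,/)\in\mathrm{E}$, where $\mathrm{E}=\mathrm{DTIME}(2^{O(n)})$.
   Context: Natural numbers include $0$. For $A,B\subseteq\mathbb N$: $A\cup B$, $A\cap B$ are the usual operations, $\overline{A}=\mathbb N\setminus A$, $A+B=\{a+b: a\in A, b\in B\}$, $A\times B=\{a\cdot b: a\in A, b\in B\}$, and $A/B=\{c\in\mathbb N:\exists a\in A\ \exists b\in B\setminus\{0\}: a=c\cdot b\}$ (exact integer division without remainder or rounding). For $\emptyset\ne\mathcal O\subseteq\{\cup,\cap,\overline{\phantom{c}},+,\times,/\}$, an $\mathcal O$-circuit $C=(V,E,g_C,\alpha)$ is a finite acyclic directed multigraph with gate set $V\subseteq\mathbb N$, every gate having indegree $0$, $1$ or $2$, a designated output gate $g_C\in V$, and a labeling $\alpha$: gates of indegree $0$ (input gates) are labeled by natural numbers, gates of indegree $1$ are labeled $\overline{\phantom{c}}$ (allowed only if $\overline{\phantom{c}}\in\mathcal O$), and gates of indegree $2$ are labeled by an operation in $\mathcal O\setminus\{\overline{\phantom{c}}\}$. The result set $I(g)\subseteq\mathbb N$ is defined inductively: $I(g)=\{\alpha(g)\}$ for an input gate; $I(g)=\mathbb N\setminus I(p)$ for a complement gate with predecessor $p$; $I(g)=I(g_1)\,\sigma\,I(g_2)$ for a gate labeled $\sigma$ with predecessors $g_1\le g_2$ (a double edge from one gate gives $g_1=g_2$). $I(C)=I(g_C)$. A circuit is encoded as a bit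 string listing its gates in reverse topological order, each gate as the triple (gate name, label, list of predecessors), with all numbers (including input labels) in binary; $|C|$ denotes the length of this encoding. The membership problem is $\mathrm{MC}(\mathcal O)=\{(C,b): C \text{ is an } \mathcal O\text{ -circuit},\ b\in\mathbb N,\ b\in I(C)\}$, with $b$ given in binary; $\mathrm{MC}(\sigma_1,\dots,\sigma_n)$ abbreviates $\mathrm{MC}(\{\sigma_1,\dots,\sigma_n\})$. -}

module Defs where

open import Data.Bool.Base using (Bool; true; false)
open import Data.Fin.Base as Fin using (Fin)
open import Data.Fin.Induction using (spo-wellFounded)
open import Data.List.Base using (List; []; _∷_; [_]; _++_; map; concatMap; length; allFin)
open import Data.List.Membership.Propositional using (_∈_)
open import Data.List.Relation.Unary.Any using (here; there)
open import Data.List.Relation.Unary.Linked using (Linked)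
open import Data.Nat.Base using (ℕ; zero; suc; _+_; _*_; _^_; _≤_)
open import Data.Product using (Σ-syntax; ∃-syntax; _×_; _,_; proj₁)
open import Data.Sum.Base using (_⊎_)
open import Data.Vec.Base as Vec using (Vec)
open import Function.Base using (id)
open import Function.Bundles using (_↔_)
open import Function.Definitions using (Injective)
open import Induction.WellFounded using (Acc; acc; WellFounded)
open import Level using (0ℓ)
open import Relation.Binary.Construct.Closure.Transitive as Closure using (TransClosure)
open import Relation.Binary.PropositionalEquality
  using (_≡_; _≢_; refl; isEquivalence; resp₂)
open import Relation.Nullary using (¬_)
open import Relation.Unary using (Pred; _∪_; _∩_; ∁; ｛_｝)

Word : Set
Word = List Bool

Language : Set₁
Language = Pred Word 0ℓ

Finite : Set → Set
Finite A = ∃[ n ] (A ↔ Fin n)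

data Symbol (W : Set) : Set where
  blank : Symbol W
  bit   : Bool → Symbol W
  work  : W → Symbol W

data State (Q : Set) : Set where
  accept reject : State Q
  active        : Q → State Q

data Move : Set where
  left stay right : Move

-- W contains the tape symbols other than the blank and the two input bits, Q
-- the states other than the two halting ones.  Tapes are infinite in both
-- directions.
record TuringMachine : Set₁ where
  field
    W       : Set
    W-fin   : Finite W
    Q       : Set
    Q-fin   : Finite Q
    extra   : ℕ
    start   : State Q

  tapes : ℕ
  tapes = suc extra

  field
    δ : Q → Vec (Symbol W) tapes → State Q × Vec (Symbol W × Move) tapes

-- `before` is listed outwards from the head; cells beyond the two lists are
-- blank.
record Tape (W : Set) : Set where
  constructor tape
  field
    before  : List (Symbol W)
    scanned : Symbol W
    after   : List (Symbol W)

open Tape public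

module _ {W : Set} where

  shift : Move → Tape W → Tape W
  shift stay  t                    = t
  shift left  (tape []       x rs) = tape [] blank (x ∷ rs)
  shift left  (tape (l ∷ ls) x rs) = tape ls l (x ∷ rs)
  shift right (tape ls x [])       = tape (x ∷ ls) blank []
  shift right (tape ls x (r ∷ rs)) = tape (x ∷ ls) r rs

  act : Symbol W × Move → Tape W → Tape W
  act (x , m) t = shift m (record t { scanned = x })

  blankTape : Tape W
  blankTape = tape [] blank []

  inputTape : Word → Tape W
  inputTape []      = blankTape
  inputTape (b ∷ w) = tape [] (bit b) (map bit w)

module Run (M : TuringMachine) where
  open TuringMachine M

  Configuration : Set
  Configuration = State Q × Vec (Tape W) tapes

  initial : Word → Configuration
  initial w = start , inputTape w Vec.∷ Vec.replicate extra blankTape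

  step : Configuration → Configuration
  step (accept   , ts) = accept , ts
  step (reject   , ts) = reject , ts
  step (active q , ts) = let (s , as) = δ q (Vec.map scanned ts) in
                         s , Vec.zipWith act as ts

  run : ℕ → Configuration → Configuration
  run zero    c = c
  run (suc n) c = run n (step c)

  finalState : ℕ → Word → State Q
  finalState n w = proj₁ (run n (initial w))

-- Halting configurations are fixed by `step`, so this says that M halts after
-- at most f ∣w∣ steps on every word w, accepting exactly the words of L.
DecidesInTime : TuringMachine → Language → (ℕ → ℕ) → Set
DecidesInTime M L f = ∀ w →
  (Run.finalState M (f (length w)) w ≡ accept × L w) ⊎
  (Run.finalState M (f (length w)) w ≡ reject × ¬ L w)

infix 4 _∈O_

_∈O_ : (ℕ → ℕ) → (ℕ → ℕ) → Set
f ∈O g = ∃[ c ] ∃[ n₀ ] (∀ n → n₀ ≤ n → f n ≤ c * g n)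

DTIME : (ℕ → ℕ) → Language → Set₁
DTIME t L = Σ[ M ∈ TuringMachine ] ∃[ f ] (f ∈O t × DecidesInTime M L f)

P : Language → Set₁
P L = ∃[ k ] DTIME (λ n → n ^ k) L

E : Language → Set₁
E L = ∃[ g ] (g ∈O id × DTIME (λ n → 2 ^ g n) L)

data BinOp : Set where
  union inter plus times quotient : BinOp

data Op : Set where
  complement : Op
  binary     : BinOp → Op

∪-op ∩-op ¬-op +-op ×-op /-op : Op
∪-op = binary union
∩-op = binary inter
¬-op = complement
+-op = binary plus
×-op = binary times
/-op = binary quotient

NatSet : Set₁
NatSet = Pred ℕ 0ℓ

infixl 6 _⊕_
infixl 7 _⊗_ _⊘_

_⊕_ _⊗_ _⊘_ : NatSet → NatSet → NatSet
(A ⊕ B) c = ∃[ a ] ∃[ b ] (A a × B b × c ≡ a + b)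
(A ⊗ B) c = ∃[ a ] ∃[ b ] (A a × B b × c ≡ a * b)
(A ⊘ B) c = ∃[ a ] ∃[ b ] (A a × B b × b ≢ 0 × a ≡ c * b)

⟦_⟧ : BinOp → NatSet → NatSet → NatSet
⟦ union    ⟧ = _∪_
⟦ inter    ⟧ = _∩_
⟦ plus     ⟧ = _⊕_
⟦ times    ⟧ = _⊗_
⟦ quotient ⟧ = _⊘_

-- The label of a gate together with its incoming edges, given by the list of
-- their sources (with repetition for a double edge).
data Node (O : List Op) (V : Set) : Set where
  input : ℕ → Node O V
  unary : complement ∈ O → V → Node O V
  bin   : (σ : BinOp) → binary σ ∈ O → V → V → Node O V

predecessors : ∀ {O V} → Node O V → List V
predecessors (input _)     = []
predecessors (unary _ p)   = p ∷ []
predecessors (bin _ _ p q) = p ∷ q ∷ []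

-- The gate set V ⊆ ℕ is the image of `name`.  The indices i : Fin size only
-- fix an order in which the gates are listed, which is arbitrary here.
-- `ordered` says that the first operand is the predecessor with the smaller
-- name.
record Circuit (O : List Op) : Set where
  field
    size     : ℕ
    name     : Fin size → ℕ
    name-inj : Injective _≡_ _≡_ name
    node     : Fin size → Node O (Fin size)
    output   : Fin size

  infix 4 _⟶_

  _⟶_ : Fin size → Fin size → Set
  p ⟶ g = p ∈ predecessors (node g)

  field
    ordered : ∀ g → Linked (λ p q → name p ≤ name q) (predecessors (node g))
    acyclic : ∀ g → ¬ TransClosure _⟶_ g g

  ⟶-wellFounded : WellFounded _⟶_
  ⟶-wellFounded = Closure.wellFounded⁻ _⟶_ (spo-wellFounded record
    { isEquivalence = isEquivalence
    ; irrefl        = λ { {g} refl → acyclic g }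
    ; trans         = Closure.transitive _⟶_
    ; <-resp-≈      = resp₂ (TransClosure _⟶_)
    })

nodeResult : ∀ {O V} (v : Node O V) → (∀ {p} → p ∈ predecessors v → NatSet) → NatSet
nodeResult (input n)     I = ｛ n ｝
nodeResult (unary _ p)   I = ∁ (I (here refl))
nodeResult (bin σ _ p q) I = ⟦ σ ⟧ (I (here refl)) (I (there (here refl)))

module _ {O : List Op} (C : Circuit O) where
  open Circuit C

  gateResultAcc : ∀ g → Acc _⟶_ g → NatSet
  gateResultAcc g (acc rs) = nodeResult (node g) (λ p⟶g → gateResultAcc _ (rs p⟶g))

  gateResult : Fin size → NatSet
  gateResult g = gateResultAcc g (⟶-wellFounded g)

  result : NatSet
  result = gateResult output

  -- Edges lead from predecessors to gates, so in reverse topological order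
  -- every gate is listed before its predecessors.
  ReverseTopological : Set
  ReverseTopological = ∀ {p g} → p ⟶ g → g Fin.< p

data Token : Set where
  digit           : Bool → Token
  operation       : Op → Token
  comma semicolon : Token

tokenCode : Token → Word
tokenCode (digit false)                 = false ∷ false ∷ false ∷ false ∷ []
tokenCode (digit true)                  = false ∷ false ∷ false ∷ true  ∷ []
tokenCode comma                         = false ∷ false ∷ true  ∷ false ∷ []
tokenCode semicolon                     = false ∷ false ∷ true  ∷ true  ∷ []
tokenCode (operation complement)        = false ∷ true  ∷ false ∷ false ∷ []
tokenCode (operation (binary union))    = false ∷ true  ∷ false ∷ true  ∷ []
tokenCode (operation (binary inter))    = false ∷ true  ∷ true  ∷ false ∷ []
tokenCode (operation (binary plus))     = false ∷ true  ∷ true  ∷ true  ∷ []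
tokenCode (operation (binary times))    = true  ∷ false ∷ false ∷ false ∷ []
tokenCode (operation (binary quotient)) = true  ∷ false ∷ false ∷ true  ∷ []

increment : List Bool → List Bool
increment []           = true ∷ []
increment (false ∷ bs) = true ∷ bs
increment (true  ∷ bs) = false ∷ increment bs

-- Least significant digit first, without superfluous zeros; 0 is written as
-- the single digit 0.
binaryDigits : ℕ → List Bool
binaryDigits zero    = false ∷ []
binaryDigits (suc n) = increment (binaryDigits n)

number : ℕ → List Token
number n = map digit (binaryDigits n)

module _ {O : List Op} (C : Circuit O) where
  open Circuit C

  label : ∀ {V} → Node O V → List Token
  label (input n)     = number n
  label (unary _ _)   = [ operation complement ]
  label (bin σ _ _ _) = [ operation (binary σ) ]

  gateTokens : Fin size → List Token
  gateTokens g =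
    number (name g) ++ comma ∷ label (node g) ++ comma ∷
    concatMap (λ p → number (name p) ++ [ comma ]) (predecessors (node g)) ++
    [ semicolon ]

  circuitTokens : List Token
  circuitTokens =
    number (name output) ++ semicolon ∷ concatMap gateTokens (allFin size)

  encode : ℕ → Word
  encode b = concatMap tokenCode (circuitTokens ++ number b)

-- All reverse topological orders of a circuit are obtained from its
-- presentations as elements of `Circuit O`.
MC : List Op → Language
MC O w = Σ[ C ∈ Circuit O ] ∃[ b ]
  (ReverseTopological C × w ≡ encode C b × result C b)

{-# OPTIONS --safe #-}

-- Without ∪ and complement every gate computes the empty set or a singleton, so
-- a circuit is evaluated gate by gate, from the last gate listed to the first,
-- with at most one number per gate.  The operations ∩ and / do not lengthen
-- numbers and + adds at most one digit, so without × all numbers have O(n)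
-- digits; × makes them at most three times as long, so with × they have 2^O(n)
-- digits.  Schoolbook arithmetic on these numbers is polynomial in their length.
--
-- Turing machines are obtained from a small language of programs working on
-- stacks.  If every execution of a loop of such a program makes at most N
-- rounds, the compiled machine runs in time polynomial in N, so the time bounds
-- only require bounds on the numbers of rounds, that is, on lengths of stacks.

module Submission where

open import Defs
open import Data.Bool.Base using (Bool; true; false; not; _∧_; _∨_; _xor_; if_then_else_)
open import Data.Empty using (⊥; ⊥-elim)
open import Data.Fin.Base as Fin using (Fin; zero; suc)
open import Data.Fin.Patterns
import Data.Fin.Properties as Fin
open import Data.List.Base as List
  using (List; []; _∷_; [_]; _++_; _ʳ++_; allFin; concatMap; drop; head; length; map; reverse; tabulate)
open import Data.List.Membership.Propositional using (_∈_)
open import Data.List.Properties as List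
  using (++-assoc; length-++; length-map; length-reverse; map-ʳ++; length-ʳ++; ʳ++-ʳ++)
open import Data.List.Relation.Unary.All as All using (All; []; _∷_)
import Data.List.Relation.Unary.All.Properties as All
open import Data.List.Relation.Unary.Any using (here; there)
open import Data.List.Relation.Unary.Linked using (Linked; []; [-]; _∷_)
open import Data.Maybe.Base as Maybe using (Maybe; just; nothing; is-just)
open import Data.Maybe.Properties using (just-injective)
open import Data.Nat.Base
open import Data.Nat.Properties
open import Data.Nat.Tactic.RingSolver using (solve-∀)
open import Data.Product using (Σ; Σ-syntax; ∃-syntax; _×_; _,_; proj₁; proj₂)
open import Data.Product.Function.Dependent.Propositional using (Σ-↔)
open import Data.Sum.Base using (_⊎_; inj₁; inj₂; [_,_]′)
open import Data.Sum.Function.Propositional using (_⊎-cong_)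
open import Data.Unit.Base using (⊤; tt)
open import Data.Vec.Base as Vec using (Vec; []; _∷_; lookup; _[_]≔_)
import Data.Vec.Properties as Vec
open import Function.Base using (id; _∘_; const)
open import Function.Bundles using (_↔_; Inverse; mk↔ₛ′)
open import Function.Properties.Inverse using (↔-refl; ↔-sym; ↔-trans)
open import Induction.WellFounded as WF using (Acc)
open import Relation.Binary.Construct.Closure.Transitive as Closure using (TransClosure)
open import Relation.Binary.PropositionalEquality hiding ([_])
open import Relation.Nullary using (¬_; yes; no; contradiction)
open import Relation.Unary using (_≐_)

-- Membership also requires that the word is an encoding at all: canonical binary numerals, distinct
-- gate names, ordered operands, and predecessors listed after the gates that use them. Numerals and
-- punctuation are checked by a finite automaton during decoding. The remaining conditions are
-- checked by evaluation itself: operands are looked up by name among the gates evaluated so far,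
-- and a gate whose own name is already there is refused. An accepted listing can therefore be
-- turned back into a circuit, with positions as gate indices.
--
-- An empty set is an ordinary value with a mark of its own, distinct from the failure caused by a
-- malformed listing.
--
-- Running out of rounds is a third outcome of a program, about which the simulation promises
-- nothing. This separates the correctness of the compiler from the bounds on rounds, which are
-- proved afterwards from the lengths of stacks alone.

variable
  A B : Set
  n   : ℕ

-- Finite types and sums over them

-- `Finite A` is by definition a Σ-type; the record gives instance search a type former of its own
-- to look for.
record Enumerable (A : Set) : Set where
  constructor enumerated
  field finite : Finite A

open Enumerable

Σ-Fin-suc : {B : Fin (suc n) → Set} →
            Σ (Fin (suc n)) B ↔ (B zero ⊎ Σ (Fin n) (B ∘ suc))
Σ-Fin-suc = mk↔ₛ′
  (λ { (zero , b) → inj₁ b ; (suc i , b) → inj₂ (i , b) })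
  (λ { (inj₁ b) → zero , b ; (inj₂ (i , b)) → suc i , b })
  (λ { (inj₁ b) → refl ; (inj₂ (i , b)) → refl })
  (λ { (zero , b) → refl ; (suc i , b) → refl })

-- The dependent form is what control states require: the control points of a continuation `f a`
-- vary with the value `a`.
Fin-Σ-finite : ∀ n {B : Fin n → Set} → (∀ i → Finite (B i)) → Finite (Σ (Fin n) B)
Fin-Σ-finite zero    fin = 0 , mk↔ₛ′ proj₁ (λ ()) (λ ()) (λ ())
Fin-Σ-finite (suc n) fin =
  let m , B₀ = fin zero
      k , Bₛ = Fin-Σ-finite n (fin ∘ suc)
  in  m + k , ↔-trans Σ-Fin-suc (↔-trans (B₀ ⊎-cong Bₛ) (↔-sym Fin.+↔⊎))

Σ-finite : {B : A → Set} → Finite A → (∀ a → Finite (B a)) → Finite (Σ A B)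
Σ-finite (n , A↔) fin =
  let m , Σ↔ = Fin-Σ-finite n (λ i → proj₁ (fin (Inverse.from A↔ i)) , ↔-refl)
  in  m , ↔-trans
            (↔-sym (Σ-↔ (↔-sym A↔) (λ {i} → ↔-sym (proj₂ (fin (Inverse.from A↔ i))))))
            Σ↔

⊎-finite : Finite A → Finite B → Finite (A ⊎ B)
⊎-finite (m , A↔) (n , B↔) = m + n , ↔-trans (A↔ ⊎-cong B↔) (↔-sym Fin.+↔⊎)

Maybe-finite : Finite A → Finite (Maybe A)
Maybe-finite (n , A↔) = suc n , mk↔ₛ′
  (λ { nothing → zero ; (just a) → suc (Inverse.to A↔ a) })
  (λ { zero → nothing ; (suc i) → just (Inverse.from A↔ i) })
  (λ { zero → refl ; (suc i) → cong suc (Inverse.strictlyInverseˡ A↔ i) })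
  (λ { nothing → refl ; (just a) → cong just (Inverse.strictlyInverseʳ A↔ a) })

⊤-finite : Finite ⊤
⊤-finite = 1 , ↔-sym Fin.1↔⊤

Bool-finite : Finite Bool
Bool-finite = 2 , ↔-sym Fin.2↔Bool

instance
  ⊤-enumerable : Enumerable ⊤
  ⊤-enumerable = enumerated ⊤-finite

  Bool-enumerable : Enumerable Bool
  Bool-enumerable = enumerated Bool-finite

  Fin-enumerable : Enumerable (Fin n)
  Fin-enumerable = enumerated (_ , ↔-refl)

  Maybe-enumerable : {{Enumerable A}} → Enumerable (Maybe A)
  Maybe-enumerable {{a}} = enumerated (Maybe-finite (finite a))

  ⊎-enumerable : {{Enumerable A}} → {{Enumerable B}} → Enumerable (A ⊎ B)
  ⊎-enumerable {{a}} {{b}} = enumerated (⊎-finite (finite a) (finite b))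

  ×-enumerable : {{Enumerable A}} → {{Enumerable B}} → Enumerable (A × B)
  ×-enumerable {{a}} {{b}} = enumerated (Σ-finite (finite a) (λ _ → finite b))

sumFin : ∀ n → (Fin n → ℕ) → ℕ
sumFin zero    h = 0
sumFin (suc n) h = h zero + sumFin n (h ∘ suc)

≤sumFin : ∀ {n} h (i : Fin n) → h i ≤ sumFin n h
≤sumFin h zero    = m≤m+n _ _
≤sumFin h (suc i) = ≤-trans (≤sumFin (h ∘ suc) i) (m≤n+m _ (h zero))

-- Plays the part of a maximum over all possible intermediate results: it dominates each summand,
-- and a finite sum of polynomially bounded functions is again polynomially bounded.
total : {{Enumerable A}} → (A → ℕ) → ℕ
total {{enumerated (n , A↔)}} h = sumFin n (h ∘ Inverse.from A↔)

≤total : {{_ : Enumerable A}} (h : A → ℕ) (a : A) → h a ≤ total h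
≤total {{enumerated (n , A↔)}} h a =
  subst (λ a′ → h a′ ≤ sumFin n (h ∘ Inverse.from A↔)) (Inverse.strictlyInverseʳ A↔ a)
        (≤sumFin (h ∘ Inverse.from A↔) (Inverse.to A↔ a))

-- Polynomially bounded functions

-- The base `suc n` is positive, so a power grows with its exponent even at `n = 0`; sums and
-- products then simply add the exponents.
Polynomial : (ℕ → ℕ) → Set
Polynomial f = ∃[ c ] ∃[ d ] (∀ n → f n ≤ c * suc n ^ d)

const-polynomial : ∀ k → Polynomial (λ _ → k)
const-polynomial k = k , 0 , λ n → ≤-reflexive (sym (*-identityʳ k))

id-polynomial : Polynomial id
id-polynomial = 1 , 1 , λ n → ≤-trans (n≤1+n n)
  (≤-reflexive (sym (trans (*-identityˡ (suc n * 1)) (*-identityʳ (suc n)))))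

+-polynomial : ∀ {f g} → Polynomial f → Polynomial g → Polynomial (λ n → f n + g n)
+-polynomial {f} {g} (c , d , f≤) (c′ , d′ , g≤) = c + c′ , d + d′ , λ n → begin
  f n + g n                                    ≤⟨ +-mono-≤ (f≤ n) (g≤ n) ⟩
  c * suc n ^ d + c′ * suc n ^ d′              ≤⟨ +-mono-≤
    (*-monoʳ-≤ c (^-monoʳ-≤ (suc n) (m≤m+n d d′)))
    (*-monoʳ-≤ c′ (^-monoʳ-≤ (suc n) (m≤n+m d′ d))) ⟩
  c * suc n ^ (d + d′) + c′ * suc n ^ (d + d′) ≡⟨ *-distribʳ-+ (suc n ^ (d + d′)) c c′ ⟨
  (c + c′) * suc n ^ (d + d′)                  ∎
  where open ≤-Reasoning

*-polynomial : ∀ {f g} → Polynomial f → Polynomial g → Polynomial (λ n → f n * g n)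
*-polynomial {f} {g} (c , d , f≤) (c′ , d′ , g≤) = c * c′ , d + d′ , λ n → begin
  f n * g n                             ≤⟨ *-mono-≤ (f≤ n) (g≤ n) ⟩
  (c * suc n ^ d) * (c′ * suc n ^ d′)   ≡⟨ [m*n]*[o*p]≡[m*o]*[n*p] c (suc n ^ d) c′ (suc n ^ d′) ⟩
  (c * c′) * (suc n ^ d * suc n ^ d′)   ≡⟨ cong (c * c′ *_) (^-distribˡ-+-* (suc n) d d′) ⟨
  c * c′ * suc n ^ (d + d′)             ∎
  where open ≤-Reasoning

sumFin-polynomial : ∀ n {h : Fin n → ℕ → ℕ} → (∀ i → Polynomial (h i)) →
                    Polynomial (λ m → sumFin n (λ i → h i m))
sumFin-polynomial zero    poly = const-polynomial 0
sumFin-polynomial (suc n) poly = +-polynomial (poly zero) (sumFin-polynomial n (poly ∘ suc))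

-- `failed` is a deliberate rejection by the program, whereas `timeout` only says that the allotted
-- number of rounds was too small.
data Result (S A : Set) : Set where
  done           : A → S → Result S A
  failed timeout : Result S A

-- Stack programs and their compilation to Turing machines

module StackMachine (W : Set) (W-finite : Finite W) (extra : ℕ) where

  stacks : ℕ
  stacks = suc extra

  Γ : Set
  Γ = Bool ⊎ W

  Store : Set
  Store = Vec (List Γ) stacks

  instance
    W-enumerable : Enumerable W
    W-enumerable = enumerated W-finite

  infixl 1 _>>=_ _>>_

  -- Intermediate results range over finite types, so the control state of a machine can remember
  -- them; unbounded data lives on the stacks only. Programs may therefore branch on results by
  -- ordinary functions.
  data Prog : Set → Set₁ where
    ret   : A → Prog A
    fail  : Prog A
    push  : Fin stacks → Γ → Prog ⊤
    pop   : Fin stacks → Prog (Maybe Γ)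
    _>>=_ : {{Enumerable A}} → Prog A → (A → Prog B) → Prog B
    iter  : {{Enumerable A}} → (A → Prog (A ⊎ B)) → A → Prog B

  _>>_ : {{Enumerable A}} → Prog A → Prog B → Prog B
  p >> q = p >>= λ _ → q

  continue : Result Store A → (A → Store → Result Store B) → Result Store B
  continue (done a s) k = k a s
  continue failed     k = failed
  continue timeout    k = timeout

  loop : ℕ → (A → Store → Result Store (A ⊎ B)) → A → Store → Result Store B
  loop zero    h a s = timeout
  loop (suc m) h a s = continue (h a s) [ loop m h , done ]′

  -- The only source of non-termination is cut off: every execution of an
  -- `iter` gets at most N rounds.
  eval : ℕ → Prog A → Store → Result Store A
  eval N (ret a)    s = done a s
  eval N fail       s = failed
  eval N (push i x) s = done tt (Vec.updateAt s i (x ∷_))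
  eval N (pop i)    s = done (head (lookup s i)) (Vec.updateAt s i (drop 1))
  eval N (p >>= f)  s = continue (eval N p s) (λ a → eval N (f a))
  eval N (iter f a) s = loop N (λ a′ → eval N (f a′)) a s

  -- A `push` takes two steps, a move to the left and a write. A round of `iter` pays one extra step
  -- for passing from the loop head into the body. Summing over all results of `p`, instead of using
  -- the actual one, makes the cost independent of the store.
  cost : ℕ → Prog A → ℕ
  cost N (ret a)    = 0
  cost N fail       = 0
  cost N (push i x) = 2
  cost N (pop i)    = 1
  cost N (p >>= f)  = cost N p + total (λ a → cost N (f a))
  cost N (iter f a) = N * suc (total (λ a′ → cost N (f a′)))

  cost-polynomial : (p : Prog A) → Polynomial (λ N → cost N p)
  cost-polynomial (ret a)    = const-polynomial 0
  cost-polynomial fail       = const-polynomial 0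
  cost-polynomial (push i x) = const-polynomial 2
  cost-polynomial (pop i)    = const-polynomial 1
  cost-polynomial (_>>=_ {{enumerated (n , _)}} p f) =
    +-polynomial (cost-polynomial p) (sumFin-polynomial n (λ i → cost-polynomial (f _)))
  cost-polynomial (iter {{enumerated (n , _)}} f a) =
    *-polynomial id-polynomial
      (+-polynomial (const-polynomial 1) (sumFin-polynomial n (λ i → cost-polynomial (f _))))

  -- Results are remembered by position: there is one copy of the continuation for each value `a`.
  -- In a loop, `(a , nothing)` is the loop head with current value `a`, and `(a , just l)` is a
  -- point inside the body started with `a`. The two points of a `push` are its move and its write.
  Loc : Prog A → Set
  Loc (ret a)          = ⊥
  Loc fail             = ⊥
  Loc (push i x)       = Bool
  Loc (pop i)          = ⊤
  Loc (_>>=_ {A} p f)  = Loc p ⊎ Σ[ a ∈ A ] Loc (f a)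
  Loc (iter {A} f _)   = Σ[ a ∈ A ] Maybe (Loc (f a))

  Loc-finite : (p : Prog A) → Finite (Loc p)
  Loc-finite (ret a)    = 0 , ↔-sym Fin.0↔⊥
  Loc-finite fail       = 0 , ↔-sym Fin.0↔⊥
  Loc-finite (push i x) = Bool-finite
  Loc-finite (pop i)    = ⊤-finite
  Loc-finite (_>>=_ {{fin}} p f) =
    ⊎-finite (Loc-finite p) (Σ-finite (finite fin) (λ a → Loc-finite (f a)))
  Loc-finite (iter {{fin}} f _) =
    Σ-finite (finite fin) (λ a → Maybe-finite (Loc-finite (f a)))

  code : Γ → Symbol W
  code (inj₁ b) = bit b
  code (inj₂ w) = work w

  decodeSymbol : Symbol W → Maybe Γ
  decodeSymbol blank    = nothing
  decodeSymbol (bit b)  = just (inj₁ b)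
  decodeSymbol (work w) = just (inj₂ w)

  Actions : Set
  Actions = Vec (Symbol W × Move) stacks

  actOn : Fin stacks → (Symbol W → Symbol W × Move) → Vec (Symbol W) stacks → Actions
  actOn i f v = Vec.updateAt (Vec.map (_, stay) v) i (const (f (lookup v i)))

  -- On an empty stack the head stays where it is: below the stack only the first cell is known to
  -- be blank, so a move to the right could uncover a cell about which nothing is known.
  popAction : Maybe Γ → Symbol W × Move
  popAction nothing  = blank , stay
  popAction (just _) = blank , right

  -- The control state in which p starts, and the transitions inside p, when
  -- the control points of p are placed into X by ι and κ says where to go with
  -- the result of p.
  module _ {X : Set} where

    entry : (p : Prog A) → (Loc p → X) → (A → State X) → State X
    entry (ret a)    ι κ = κ a
    entry fail       ι κ = reject
    entry (push i x) ι κ = active (ι false)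
    entry (pop i)    ι κ = active (ι tt)
    entry (p >>= f)  ι κ = entry p (ι ∘ inj₁) (λ a → entry (f a) (ι ∘ inj₂ ∘ (a ,_)) κ)
    entry (iter f a) ι κ = active (ι (a , nothing))

    again : {C : A → Set} → (Σ[ a ∈ A ] Maybe (C a) → X) → (B → State X) →
            A ⊎ B → State X
    again ι κ (inj₁ a) = active (ι (a , nothing))
    again ι κ (inj₂ b) = κ b

    trans-δ : (p : Prog A) → (Loc p → X) → (A → State X) →
              Loc p → Vec (Symbol W) stacks → State X × Actions
    trans-δ (push i x) ι κ false v = active (ι true) , actOn i (_, left) v
    trans-δ (push i x) ι κ true  v = κ tt , actOn i (const (code x , stay)) v
    trans-δ (pop i)    ι κ tt    v =
      κ (decodeSymbol (lookup v i)) , actOn i (popAction ∘ decodeSymbol) v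
    trans-δ (p >>= f)  ι κ (inj₁ l) v =
      trans-δ p (ι ∘ inj₁) (λ a → entry (f a) (ι ∘ inj₂ ∘ (a ,_)) κ) l v
    trans-δ (p >>= f)  ι κ (inj₂ (a , l)) v = trans-δ (f a) (ι ∘ inj₂ ∘ (a ,_)) κ l v
    trans-δ (iter f _) ι κ (a , nothing) v =
      entry (f a) (ι ∘ (a ,_) ∘ just) (again ι κ) , Vec.map (_, stay) v
    trans-δ (iter f _) ι κ (a , just l) v = trans-δ (f a) (ι ∘ (a ,_) ∘ just) (again ι κ) l v

  verdict : {X : Set} → Bool → State X
  verdict true  = accept
  verdict false = reject

  machine : Prog Bool → TuringMachine
  machine p = record
    { W       = W
    ; W-fin   = W-finite
    ; Q       = Loc p
    ; Q-fin   = Loc-finite p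
    ; extra   = extra
    ; start   = entry p id verdict
    ; δ       = trans-δ p id verdict
    }

  -- A stack occupies the cells from the head on to the right; what lies to the
  -- left of the head is junk left over by earlier pushes and pops.
  Cells : List Γ → List (Symbol W) → Set
  Cells []       []       = ⊤
  Cells []       (c ∷ cs) = c ≡ blank
  Cells (x ∷ xs) []       = ⊥
  Cells (x ∷ xs) (c ∷ cs) = c ≡ code x × Cells xs cs

  Holds : List Γ → Tape W → Set
  Holds xs t = Cells xs (scanned t ∷ after t)

  Represents : Store → Vec (Tape W) stacks → Set
  Represents s ts = ∀ i → Holds (lookup s i) (lookup ts i)

  FinalVerdict : Result Store Bool → Bool → Set
  FinalVerdict (done b′ s) b = b′ ≡ b
  FinalVerdict failed      b = false ≡ b
  FinalVerdict timeout     b = ⊥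

  inputStore : Word → Store
  inputStore w = map inj₁ w ∷ Vec.replicate extra []

  module _ (main : Prog Bool) where
    open Run (machine main)

    run-+ : ∀ m n c → run (m + n) c ≡ run n (run m c)
    run-+ zero    n c = refl
    run-+ (suc m) n c = run-+ m n (step c)

    halted-run : ∀ n b ts → run n (verdict b , ts) ≡ (verdict b , ts)
    halted-run zero    b     ts = refl
    halted-run (suc n) true  ts = halted-run n true ts
    halted-run (suc n) false ts = halted-run n false ts

    scannedAll : Vec (Tape W) stacks → Vec (Symbol W) stacks
    scannedAll = Vec.map scanned

    keep-id : ∀ {k} (ts : Vec (Tape W) k) →
              Vec.zipWith act (Vec.map (_, stay) (Vec.map scanned ts)) ts ≡ ts
    keep-id []       = refl
    keep-id (t ∷ ts) = cong (t ∷_) (keep-id ts)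

    actOn-tapes : ∀ i f ts → Vec.zipWith act (actOn i f (scannedAll ts)) ts ≡
                  Vec.updateAt ts i (λ t → act (f (scanned t)) t)
    actOn-tapes = go
      where
      go : ∀ {k} i (f : Symbol W → Symbol W × Move) (ts : Vec (Tape W) k) →
           Vec.zipWith act (Vec.updateAt (Vec.map (_, stay) (Vec.map scanned ts)) i
                             (const (f (lookup (Vec.map scanned ts) i)))) ts ≡
           Vec.updateAt ts i (λ t → act (f (scanned t)) t)
      go zero    f (t ∷ ts) = cong (act (f (scanned t)) t ∷_) (keep-id ts)
      go (suc i) f (t ∷ ts) = cong (t ∷_) (go i f ts)

    represents-update : ∀ {s ts} i {g : List Γ → List Γ} {h : Tape W → Tape W} →
      Represents s ts → Holds (g (lookup s i)) (h (lookup ts i)) →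
      Represents (Vec.updateAt s i g) (Vec.updateAt ts i h)
    represents-update {s} {ts} i {g} {h} rep new j with i Fin.≟ j
    ... | yes refl = subst₂ Holds (sym (Vec.lookup∘updateAt i s)) (sym (Vec.lookup∘updateAt i ts)) new
    ... | no i≢j = subst₂ Holds
            (sym (Vec.lookup∘updateAt′ j i (i≢j ∘ sym) s))
            (sym (Vec.lookup∘updateAt′ j i (i≢j ∘ sym) ts)) (rep j)

    holds-push : ∀ {xs} x t → Holds xs t →
                 Holds (x ∷ xs) (act (code x , stay) (act (scanned t , left) t))
    holds-push x (tape []       c cs) h = refl , h
    holds-push x (tape (l ∷ ls) c cs) h = refl , h

    holds-pop : ∀ xs t → Holds xs t → decodeSymbol (scanned t) ≡ head xs ×
                Holds (drop 1 xs) (act (popAction (decodeSymbol (scanned t))) t)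
    holds-pop []                   (tape ls c cs)        refl        = refl , refl
    holds-pop (inj₁ b ∷ [])        (tape ls c [])        (refl , h) = refl , refl
    holds-pop (inj₂ w ∷ [])        (tape ls c [])        (refl , h) = refl , refl
    holds-pop (inj₁ b ∷ xs)        (tape ls c (c′ ∷ cs)) (refl , h) = refl , h
    holds-pop (inj₂ w ∷ xs)        (tape ls c (c′ ∷ cs)) (refl , h) = refl , h

    -- Nothing is claimed for `timeout`, which lets the simulation hold for every `N`. After a
    -- failure the tapes are arbitrary, since only the halting state counts.
    Simulates : Result Store A → (A → State (Loc main)) → ℕ → Configuration → Set
    Simulates (done a s) κ T c =
      ∃[ t ] (t ≤ T × ∃[ ts ] (Represents s ts × run t c ≡ (κ a , ts)))
    Simulates failed     κ T c = ∃[ t ] (t ≤ T × ∃[ ts ] (run t c ≡ (reject , ts)))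
    Simulates timeout    κ T c = ⊤

    -- Also used with `t = 0`, where it merely weakens the time bound.
    simulates-prefix : ∀ (r : Result Store A) {κ T} t {T′ c c′} →
      run t c ≡ c′ → t + T ≤ T′ → Simulates r κ T c′ → Simulates r κ T′ c
    simulates-prefix (done a s) t {c = c} eq ≤T′ (u , u≤ , ts , rep , eq′) =
      t + u , ≤-trans (+-monoʳ-≤ t u≤) ≤T′ , ts , rep ,
      trans (run-+ t u c) (trans (cong (run u) eq) eq′)
    simulates-prefix failed t {c = c} eq ≤T′ (u , u≤ , ts , eq′) =
      t + u , ≤-trans (+-monoʳ-≤ t u≤) ≤T′ , ts ,
      trans (run-+ t u c) (trans (cong (run u) eq) eq′)
    simulates-prefix timeout t eq ≤T′ sim = tt

    -- Subprograms are simulated inside the transition function of the whole program. Since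
    -- `trans-δ` descends by composing injections, the hypothesis passes to a subprogram by
    -- restriction to its control points, and for `main` itself it is `refl`.
    Placed : (p : Prog A) → (Loc p → Loc main) → (A → State (Loc main)) → Set
    Placed p ι κ = ∀ l v → trans-δ main id verdict (ι l) v ≡ trans-δ p ι κ l v

    simulates-continue : ∀ (r : Result Store A) {k : A → Store → Result Store B} {κ κ′ T T′ c} →
      Simulates r κ T c →
      (∀ a s ts → r ≡ done a s → Represents s ts → Simulates (k a s) κ′ T′ (κ a , ts)) →
      Simulates (continue r k) κ′ (T + T′) c
    simulates-continue (done a s) (t , t≤ , ts , rep , eq) next =
      simulates-prefix _ t eq (+-monoˡ-≤ _ t≤) (next a s ts refl rep)
    simulates-continue failed (t , t≤ , ts , eq) next =
      t , ≤-trans t≤ (m≤m+n _ _) , ts , eq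
    simulates-continue timeout sim next = tt

    step-active : ∀ {q st as ts ts′} → trans-δ main id verdict q (scannedAll ts) ≡ (st , as) →
                  Vec.zipWith act as ts ≡ ts′ → step (active q , ts) ≡ (st , ts′)
    step-active {ts = ts} eq eq′ rewrite eq = cong (_ ,_) eq′

    simulation : ∀ N (p : Prog A) {ι κ} → Placed p ι κ → ∀ {s ts} → Represents s ts →
                 Simulates (eval N p s) κ (cost N p) (entry p ι κ , ts)

    simulation-loop : ∀ N {{_ : Enumerable A}} (f : A → Prog (A ⊎ B)) {ι κ a₀} →
      Placed (iter f a₀) ι κ → ∀ m a {s ts} → Represents s ts →
      Simulates (loop m (λ a′ → eval N (f a′)) a s) κ
                (m * suc (total (λ a′ → cost N (f a′)))) (active (ι (a , nothing)) , ts)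

    simulation N (ret a) placed rep = 0 , z≤n , _ , rep , refl
    simulation N fail    placed rep = 0 , z≤n , _ , refl
    simulation N (push i x) {ι} {κ} placed {s} {ts} rep =
      2 , ≤-refl , _ , rep′ ,
      trans (cong step (step-active {ts = ts} (placed false _) (actOn-tapes i (_, left) ts)))
            (trans (step-active {ts = ts₁} (placed true _) (actOn-tapes i (const (code x , stay)) ts₁))
                   (cong (κ tt ,_) (Vec.updateAt-updateAt i ts)))
      where
      ts₁ : Vec (Tape W) stacks
      ts₁ = Vec.updateAt ts i (λ t → act (scanned t , left) t)
      rep′ : Represents (Vec.updateAt s i (x ∷_))
               (Vec.updateAt ts i (λ t → act (code x , stay) (act (scanned t , left) t)))
      rep′ = represents-update {s} {ts} i rep (holds-push x (lookup ts i) (rep i))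
    simulation N (pop i) {ι} {κ} placed {s} {ts} rep =
      1 , ≤-refl , _ , rep′ ,
      trans (step-active {ts = ts} (placed tt _) (actOn-tapes i (popAction ∘ decodeSymbol) ts))
            (cong (λ x → κ x , Vec.updateAt ts i (λ t → act (popAction (decodeSymbol (scanned t))) t))
              (trans (cong decodeSymbol (Vec.lookup-map i scanned ts)) (proj₁ popped)))
      where
      popped : decodeSymbol (scanned (lookup ts i)) ≡ head (lookup s i) ×
               Holds (drop 1 (lookup s i)) (act (popAction (decodeSymbol (scanned (lookup ts i)))) (lookup ts i))
      popped = holds-pop (lookup s i) (lookup ts i) (rep i)
      rep′ : Represents (Vec.updateAt s i (drop 1))
               (Vec.updateAt ts i (λ t → act (popAction (decodeSymbol (scanned t))) t))
      rep′ = represents-update {s} {ts} i rep (proj₂ popped)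
    simulation N (p >>= f) placed {s} rep =
      simulates-continue (eval N p s) (simulation N p (λ l → placed (inj₁ l)) rep)
        λ a s′ ts′ _ rep′ → simulates-prefix (eval N (f a) s′) 0 refl (≤total (λ a → cost N (f a)) a)
          (simulation N (f a) (λ l → placed (inj₂ (a , l))) rep′)
    simulation N (iter f a) placed rep = simulation-loop N f placed N a rep

    simulation-loop N f placed zero a rep = tt
    simulation-loop N f {ι} {κ} placed (suc m) a {s} {ts} rep =
      -- The single step from the loop head into the body is the `suc` in the cost of a round.
      simulates-prefix (loop (suc m) (λ a′ → eval N (f a′)) a s) 1
        (step-active {ts = ts} (placed (a , nothing) _) (keep-id ts)) (s≤s ≤-refl)
        (simulates-continue (eval N (f a) s)
          (simulates-prefix (eval N (f a) s) 0 refl (≤total (λ a′ → cost N (f a′)) a)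
            (simulation N (f a) (λ l → placed (a , just l)) rep))
          λ { (inj₁ a′) s′ ts′ _ rep′ → simulation-loop N f placed m a′ rep′
            ; (inj₂ b) s′ ts′ _ rep′ → 0 , z≤n , ts′ , rep′ , refl })

    initial-represents : ∀ w → Represents (inputStore w) (proj₂ (initial w))
    initial-represents w (suc i) = subst₂ Holds
      (sym (Vec.lookup-replicate i [])) (sym (Vec.lookup-replicate i blankTape)) refl
    initial-represents []      zero = refl
    initial-represents (b ∷ w) zero = refl , cells w
      where
      cells : ∀ w → Cells (map inj₁ w) (map bit w)
      cells []      = tt
      cells (b ∷ w) = refl , cells w

    -- The simulation halts after some `t` steps below the cost. Halting configurations are
    -- stationary, so the remaining steps up to exactly `cost N main` change nothing.
    machine-correct : ∀ N w b → FinalVerdict (eval N main (inputStore w)) b →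
                      finalState (cost N main) w ≡ verdict b
    machine-correct N w b fv =
      extract (eval N main (inputStore w)) fv
        (simulation N main (λ l v → refl) (initial-represents w))
      where
      finish : ∀ b {t c ts} → t ≤ cost N main → run t c ≡ (verdict b , ts) →
               proj₁ (run (cost N main) c) ≡ verdict b
      finish b {t} {c} t≤ eq = cong proj₁ (begin
        run (cost N main) c                    ≡⟨ cong (λ n → run n c) (m+[n∸m]≡n t≤) ⟨
        run (t + (cost N main ∸ t)) c          ≡⟨ run-+ t _ c ⟩
        run (cost N main ∸ t) (run t c)        ≡⟨ cong (run (cost N main ∸ t)) eq ⟩
        run (cost N main ∸ t) (verdict b , _)  ≡⟨ halted-run (cost N main ∸ t) b _ ⟩
        (verdict b , _)                        ∎)
        where open ≡-Reasoning
      extract : ∀ r → FinalVerdict r b → Simulates r verdict (cost N main) (initial w) →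
                finalState (cost N main) w ≡ verdict b
      extract (done .b s) refl (t , t≤ , ts , rep , eq) = finish b t≤ eq
      extract failed      refl (t , t≤ , ts , eq)       = finish false t≤ eq

-- Digitwise arithmetic

bitValue : Bool → ℕ
bitValue false = 0
bitValue true  = 1

bitValue≤1 : ∀ b → bitValue b ≤ 1
bitValue≤1 false = z≤n
bitValue≤1 true  = ≤-refl

value : List Bool → ℕ
value []       = 0
value (b ∷ bs) = bitValue b + 2 * value bs

-- A digitwise operation that scans two numbers from the least significant
-- digit on, passing a carry along.  With `pad` the output is extended beyond
-- the first operand, and by a final carry.
record Digitwise : Set where
  field
    pad        : Bool
    next emit : Bool → Bool → Bool → Bool

  carry : Bool → List Bool → List Bool → Bool
  carry c []       []       = c
  carry c []       (b ∷ bs) = carry (next c false b) [] bs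
  carry c (a ∷ as) []       = carry (next c a false) as []
  carry c (a ∷ as) (b ∷ bs) = carry (next c a b) as bs

  digitsOut : Bool → List Bool → List Bool → List Bool
  digitsOut c []       []       = if pad ∧ c then true ∷ [] else []
  digitsOut c []       (b ∷ bs) =
    if pad then emit c false b ∷ digitsOut (next c false b) [] bs else digitsOut (next c false b) [] bs
  digitsOut c (a ∷ as) []       = emit c a false ∷ digitsOut (next c a false) as []
  digitsOut c (a ∷ as) (b ∷ bs) = emit c a b ∷ digitsOut (next c a b) as bs

open Digitwise using (carry; digitsOut)

majority : Bool → Bool → Bool → Bool
majority a b c = if a then b ∨ c else b ∧ c

-- The carry is, in turn, the carry, the borrow, the truth of equality so far, and the result of the
-- comparison so far, which a later and hence more significant digit overrides. The two comparisons
-- emit the digits of the first operand, so that comparing leaves it intact.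
adder subtractor equality order : Digitwise
adder      = record { pad = true  ; next = λ c a b → majority c a b       ; emit = λ c a b → c xor (a xor b) }
subtractor = record { pad = false ; next = λ c a b → majority c (not a) b ; emit = λ c a b → c xor (a xor b) }
equality   = record { pad = false ; next = λ c a b → c ∧ not (a xor b)    ; emit = λ c a b → a }
order      = record { pad = false ; next = λ c a b → if a xor b then b else c ; emit = λ c a b → a }

add sub : List Bool → List Bool → List Bool
add = digitsOut adder false
sub = digitsOut subtractor false

borrow eqBits leqBits : List Bool → List Bool → Bool
borrow  = carry subtractor false
eqBits  = carry equality true
leqBits = carry order true

shiftAdd : List Bool → Bool → List Bool → List Bool
shiftAdd bs false ds = false ∷ ds
shiftAdd bs true  ds = add (false ∷ ds) bs

-- Horner's scheme in the digits of the first factor: double the product of the higher digits, then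
-- add `bs` if the current digit is 1.
mul : List Bool → List Bool → List Bool
mul []       bs = []
mul (a ∷ as) bs = shiftAdd bs a (mul as bs)

-- Cancels common factors 2 until the divisor is odd, as `oddQuotient` requires. It fails if the
-- divisor is 0, or if a nonzero dividend has fewer factors 2 than the divisor. An exhausted
-- dividend is 0 and stays 0.
strip : List Bool → List Bool → Maybe (List Bool × List Bool)
strip as           []           = nothing
strip as           (true ∷ bs)  = just (as , true ∷ bs)
strip []           (false ∷ bs) = strip [] bs
strip (false ∷ as) (false ∷ bs) = strip as bs
strip (true ∷ as)  (false ∷ bs) = nothing

-- Exact division by an odd number from the least significant digit on: the
-- lowest digit of the quotient is that of the dividend.
oddQuotient : ℕ → List Bool → List Bool → Maybe (List Bool)
oddQuotient n       []           bs = just []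
-- The fuel has run out, which does not happen if `n` is at least `length as`.
oddQuotient zero    (a ∷ as)     bs = nothing
oddQuotient (suc n) (false ∷ as) bs = Maybe.map (false ∷_) (oddQuotient n as bs)
oddQuotient (suc n) (true ∷ as)  bs =
  if borrow (true ∷ as) bs then nothing
  -- In use both numbers are odd, so the lowest digit of the difference is 0 and dropping it halves
  -- the difference. Subtraction keeps the length, so the dividend gets shorter by one digit, in
  -- step with the fuel.
  else Maybe.map (true ∷_) (oddQuotient n (drop 1 (sub (true ∷ as) bs)) bs)

div : List Bool → List Bool → Maybe (List Bool)
div as bs = strip as bs Maybe.>>= λ (as′ , bs′) → oddQuotient (length as′) as′ bs′

full-adder : ∀ c a b → bitValue (c xor (a xor b)) + 2 * bitValue (majority c a b) ≡
             bitValue c + bitValue a + bitValue b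
full-adder false false false = refl
full-adder false false true  = refl
full-adder false true  false = refl
full-adder false true  true  = refl
full-adder true  false false = refl
full-adder true  false true  = refl
full-adder true  true  false = refl
full-adder true  true  true  = refl

full-subtractor : ∀ c a b → bitValue a + 2 * bitValue (majority c (not a) b) ≡
                  bitValue b + bitValue c + bitValue (c xor (a xor b))
full-subtractor false false false = refl
full-subtractor false false true  = refl
full-subtractor false true  false = refl
full-subtractor false true  true  = refl
full-subtractor true  false false = refl
full-subtractor true  false true  = refl
full-subtractor true  true  false = refl
full-subtractor true  true  true  = refl

add-step : ∀ c a b v x y →
           v ≡ bitValue (majority c a b) + x + y →
           bitValue (c xor (a xor b)) + 2 * v ≡
           bitValue c + (bitValue a + 2 * x) + (bitValue b + 2 * y)
add-step c a b v x y refl = begin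
  d + 2 * (m + x + y)           ≡⟨ lemma₁ d m x y ⟩
  (d + 2 * m) + 2 * x + 2 * y   ≡⟨ cong (λ z → z + 2 * x + 2 * y) (full-adder c a b) ⟩
  bitValue c + bitValue a + bitValue b + 2 * x + 2 * y
    ≡⟨ lemma₂ (bitValue c) (bitValue a) (bitValue b) x y ⟩
  bitValue c + (bitValue a + 2 * x) + (bitValue b + 2 * y) ∎
  where
  open ≡-Reasoning
  d m : ℕ
  d = bitValue (c xor (a xor b))
  m = bitValue (majority c a b)
  lemma₁ : ∀ d m x y → d + 2 * (m + x + y) ≡ (d + 2 * m) + 2 * x + 2 * y
  lemma₁ = solve-∀
  lemma₂ : ∀ c a b x y → c + a + b + 2 * x + 2 * y ≡ c + (a + 2 * x) + (b + 2 * y)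
  lemma₂ = solve-∀

value-output-adder : ∀ c as bs → value (digitsOut adder c as bs) ≡ bitValue c + value as + value bs
value-output-adder false []       []       = refl
value-output-adder true  []       []       = refl
value-output-adder c     []       (b ∷ bs) =
  add-step c false b (value (digitsOut adder (majority c false b) [] bs)) 0 (value bs)
    (value-output-adder _ [] bs)
value-output-adder c     (a ∷ as) []       = 
  add-step c a false (value (digitsOut adder (majority c a false) as [])) (value as) 0
    (value-output-adder _ as [])
value-output-adder c     (a ∷ as) (b ∷ bs) =
  add-step c a b (value (digitsOut adder (majority c a b) as bs)) (value as) (value bs)
    (value-output-adder _ as bs)

value-add : ∀ as bs → value (add as bs) ≡ value as + value bs
value-add = value-output-adder false

-- A final borrow signals that the subtrahend is larger; the digits produced are then meaningless
-- and only the strict inequality is kept.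
Difference : Bool → ℕ → ℕ → ℕ → Set
Difference false x y z = x ≡ y + z
Difference true  x y z = x < y

sub-step : ∀ c a b r x y z →
           Difference r x (y + bitValue (majority c (not a) b)) z →
           Difference r (bitValue a + 2 * x) (bitValue b + 2 * y + bitValue c)
                      (bitValue (c xor (a xor b)) + 2 * z)
sub-step c a b false x y z refl = begin
  bitValue a + 2 * (y + m + z)                    ≡⟨ lemma₁ (bitValue a) y m z ⟩
  (bitValue a + 2 * m) + 2 * y + 2 * z
    ≡⟨ cong (λ t → t + 2 * y + 2 * z) (full-subtractor c a b) ⟩
  bitValue b + bitValue c + d + 2 * y + 2 * z     ≡⟨ lemma₂ (bitValue b) (bitValue c) d y z ⟩
  bitValue b + 2 * y + bitValue c + (d + 2 * z)   ∎
  where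
  open ≡-Reasoning
  d m : ℕ
  d = bitValue (c xor (a xor b))
  m = bitValue (majority c (not a) b)
  lemma₁ : ∀ a y m z → a + 2 * (y + m + z) ≡ (a + 2 * m) + 2 * y + 2 * z
  lemma₁ = solve-∀
  lemma₂ : ∀ b c d y z → b + c + d + 2 * y + 2 * z ≡ b + 2 * y + c + (d + 2 * z)
  lemma₂ = solve-∀
sub-step c a b true x y z x< = +-cancelʳ-≤ 1 _ _ (begin
  suc (bitValue a + 2 * x) + 1              ≡⟨ lemma₁ (bitValue a) x ⟩
  bitValue a + 2 * suc x                    ≤⟨ +-monoʳ-≤ (bitValue a) (*-monoʳ-≤ 2 x<) ⟩
  bitValue a + 2 * (y + m)                  ≡⟨ lemma₂ (bitValue a) y m ⟩
  (bitValue a + 2 * m) + 2 * y              ≡⟨ cong (_+ 2 * y) (full-subtractor c a b) ⟩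
  bitValue b + bitValue c + d + 2 * y       ≡⟨ lemma₃ (bitValue b) (bitValue c) d y ⟩
  bitValue b + 2 * y + bitValue c + d
    ≤⟨ +-monoʳ-≤ (bitValue b + 2 * y + bitValue c) (bitValue≤1 (c xor (a xor b))) ⟩
  bitValue b + 2 * y + bitValue c + 1       ∎)
  where
  open ≤-Reasoning
  d m : ℕ
  d = bitValue (c xor (a xor b))
  m = bitValue (majority c (not a) b)
  lemma₁ : ∀ a x → suc (a + 2 * x) + 1 ≡ a + 2 * suc x
  lemma₁ = solve-∀
  lemma₂ : ∀ a y m → a + 2 * (y + m) ≡ (a + 2 * m) + 2 * y
  lemma₂ = solve-∀
  lemma₃ : ∀ b c d y → b + c + d + 2 * y ≡ b + 2 * y + c + d
  lemma₃ = solve-∀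

-- Past the end of the minuend the subtractor emits nothing, so `z` stays the same on both sides,
-- unlike in `sub-step`. Without a final borrow the remaining digits of the subtrahend must all be
-- 0.
sub-step-[] : ∀ c b r y z → Difference r 0 (y + bitValue (majority c true b)) z →
              Difference r 0 (bitValue b + 2 * y + bitValue c) z
sub-step-[] false false false zero    zero    d = refl
sub-step-[] false true  false zero    z       ()
sub-step-[] true  b     false zero    z       ()
sub-step-[] c     false true  (suc y) z       d = s≤s z≤n
sub-step-[] true  false true  zero    z       d = s≤s z≤n
sub-step-[] c     true  true  y       z       d = s≤s z≤n

difference-carry : ∀ c as bs → Difference (carry subtractor c as bs) (value as)
                     (value bs + bitValue c) (value (digitsOut subtractor c as bs))
difference-carry false []       []       = refl
difference-carry true  []       []       = s≤s z≤n
difference-carry c     []       (b ∷ bs) =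
  sub-step-[] c b (carry subtractor (majority c true b) [] bs) (value bs) _ (difference-carry _ [] bs)
difference-carry c     (a ∷ as) []       =
  sub-step c a false (carry subtractor (majority c (not a) false) as []) (value as) 0 _
    (difference-carry _ as [])
difference-carry c     (a ∷ as) (b ∷ bs) =
  sub-step c a b (carry subtractor (majority c (not a) b) as bs) (value as) (value bs) _
    (difference-carry _ as bs)

difference : ∀ as bs → Difference (borrow as bs) (value as) (value bs) (value (sub as bs))
difference as bs = subst (λ y → Difference (borrow as bs) (value as) y (value (sub as bs)))
                         (+-identityʳ (value bs)) (difference-carry false as bs)

length-output-adder : ∀ c as bs {n} → length as ≤ n → length bs ≤ n →
                      length (digitsOut adder c as bs) ≤ suc n
length-output-adder false []       []       as≤       bs≤       = z≤n
length-output-adder true  []       []       as≤       bs≤       = s≤s z≤n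
length-output-adder c     []       (b ∷ bs) as≤       (s≤s bs≤) = s≤s (length-output-adder _ [] bs z≤n bs≤)
length-output-adder c     (a ∷ as) []       (s≤s as≤) bs≤       = s≤s (length-output-adder _ as [] as≤ z≤n)
length-output-adder c     (a ∷ as) (b ∷ bs) (s≤s as≤) (s≤s bs≤) = s≤s (length-output-adder _ as bs as≤ bs≤)

length-sub : ∀ c as bs → length (digitsOut subtractor c as bs) ≡ length as
length-sub c []       []       = refl
length-sub c []       (b ∷ bs) = length-sub _ [] bs
length-sub c (a ∷ as) []       = cong suc (length-sub _ as [])
length-sub c (a ∷ as) (b ∷ bs) = cong suc (length-sub _ as bs)

equality-output : ∀ c as bs → digitsOut equality c as bs ≡ as
equality-output c []       []       = refl
equality-output c []       (b ∷ bs) = equality-output _ [] bs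
equality-output c (a ∷ as) []       = cong (a ∷_) (equality-output _ as [])
equality-output c (a ∷ as) (b ∷ bs) = cong (a ∷_) (equality-output _ as bs)

order-output : ∀ c as bs → digitsOut order c as bs ≡ as
order-output c []       []       = refl
order-output c []       (b ∷ bs) = order-output _ [] bs
order-output c (a ∷ as) []       = cong (a ∷_) (order-output _ as [])
order-output c (a ∷ as) (b ∷ bs) = cong (a ∷_) (order-output _ as bs)

odd≢even : ∀ x y → 1 + 2 * x ≢ 2 * y
odd≢even x       zero    ()
odd≢even zero    (suc y) eq with trans (suc-injective eq) (+-suc y (y + 0))
... | ()
odd≢even (suc x) (suc y) eq = odd≢even x y
  (suc-injective (suc-injective (trans (sym (cong suc (double x))) (trans eq (double y)))))
  where
  double : ∀ x → 2 * suc x ≡ suc (suc (2 * x))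
  double = solve-∀

halve : ∀ {x y} → 2 * x ≡ 2 * y → x ≡ y
halve = *-cancelˡ-≡ _ _ 2

EqualTo : Bool → Bool → ℕ → ℕ → Set
EqualTo c r x y = (r ≡ true → c ≡ true × x ≡ y) × (c ≡ true → x ≡ y → r ≡ true)

equal-step : ∀ c a b r x y → EqualTo (c ∧ not (a xor b)) r x y →
             EqualTo c r (bitValue a + 2 * x) (bitValue b + 2 * y)
equal-step false a b r x y (sound , complete) =
  (λ eq → contradiction (proj₁ (sound eq)) λ ()) , λ ()
equal-step true false false r x y (sound , complete) =
  (λ eq → refl , cong (2 *_) (proj₂ (sound eq))) , λ _ eq → complete refl (halve eq)
equal-step true false true  r x y (sound , complete) =
  (λ eq → contradiction (proj₁ (sound eq)) λ ()) , λ _ eq → ⊥-elim (odd≢even y x (sym eq))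
equal-step true true  false r x y (sound , complete) =
  (λ eq → contradiction (proj₁ (sound eq)) λ ()) , λ _ eq → ⊥-elim (odd≢even x y eq)
equal-step true true  true  r x y (sound , complete) =
  (λ eq → refl , cong (λ z → suc (2 * z)) (proj₂ (sound eq))) ,
  λ _ eq → complete refl (halve (suc-injective eq))

equal-carry : ∀ c as bs → EqualTo c (carry equality c as bs) (value as) (value bs)
equal-carry c []       []       = (λ eq → eq , refl) , λ eq _ → eq
equal-carry c []       (b ∷ bs) = equal-step c false b _ 0 (value bs) (equal-carry _ [] bs)
equal-carry c (a ∷ as) []       = equal-step c a false _ (value as) 0 (equal-carry _ as [])
equal-carry c (a ∷ as) (b ∷ bs) = equal-step c a b _ (value as) (value bs) (equal-carry _ as bs)

eqBits-sound : ∀ as bs → eqBits as bs ≡ true → value as ≡ value bs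
eqBits-sound as bs eq = proj₂ (proj₁ (equal-carry true as bs) eq)

eqBits-complete : ∀ as bs → value as ≡ value bs → eqBits as bs ≡ true
eqBits-complete as bs = proj₂ (equal-carry true as bs) refl

-- A single formula for both comparisons: `x < y + bitValue c` is `x < y` for `c = false` and
-- `x ≤ y` for `c = true`. The initial carry thus selects the relation that is decided.
Below : Bool → Bool → ℕ → ℕ → Set
Below c r x y = (r ≡ true → x < y + bitValue c) × (x < y + bitValue c → r ≡ true)

below-refl : ∀ c → Below c c 0 0
below-refl false = (λ ()) , λ ()
below-refl true  = (λ _ → s≤s z≤n) , λ _ → refl

below-step : ∀ c a b r x y → Below (if a xor b then b else c) r x y →
             Below c r (bitValue a + 2 * x) (bitValue b + 2 * y)
below-step c false true r x y (sound , complete) =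
  (λ eq → s≤s (≤-trans (*-monoʳ-≤ 2 (x≤ (sound eq))) (m≤m+n _ (bitValue c)))) ,
  λ lt → complete (subst (x <_) (+-comm 1 y) (s≤s (half-≤ c lt)))
  where
  x≤ : x < y + 1 → x ≤ y
  x≤ lt = s≤s⁻¹ (subst (x <_) (+-comm y 1) lt)
  half-≤ : ∀ c → 2 * x < 1 + 2 * y + bitValue c → x ≤ y
  half-≤ c lt = ≮⇒≥ λ y< → <⇒≱ lt (begin
    1 + 2 * y + bitValue c  ≤⟨ +-monoʳ-≤ (1 + 2 * y) (bitValue≤1 c) ⟩
    1 + 2 * y + 1           ≡⟨ double y ⟩
    2 * suc y               ≤⟨ *-monoʳ-≤ 2 y< ⟩
    2 * x                   ∎)
    where
    open ≤-Reasoning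
    double : ∀ y → 1 + 2 * y + 1 ≡ 2 * suc y
    double = solve-∀
below-step c true false r x y (sound , complete) =
  (λ eq → ≤-trans (≤-trans (≤-reflexive (double x)) (*-monoʳ-≤ 2 (x< (sound eq)))) (m≤m+n _ (bitValue c))) ,
  λ lt → complete (subst (x <_) (sym (+-identityʳ y)) (half c lt))
  where
  double : ∀ x → suc (1 + 2 * x) ≡ 2 * suc x
  double = solve-∀
  x< : x < y + 0 → x < y
  x< = subst (x <_) (+-identityʳ y)
  half : ∀ c → 1 + 2 * x < 2 * y + bitValue c → x < y
  half c lt = ≰⇒> λ y≤ → <⇒≱ lt (≤-trans (+-mono-≤ (*-monoʳ-≤ 2 y≤) (bitValue≤1 c))
                                         (≤-reflexive (+-comm (2 * x) 1)))
below-step false false false r x y (sound , complete) =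
  (λ eq → subst (2 * x <_) (sym (+-identityʳ _)) (*-monoʳ-< 2 (subst (x <_) (+-identityʳ y) (sound eq)))) ,
  λ lt → complete (subst (x <_) (sym (+-identityʳ y)) (*-cancelˡ-< 2 _ _ (subst (2 * x <_) (+-identityʳ _) lt)))
below-step true false false r x y (sound , complete) =
  (λ eq → subst (2 * x <_) (+-comm 1 _) (s≤s (*-monoʳ-≤ 2 (s≤s⁻¹ (subst (x <_) (+-comm y 1) (sound eq)))))) ,
  λ lt → complete (subst (x <_) (+-comm 1 y) (s≤s (*-cancelˡ-≤ 2 (s≤s⁻¹ (subst (2 * x <_) (+-comm _ 1) lt)))))
below-step false true true r x y (sound , complete) =
  (λ eq → s≤s (subst (2 * x <_) (sym (+-identityʳ _)) (*-monoʳ-< 2 (subst (x <_) (+-identityʳ y) (sound eq))))) ,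
  λ lt → complete (subst (x <_) (sym (+-identityʳ y)) (*-cancelˡ-< 2 _ _ (subst (2 * x <_) (+-identityʳ _) (s≤s⁻¹ lt))))
below-step true true true r x y (sound , complete) =
  (λ eq → s≤s (subst (2 * x <_) (+-comm 1 _) (s≤s (*-monoʳ-≤ 2 (s≤s⁻¹ (subst (x <_) (+-comm y 1) (sound eq))))))) ,
  λ lt → complete (subst (x <_) (+-comm 1 y) (s≤s (*-cancelˡ-≤ 2 (s≤s⁻¹ (subst (2 * x <_) (+-comm _ 1) (s≤s⁻¹ lt))))))

below-carry : ∀ c as bs → Below c (carry order c as bs) (value as) (value bs)
below-carry c []       []       = below-refl c
below-carry c []       (b ∷ bs) = below-step c false b _ 0 (value bs) (below-carry _ [] bs)
below-carry c (a ∷ as) []       = below-step c a false _ (value as) 0 (below-carry _ as [])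
below-carry c (a ∷ as) (b ∷ bs) = below-step c a b _ (value as) (value bs) (below-carry _ as bs)

leqBits-sound : ∀ as bs → leqBits as bs ≡ true → value as ≤ value bs
leqBits-sound as bs eq =
  s≤s⁻¹ (subst (value as <_) (+-comm (value bs) 1) (proj₁ (below-carry true as bs) eq))

leqBits-complete : ∀ as bs → value as ≤ value bs → leqBits as bs ≡ true
leqBits-complete as bs le =
  proj₂ (below-carry true as bs) (subst (value as <_) (+-comm 1 (value bs)) (s≤s le))

value-mul : ∀ as bs → value (mul as bs) ≡ value as * value bs
value-mul []           bs = refl
value-mul (false ∷ as) bs = trans (cong (2 *_) (value-mul as bs)) (sym (*-assoc 2 (value as) (value bs)))
value-mul (true ∷ as)  bs = begin
  value (add (false ∷ mul as bs) bs)   ≡⟨ value-add (false ∷ mul as bs) bs ⟩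
  2 * value (mul as bs) + value bs     ≡⟨ cong (λ v → 2 * v + value bs) (value-mul as bs) ⟩
  2 * (value as * value bs) + value bs ≡⟨ lemma (value as) (value bs) ⟩
  (1 + 2 * value as) * value bs        ∎
  where
  open ≡-Reasoning
  lemma : ∀ x y → 2 * (x * y) + y ≡ (1 + 2 * x) * y
  lemma = solve-∀

length-mul : ∀ as bs → length (mul as bs) ≤ 2 * length as + length bs
length-mul []           bs = z≤n
length-mul (false ∷ as) bs = ≤-trans (s≤s (length-mul as bs))
  (+-monoˡ-≤ (length bs) (≤-trans (n≤1+n _) (≤-reflexive (double (length as)))))
  where
  double : ∀ x → suc (suc (2 * x)) ≡ 2 * suc x
  double = solve-∀
length-mul (true ∷ as)  bs = ≤-trans
  (length-output-adder false (false ∷ mul as bs) bs (s≤s (length-mul as bs)) (m≤n+m (length bs) (suc (2 * length as))))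
  (≤-reflexive (double (length as) (length bs)))
  where
  double : ∀ x y → suc (suc (2 * x + y)) ≡ 2 * suc x + y
  double = solve-∀

-- Divisor 0 is answered by `nothing`, in agreement with `_⊘_`, where such a division contributes no
-- element.
Quotient : ℕ → ℕ → Maybe (List Bool) → Set
Quotient a b (just cs) = b ≢ 0 × a ≡ value cs * b
Quotient a b nothing   = b ≢ 0 → ∀ c → a ≢ c * b

quotient-double : ∀ a b r → Quotient a b r → Quotient (2 * a) (2 * b) r
quotient-double a b (just cs) (b≢0 , refl) =
  (λ eq → b≢0 (halve {b} {0} eq)) , lemma (value cs) b
  where
  lemma : ∀ c b → 2 * (c * b) ≡ c * (2 * b)
  lemma = solve-∀
quotient-double a b nothing none 2b≢0 c eq =
  none (λ { refl → 2b≢0 refl }) c (halve (trans eq (lemma c b)))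
  where
  lemma : ∀ c b → c * (2 * b) ≡ 2 * (c * b)
  lemma = solve-∀

evenOrOdd : ∀ c → (∃[ d ] c ≡ 2 * d) ⊎ (∃[ d ] c ≡ 1 + 2 * d)
evenOrOdd zero = inj₁ (0 , refl)
evenOrOdd (suc c) with evenOrOdd c
... | inj₁ (d , refl) = inj₂ (d , refl)
... | inj₂ (d , refl) = inj₁ (suc d , lemma d)
  where
  lemma : ∀ d → suc (1 + 2 * d) ≡ 2 * suc d
  lemma = solve-∀

-- For an odd divisor the quotient has the parity of the dividend. An even quotient can be halved
-- along with the dividend, while an odd one would make the product odd, by (1 + 2d)(1 + 2y) = 1 +
-- 2(d + y + 2dy).
even-quotient : ∀ x y r → Quotient x (1 + 2 * y) r →
                Quotient (2 * x) (1 + 2 * y) (Maybe.map (false ∷_) r)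
even-quotient x y (just cs) (b≢0 , eq) =
  b≢0 , trans (cong (2 *_) eq) (sym (*-assoc 2 (value cs) (1 + 2 * y)))
even-quotient x y nothing none b≢0 c eq with evenOrOdd c
... | inj₁ (d , refl) = none b≢0 d (halve (trans eq (*-assoc 2 d (1 + 2 * y))))
... | inj₂ (d , refl) = odd≢even (d + y + 2 * (d * y)) x (trans (lemma d y) (sym eq))
  where
  lemma : ∀ d y → 1 + 2 * (d + y + 2 * (d * y)) ≡ (1 + 2 * d) * (1 + 2 * y)
  lemma = solve-∀

-- The product is odd, so any quotient has the form 1 + 2d. Subtracting the divisor once leaves 2d
-- times the divisor, hence `d` is a quotient for half of the difference.
odd-quotient : ∀ x y z r → 1 + 2 * x ≡ (1 + 2 * y) + 2 * z → Quotient z (1 + 2 * y) r →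
               Quotient (1 + 2 * x) (1 + 2 * y) (Maybe.map (true ∷_) r)
odd-quotient x y z (just cs) eq (b≢0 , refl) =
  b≢0 , trans eq (lemma (value cs) (1 + 2 * y))
  where
  lemma : ∀ c b → b + 2 * (c * b) ≡ (1 + 2 * c) * b
  lemma = solve-∀
odd-quotient x y z nothing eq none b≢0 c eq′ with evenOrOdd c
... | inj₁ (d , refl) = odd≢even x (d * (1 + 2 * y)) (trans eq′ (*-assoc 2 d (1 + 2 * y)))
... | inj₂ (d , refl) = none b≢0 d (halve (+-cancelˡ-≡ (1 + 2 * y) _ _
        (trans (trans (sym eq) eq′) (lemma d (1 + 2 * y)))))
  where
  lemma : ∀ d b → (1 + 2 * d) * b ≡ b + 2 * (d * b)
  lemma = solve-∀

-- The dividend is odd, hence not the multiple 0, and every other multiple of `b` is at least `b`.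
small-quotient : ∀ x b → 1 + 2 * x < b → Quotient (1 + 2 * x) b nothing
small-quotient x b lt b≢0 zero    ()
small-quotient x b lt b≢0 (suc c) eq = <⇒≱ lt (≤-trans (m≤m+n b (c * b)) (≤-reflexive (sym eq)))

oddQuotient-correct : ∀ n as bs → length as ≤ n →
  Quotient (value as) (value (true ∷ bs)) (oddQuotient n as (true ∷ bs))
oddQuotient-correct n       []           bs len = (λ ()) , refl
oddQuotient-correct (suc n) (false ∷ as) bs (s≤s len) =
  even-quotient (value as) (value bs) _ (oddQuotient-correct n as bs len)
oddQuotient-correct (suc n) (true ∷ as)  bs (s≤s len)
  with borrow (true ∷ as) (true ∷ bs) | difference (true ∷ as) (true ∷ bs)
... | true  | lt = small-quotient (value as) (value (true ∷ bs)) lt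
... | false | eq = odd-quotient (value as) (value bs) (value (digitsOut subtractor false as bs)) _ eq
  (oddQuotient-correct n (digitsOut subtractor false as bs) bs
    (≤-trans (≤-reflexive (length-sub false as bs)) len))

div-correct : ∀ as bs → Quotient (value as) (value bs) (div as bs)
div-correct as           []           = λ b≢0 → ⊥-elim (b≢0 refl)
div-correct as           (true ∷ bs)  = oddQuotient-correct (length as) as bs ≤-refl
div-correct []           (false ∷ bs) = quotient-double 0 (value bs) (div [] bs) (div-correct [] bs)
div-correct (false ∷ as) (false ∷ bs) = quotient-double (value as) (value bs) (div as bs) (div-correct as bs)
div-correct (true ∷ as)  (false ∷ bs) = λ _ c eq → odd≢even (value as) (c * value bs) (trans eq (lemma c (value bs)))
  where
  lemma : ∀ c b → c * (2 * b) ≡ 2 * (c * b)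
  lemma = solve-∀

Shorter : ℕ → Maybe (List Bool) → Set
Shorter n r = ∀ {cs} → r ≡ just cs → length cs ≤ n

length-oddQuotient : ∀ n as bs → Shorter (length as) (oddQuotient n as bs)
length-oddQuotient n       []           bs refl = z≤n
length-oddQuotient (suc n) (false ∷ as) bs eq
  with oddQuotient n as bs | length-oddQuotient n as bs
length-oddQuotient (suc n) (false ∷ as) bs refl | just cs | le = s≤s (le refl)
length-oddQuotient (suc n) (true ∷ as)  bs eq with borrow (true ∷ as) bs
... | false
  with oddQuotient n (drop 1 (sub (true ∷ as) bs)) bs
     | length-oddQuotient n (drop 1 (sub (true ∷ as) bs)) bs
length-oddQuotient (suc n) (true ∷ as) bs refl | false | just cs | le =
  s≤s (≤-trans (le refl) (≤-reflexive (length-rest bs)))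
  where
  length-rest : ∀ bs → length (drop 1 (sub (true ∷ as) bs)) ≡ length as
  length-rest []       = length-sub _ as []
  length-rest (b ∷ bs) = length-sub _ as bs

length-div : ∀ as bs → Shorter (length as) (div as bs)
length-div as           (true ∷ bs)  eq = length-oddQuotient (length as) as (true ∷ bs) eq
length-div []           (false ∷ bs) eq = length-div [] bs eq
length-div (false ∷ as) (false ∷ bs) eq = ≤-trans (length-div as bs eq) (n≤1+n _)

-- Binary notation

value-increment : ∀ ds → value (increment ds) ≡ suc (value ds)
value-increment []           = refl
value-increment (false ∷ ds) = refl
value-increment (true ∷ ds)  = trans (cong (2 *_) (value-increment ds)) (lemma (value ds))
  where
  lemma : ∀ x → 2 * suc x ≡ suc (1 + 2 * x)
  lemma = solve-∀

value-binaryDigits : ∀ n → value (binaryDigits n) ≡ n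
value-binaryDigits zero    = refl
value-binaryDigits (suc n) = trans (value-increment (binaryDigits n)) (cong suc (value-binaryDigits n))

-- Two increments of `false ∷ ds` amount to one increment of `ds`. The induction starts at 1,
-- because 0 is written with a digit of its own and doubling it adds none.
binaryDigits-even : ∀ n → binaryDigits (2 * suc n) ≡ false ∷ binaryDigits (suc n)
binaryDigits-even zero    = refl
binaryDigits-even (suc n) = trans (cong binaryDigits (lemma n))
                                  (cong (increment ∘ increment) (binaryDigits-even n))
  where
  lemma : ∀ n → 2 * suc (suc n) ≡ suc (suc (2 * suc n))
  lemma = solve-∀

binaryDigits-odd : ∀ n → binaryDigits (1 + 2 * suc n) ≡ true ∷ binaryDigits (suc n)
binaryDigits-odd n = cong increment (binaryDigits-even n)

-- Scanning a number digit by digit decides whether it has superfluous zeros: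
-- `low` means that another digit has to follow.
pattern fresh = 0F
pattern nil   = 1F
pattern low   = 2F
pattern high  = 3F

afterDigit : Fin 4 → Bool → Fin 4
afterDigit n     true  = high
afterDigit fresh false = nil
afterDigit _     false = low

afterDigits : Fin 4 → List Bool → Fin 4
afterDigits n []       = n
afterDigits n (d ∷ ds) = afterDigits (afterDigit n d) ds

complete : Fin 4 → Bool
complete fresh = false
complete nil   = true
complete low   = false
complete high  = true

Canonical : Fin 4 → List Bool → Set
Canonical n ds = complete (afterDigits n ds) ≡ true

private
  nil⇒low : ∀ d ds → Canonical nil (d ∷ ds) → Canonical low (d ∷ ds)
  nil⇒low false ds c = c
  nil⇒low true  ds c = c

  high⇒low : ∀ d ds → Canonical high (d ∷ ds) → Canonical low (d ∷ ds)
  high⇒low false ds c = c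
  high⇒low true  ds c = c

  low⇒high : ∀ ds → Canonical low ds → Canonical high ds
  low⇒high (false ∷ ds) c = c
  low⇒high (true ∷ ds)  c = c

  low⇒nil : ∀ ds → Canonical low ds → Canonical nil ds
  low⇒nil (false ∷ ds) c = c
  low⇒nil (true ∷ ds)  c = c

  Positive : List Bool → Set
  Positive ds = ∃[ n ] (ds ≡ binaryDigits (suc n))

  false∷-positive : ∀ {ds} → Positive ds → Positive (false ∷ ds)
  -- `2 * suc n` computes to `suc (n + suc (n + 0))`.
  false∷-positive (n , refl) = n + suc (n + 0) , sym (binaryDigits-even n)

  true∷-positive : ∀ {ds} → Positive ds → Positive (true ∷ ds)
  true∷-positive (n , refl) = 2 * suc n , sym (binaryDigits-odd n)

  canonical-high : ∀ ds → Canonical high ds → Positive (true ∷ ds)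

  canonical-low : ∀ ds → Canonical low ds → Positive ds
  canonical-low (false ∷ ds) c = false∷-positive (canonical-low ds c)
  canonical-low (true ∷ ds)  c = canonical-high ds c

  canonical-high []           c = 0 , refl
  canonical-high (false ∷ ds) c = true∷-positive (false∷-positive (canonical-low ds c))
  canonical-high (true ∷ ds)  c = true∷-positive (canonical-high ds c)

canonical⇒binaryDigits : ∀ ds → Canonical fresh ds → ∃[ n ] (ds ≡ binaryDigits n)
canonical⇒binaryDigits (false ∷ [])     c = 0 , refl
canonical⇒binaryDigits (false ∷ d ∷ ds) c =
  let n , eq = false∷-positive (canonical-low (d ∷ ds) (nil⇒low d ds c)) in suc n , eq
canonical⇒binaryDigits (true ∷ ds)      c = let n , eq = canonical-high ds c in suc n , eq

private
  increment-low : ∀ ds → Canonical low ds → Canonical low (increment ds)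
  increment-high : ∀ ds → Canonical high ds → Canonical low (increment ds)

  increment-low (false ∷ ds) c = low⇒high ds c
  increment-low (true ∷ ds)  c = increment-high ds c

  increment-high []       c = refl
  increment-high (d ∷ ds) c = increment-low (d ∷ ds) (high⇒low d ds c)

  increment-canonical : ∀ ds → Canonical fresh ds → Canonical fresh (increment ds)
  increment-canonical (false ∷ [])     c = refl
  increment-canonical (false ∷ d ∷ ds) c = low⇒high (d ∷ ds) (nil⇒low d ds c)
  increment-canonical (true ∷ ds)      c = low⇒nil (increment ds) (increment-high ds c)

binaryDigits-canonical : ∀ n → Canonical fresh (binaryDigits n)
binaryDigits-canonical zero    = refl
binaryDigits-canonical (suc n) = increment-canonical (binaryDigits n) (binaryDigits-canonical n)

-- The syntax of encoded circuits

-- Gates refer to each other by names only, so a list of gates may contain dangling, repeated or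
-- cyclic references; it is what the syntax alone guarantees. Complement gates are absent because
-- the syntax check rejects them.
data Gate : Set where
  constant : (name label : ℕ) → Gate
  operate  : (σ : BinOp) (p q name : ℕ) → Gate

gateName : Gate → ℕ
gateName (constant n l)    = n
gateName (operate σ p q n) = n

tokensOfGate : Gate → List Token
tokensOfGate (constant n l)    = number n ++ comma ∷ number l ++ comma ∷ semicolon ∷ []
tokensOfGate (operate σ p q n) =
  number n ++ comma ∷ operation (binary σ) ∷ comma ∷
  number p ++ comma ∷ number q ++ comma ∷ semicolon ∷ []

record Listing : Set where
  constructor listing
  field
    outputName : ℕ
    gates      : List Gate
    target     : ℕ

open Listing

tokensOf : Listing → List Token
tokensOf (listing o gs b) = number o ++ semicolon ∷ concatMap tokensOfGate gs ++ number b

constant-++ : ∀ n l gs b →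
  concatMap tokensOfGate (constant n l ∷ gs) ++ number b ≡
  number n ++ comma ∷ number l ++ comma ∷ semicolon ∷ concatMap tokensOfGate gs ++ number b
constant-++ n l gs b = begin
  (tokensOfGate (constant n l) ++ concatMap tokensOfGate gs) ++ number b
    ≡⟨ ++-assoc (tokensOfGate (constant n l)) _ _ ⟩
  tokensOfGate (constant n l) ++ rest
    ≡⟨ ++-assoc (number n) _ _ ⟩
  number n ++ comma ∷ (number l ++ comma ∷ semicolon ∷ []) ++ rest
    ≡⟨ cong (λ ts → number n ++ comma ∷ ts) (++-assoc (number l) _ _) ⟩
  number n ++ comma ∷ number l ++ comma ∷ semicolon ∷ rest ∎
  where
  open ≡-Reasoning
  rest : List Token
  rest = concatMap tokensOfGate gs ++ number b

operate-++ : ∀ σ p q n gs b →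
  concatMap tokensOfGate (operate σ p q n ∷ gs) ++ number b ≡
  number n ++ comma ∷ operation (binary σ) ∷ comma ∷
  number p ++ comma ∷ number q ++ comma ∷ semicolon ∷ concatMap tokensOfGate gs ++ number b
operate-++ σ p q n gs b = begin
  (tokensOfGate (operate σ p q n) ++ concatMap tokensOfGate gs) ++ number b
    ≡⟨ ++-assoc (tokensOfGate (operate σ p q n)) _ _ ⟩
  tokensOfGate (operate σ p q n) ++ rest
    ≡⟨ ++-assoc (number n) _ _ ⟩
  number n ++ comma ∷ operation (binary σ) ∷ comma ∷
    (number p ++ comma ∷ number q ++ comma ∷ semicolon ∷ []) ++ rest
    ≡⟨ cong (λ ts → number n ++ comma ∷ operation (binary σ) ∷ comma ∷ ts)
         (trans (++-assoc (number p) _ _)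
                (cong (λ ts → number p ++ comma ∷ ts) (++-assoc (number q) _ _))) ⟩
  number n ++ comma ∷ operation (binary σ) ∷ comma ∷
    number p ++ comma ∷ number q ++ comma ∷ semicolon ∷ rest ∎
  where
  open ≡-Reasoning
  rest : List Token
  rest = concatMap tokensOfGate gs ++ number b

suffix< : ∀ {A : Set} (xs : List A) {y ys} → length ys < length (xs ++ y ∷ ys)
suffix< []       = ≤-refl
suffix< (x ∷ xs) = ≤-trans (suffix< xs) (n≤1+n _)

module Syntax (allowed : BinOp → Bool) where

  OpAllowed : Gate → Set
  OpAllowed (constant n l)    = ⊤
  OpAllowed (operate σ p q n) = allowed σ ≡ true

  pattern inOutput  = 0F
  pattern inName    = 1F
  pattern inLabel   = 2F
  pattern inFirst   = 3F
  pattern inSecond  = 4F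
  pattern pastOp    = 5F
  pattern pastComma = 6F

  SyntaxState : Set
  SyntaxState = Fin 7 × Fin 4

  inNumber : Fin 7 → Bool
  inNumber pastOp    = false
  inNumber pastComma = false
  inNumber _         = true

  guard : Bool → SyntaxState → Maybe SyntaxState
  guard b s = if b then just s else nothing

  -- The grammar of encodings is regular. The state `pastComma` is shared by constants, after the
  -- label, and by binary gates, after the second predecessor: in both cases only the semicolon may
  -- follow.
  syntaxStep : Fin 7 → Fin 4 → Token → Maybe SyntaxState
  syntaxStep c         n     (operation complement) = nothing
  syntaxStep c         n     (digit d)              = guard (inNumber c) (c , afterDigit n d)
  syntaxStep inOutput  n     semicolon              = guard (complete n) (inName , fresh)
  syntaxStep inName    n     comma                  = guard (complete n) (inLabel , fresh)
  syntaxStep inLabel   n     comma                  = guard (complete n) (pastComma , fresh)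
  -- `fresh` excludes digits in front of the operator.
  syntaxStep inLabel   fresh (operation (binary σ)) = guard (allowed σ) (pastOp , fresh)
  syntaxStep pastOp    n     comma                  = just (inFirst , fresh)
  syntaxStep inFirst   n     comma                  = guard (complete n) (inSecond , fresh)
  syntaxStep inSecond  n     comma                  = guard (complete n) (pastComma , fresh)
  syntaxStep pastComma n     semicolon              = just (inName , fresh)
  syntaxStep _         _     _                      = nothing

  -- The target number at the end of the word looks like the name of a further gate until the word
  -- stops.
  final : Fin 7 → Fin 4 → Bool
  final inName n = complete n
  final _      n = false

  Accepts : Fin 7 → Fin 4 → List Token → Set
  AcceptsFrom : Maybe SyntaxState → List Token → Set
  Accepts c n []       = final c n ≡ true
  Accepts c n (t ∷ ts) = AcceptsFrom (syntaxStep c n t) ts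
  AcceptsFrom nothing        ts = ⊥
  AcceptsFrom (just (c , n)) ts = Accepts c n ts

  private
    guard-true : ∀ {b s ts} → b ≡ true → AcceptsFrom (just s) ts → AcceptsFrom (guard b s) ts
    guard-true refl acc = acc

    guard-inv : ∀ b {s ts} → AcceptsFrom (guard b s) ts → b ≡ true × AcceptsFrom (just s) ts
    guard-inv true acc = refl , acc

    accepts-digits : ∀ {c} → inNumber c ≡ true → ∀ n ds {ts} →
                     Accepts c (afterDigits n ds) ts → Accepts c n (map digit ds ++ ts)
    accepts-digits r n []       acc = acc
    accepts-digits {c} r n (d ∷ ds) {ts} acc =
      guard-true {ts = map digit ds ++ ts} r (accepts-digits r (afterDigit n d) ds acc)

    accepts-number : ∀ {c c′ n′} k {t ts} → inNumber c ≡ true →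
      (∀ n → syntaxStep c n t ≡ guard (complete n) (c′ , n′)) → Accepts c′ n′ ts →
      Accepts c fresh (number k ++ t ∷ ts)
    accepts-number k {t} {ts} r step acc = accepts-digits r fresh (binaryDigits k)
      (subst (λ s → AcceptsFrom s ts) (sym (step (afterDigits fresh (binaryDigits k))))
        (guard-true {ts = ts} (binaryDigits-canonical k) acc))

    accepts-gates : ∀ gs b → All OpAllowed gs →
                    Accepts inName fresh (concatMap tokensOfGate gs ++ number b)
    accepts-gates [] b [] = subst (Accepts inName fresh) (List.++-identityʳ (number b))
      (accepts-digits refl fresh (binaryDigits b) (binaryDigits-canonical b))
    accepts-gates (constant n l ∷ gs) b (_ ∷ ok) =
      subst (Accepts inName fresh) (sym (constant-++ n l gs b))
        (accepts-number n refl (λ _ → refl) (accepts-number l refl (λ _ → refl) (accepts-gates gs b ok)))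
    accepts-gates (operate σ p q n ∷ gs) b (ok₁ ∷ ok) =
      subst (Accepts inName fresh) (sym (operate-++ σ p q n gs b))
        (accepts-number n refl (λ _ → refl)
          (guard-true {ts = comma ∷ number p ++ comma ∷ number q ++ comma ∷ semicolon ∷
                              concatMap tokensOfGate gs ++ number b} ok₁
            (accepts-number p refl (λ _ → refl) (accepts-number q refl (λ _ → refl) (accepts-gates gs b ok)))))

  accepts-tokensOf : ∀ ℓ → All OpAllowed (gates ℓ) → Accepts inOutput fresh (tokensOf ℓ)
  accepts-tokensOf (listing o gs b) ok = accepts-number o refl (λ _ → refl) (accepts-gates gs b ok)

  private
    data Digits? (c : Fin 7) (n : Fin 4) : List Token → Set where
      all  : ∀ ds → final c (afterDigits n ds) ≡ true → Digits? c n (map digit ds)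
      stop : ∀ ds t ts → (∀ d → t ≢ digit d) → Accepts c (afterDigits n ds) (t ∷ ts) →
             Digits? c n (map digit ds ++ t ∷ ts)

    readDigits : ∀ c n ts → Accepts c n ts → Digits? c n ts
    readDigits c n []              acc = all [] acc
    readDigits c n (digit d ∷ ts)  acc
      with guard-inv (inNumber c) {ts = ts} acc
    ... | _ , acc′ with readDigits c (afterDigit n d) ts acc′
    ... | all ds fin         = all (d ∷ ds) fin
    ... | stop ds t ts nd a  = stop (d ∷ ds) t ts nd a
    readDigits c n (operation o ∷ ts) acc = stop [] _ ts (λ _ ()) acc
    readDigits c n (comma ∷ ts)       acc = stop [] _ ts (λ _ ()) acc
    readDigits c n (semicolon ∷ ts)   acc = stop [] _ ts (λ _ ()) acc

    data Ends : Fin 7 → Token → Fin 7 → Set where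
      ofOutput : Ends inOutput semicolon inName
      ofName   : Ends inName comma inLabel
      ofLabel  : Ends inLabel comma pastComma
      ofFirst  : Ends inFirst comma inSecond
      ofSecond : Ends inSecond comma pastComma

    data Number? (c : Fin 7) : List Token → Set where
      last  : ∀ k → c ≡ inName → Number? c (number k)
      ended : ∀ k {t c′} ts → Ends c t c′ → Accepts c′ fresh ts → Number? c (number k ++ t ∷ ts)
      op    : ∀ σ ts → c ≡ inLabel → allowed σ ≡ true → Accepts pastOp fresh ts →
              Number? c (operation (binary σ) ∷ ts)

    canonicalEnd : ∀ {c t c′} ds ts → Ends c t c′ →
                   complete (afterDigits fresh ds) ≡ true × Accepts c′ fresh ts →
                   Number? c (map digit ds ++ t ∷ ts)
    canonicalEnd {c} {t} ds ts e (can , acc) with canonical⇒binaryDigits ds can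
    ... | k , refl = ended k ts e acc

    data Reading : Fin 7 → Set where
      ofOutput : Reading inOutput
      ofName   : Reading inName
      ofLabel  : Reading inLabel
      ofFirst  : Reading inFirst
      ofSecond : Reading inSecond

    readNumber : ∀ {c} → Reading c → ∀ ts → Accepts c fresh ts → Number? c ts
    readNumber {c} r ts acc with readDigits c fresh ts acc
    readNumber ofOutput _ _ | all ds ()
    readNumber ofLabel  _ _ | all ds ()
    readNumber ofFirst  _ _ | all ds ()
    readNumber ofSecond _ _ | all ds ()
    readNumber ofName   _ _ | all ds fin with canonical⇒binaryDigits ds fin
    ... | k , refl = last k refl
    readNumber r      _ _ | stop ds (digit d) ts nd a = ⊥-elim (nd d refl)
    readNumber ofOutput _ _ | stop ds semicolon ts nd a = canonicalEnd ds ts ofOutput (guard-inv _ {ts = ts} a)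
    readNumber ofName   _ _ | stop ds comma     ts nd a = canonicalEnd ds ts ofName (guard-inv _ {ts = ts} a)
    readNumber ofLabel  _ _ | stop ds comma     ts nd a = canonicalEnd ds ts ofLabel (guard-inv _ {ts = ts} a)
    readNumber ofFirst  _ _ | stop ds comma     ts nd a = canonicalEnd ds ts ofFirst (guard-inv _ {ts = ts} a)
    readNumber ofSecond _ _ | stop ds comma     ts nd a = canonicalEnd ds ts ofSecond (guard-inv _ {ts = ts} a)
    readNumber ofLabel  _ _ | stop [] (operation (binary σ)) ts nd a =
      let ok , acc = guard-inv (allowed σ) {ts = ts} a in op σ ts refl ok acc
    readNumber ofLabel  _ _ | stop (d ∷ ds) (operation (binary σ)) ts nd a =
      ⊥-elim (notFresh (afterDigit fresh d) ds (notFresh₁ d) a)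
      where
      Fresh : Fin 4 → Set
      Fresh n = n ≡ fresh
      notFresh₁ : ∀ d → ¬ Fresh (afterDigit fresh d)
      notFresh₁ false ()
      notFresh₁ true  ()
      notFresh₂ : ∀ n d → ¬ Fresh (afterDigit n d)
      notFresh₂ fresh false ()
      notFresh₂ nil   false ()
      notFresh₂ low   false ()
      notFresh₂ high  false ()
      notFresh₂ n     true  ()
      dead : ∀ n → ¬ Fresh n → ¬ AcceptsFrom (syntaxStep inLabel n (operation (binary σ))) ts
      dead fresh nf a = nf refl
      notFresh : ∀ n ds → ¬ Fresh n →
                 ¬ AcceptsFrom (syntaxStep inLabel (afterDigits n ds) (operation (binary σ))) ts
      notFresh n []       nf = dead n nf
      notFresh n (d ∷ ds) nf = notFresh (afterDigit n d) ds (notFresh₂ n d)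

    pastComma-inv : ∀ ts → Accepts pastComma fresh ts →
                    ∃[ ts′ ] (ts ≡ semicolon ∷ ts′ × Accepts inName fresh ts′)
    pastComma-inv (semicolon ∷ ts) acc = ts , refl , acc
    pastComma-inv (operation complement ∷ ts) ()
    pastComma-inv (operation (binary σ) ∷ ts) ()

    pastOp-inv : ∀ ts → Accepts pastOp fresh ts →
                 ∃[ ts′ ] (ts ≡ comma ∷ ts′ × Accepts inFirst fresh ts′)
    pastOp-inv (comma ∷ ts) acc = ts , refl , acc
    pastOp-inv (operation complement ∷ ts) ()
    pastOp-inv (operation (binary σ) ∷ ts) ()

    -- The recursion is on a bound for the number of tokens, because the remaining tokens are
    -- delivered by views and are not structurally smaller.
    parseGates : ∀ k ts → length ts < k → Accepts inName fresh ts →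
                 ∃[ gs ] ∃[ b ] (ts ≡ concatMap tokensOfGate gs ++ number b × All OpAllowed gs)
    parseGates (suc k) ts (s≤s len) acc with readNumber ofName ts acc
    ... | last b refl = [] , b , refl , []
    ... | ended n ts₁ ofName acc₁ with readNumber ofLabel ts₁ acc₁
    ... | ended l ts₂′ ofLabel acc₂′ with pastComma-inv ts₂′ acc₂′
    ... | ts₂ , refl , acc₂ =
      let gs , b , eq , ok = parseGates k ts₂ shorter acc₂
      in  constant n l ∷ gs , b ,
          trans (cong (λ ts → number n ++ comma ∷ number l ++ comma ∷ semicolon ∷ ts) eq)
                (sym (constant-++ n l gs b)) ,
          _ ∷ ok
      where
      open ≤-Reasoning
      shorter : length ts₂ < k
      shorter = begin-strict
        length ts₂                                            <⟨ ≤-refl ⟩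
        length (semicolon ∷ ts₂)                              <⟨ suffix< (number l) ⟩
        length (number l ++ comma ∷ semicolon ∷ ts₂)          <⟨ suffix< (number n) ⟩
        length (number n ++ comma ∷ number l ++ comma ∷ semicolon ∷ ts₂) ≤⟨ len ⟩
        k                                                     ∎
    parseGates (suc k) _ (s≤s len) acc
      | ended n ts₁ ofName acc₁ | op σ ts₂′ refl allow acc₂′ with pastOp-inv ts₂′ acc₂′
    ... | ts₂ , refl , acc₂ with readNumber ofFirst ts₂ acc₂
    ... | ended p ts₃ ofFirst acc₃ with readNumber ofSecond ts₃ acc₃
    ... | ended q ts₄′ ofSecond acc₄′ with pastComma-inv ts₄′ acc₄′
    ... | ts₄ , refl , acc₄ =
      let gs , b , eq , ok = parseGates k ts₄ shorter acc₄
      in  operate σ p q n ∷ gs , b ,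
          trans (cong (λ ts → number n ++ comma ∷ operation (binary σ) ∷ comma ∷
                   number p ++ comma ∷ number q ++ comma ∷ semicolon ∷ ts) eq)
                (sym (operate-++ σ p q n gs b)) ,
          allow ∷ ok
      where
      open ≤-Reasoning
      shorter : length ts₄ < k
      shorter = begin-strict
        length ts₄                                            <⟨ ≤-refl ⟩
        length (semicolon ∷ ts₄)                              <⟨ suffix< (number q) ⟩
        length (number q ++ comma ∷ semicolon ∷ ts₄)          <⟨ suffix< (number p) ⟩
        length ts₂                                            <⟨ ≤-refl ⟩
        length (comma ∷ ts₂)                                  <⟨ ≤-refl ⟩
        length (operation (binary σ) ∷ comma ∷ ts₂)           <⟨ suffix< (number n) ⟩
        length (number n ++ comma ∷ operation (binary σ) ∷ comma ∷ ts₂) ≤⟨ len ⟩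
        k                                                     ∎

  parse : ∀ ts → Accepts inOutput fresh ts → ∃[ ℓ ] (ts ≡ tokensOf ℓ × All OpAllowed (gates ℓ))
  parse ts acc with readNumber ofOutput ts acc
  ... | ended o ts′ ofOutput acc′ =
    let gs , b , eq , ok = parseGates (suc (length ts′)) ts′ ≤-refl acc′
    in  listing o gs b , cong (λ ts → number o ++ semicolon ∷ ts) eq , ok

  -- Decoding of words, with the syntax checked on the fly

  decodeToken : Bool → Bool → Bool → Bool → Maybe Token
  decodeToken false false false b     = just (digit b)
  decodeToken false false true  false = just comma
  decodeToken false false true  true  = just semicolon
  decodeToken false true  false false = just (operation complement)
  decodeToken false true  false true  = just (operation (binary union))
  decodeToken false true  true  false = just (operation (binary inter))
  decodeToken false true  true  true  = just (operation (binary plus))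
  decodeToken true  false false false = just (operation (binary times))
  decodeToken true  false false true  = just (operation (binary quotient))
  decodeToken _     _     _     _     = nothing

  -- The graph of the decoder. Its cases are those that the stack program distinguishes in one
  -- round, so the correctness of the program is an induction over this type.
  data Scan (c : Fin 7) (n : Fin 4) : Word → Maybe (List Token) → Set where
    finished   : final c n ≡ true → Scan c n [] (just [])
    unfinished : final c n ≡ false → Scan c n [] nothing
    odd₁       : ∀ b₁ → Scan c n (b₁ ∷ []) nothing
    odd₂       : ∀ b₁ b₂ → Scan c n (b₁ ∷ b₂ ∷ []) nothing
    odd₃       : ∀ b₁ b₂ b₃ → Scan c n (b₁ ∷ b₂ ∷ b₃ ∷ []) nothing
    noToken    : ∀ b₁ b₂ b₃ b₄ {w} → decodeToken b₁ b₂ b₃ b₄ ≡ nothing →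
                 Scan c n (b₁ ∷ b₂ ∷ b₃ ∷ b₄ ∷ w) nothing
    misplaced  : ∀ b₁ b₂ b₃ b₄ {w t} → decodeToken b₁ b₂ b₃ b₄ ≡ just t →
                 syntaxStep c n t ≡ nothing → Scan c n (b₁ ∷ b₂ ∷ b₃ ∷ b₄ ∷ w) nothing
    token      : ∀ b₁ b₂ b₃ b₄ {w t c′ n′ r} → decodeToken b₁ b₂ b₃ b₄ ≡ just t →
                 syntaxStep c n t ≡ just (c′ , n′) → Scan c′ n′ w r →
                 Scan c n (b₁ ∷ b₂ ∷ b₃ ∷ b₄ ∷ w) (Maybe.map (t ∷_) r)

  scan : ∀ c n w → ∃[ r ] Scan c n w r
  scan c n [] with final c n in eq
  ... | true  = _ , finished eq
  ... | false = _ , unfinished eq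
  scan c n (b₁ ∷ [])           = _ , odd₁ b₁
  scan c n (b₁ ∷ b₂ ∷ [])      = _ , odd₂ b₁ b₂
  scan c n (b₁ ∷ b₂ ∷ b₃ ∷ []) = _ , odd₃ b₁ b₂ b₃
  scan c n (b₁ ∷ b₂ ∷ b₃ ∷ b₄ ∷ w) with decodeToken b₁ b₂ b₃ b₄ in eq
  ... | nothing = _ , noToken b₁ b₂ b₃ b₄ eq
  ... | just t with syntaxStep c n t in eq′
  ... | nothing        = _ , misplaced b₁ b₂ b₃ b₄ eq eq′
  ... | just (c′ , n′) = _ , token b₁ b₂ b₃ b₄ eq eq′ (proj₂ (scan c′ n′ w))

  private
    decodeToken-sound : ∀ b₁ b₂ b₃ b₄ {t} → decodeToken b₁ b₂ b₃ b₄ ≡ just t →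
                        tokenCode t ≡ b₁ ∷ b₂ ∷ b₃ ∷ b₄ ∷ []
    decodeToken-sound false false false false refl = refl
    decodeToken-sound false false false true  refl = refl
    decodeToken-sound false false true  false refl = refl
    decodeToken-sound false false true  true  refl = refl
    decodeToken-sound false true  false false refl = refl
    decodeToken-sound false true  false true  refl = refl
    decodeToken-sound false true  true  false refl = refl
    decodeToken-sound false true  true  true  refl = refl
    decodeToken-sound true  false false false refl = refl
    decodeToken-sound true  false false true  refl = refl

    scan-token : ∀ {c n c′ n′ w ts} t → syntaxStep c n t ≡ just (c′ , n′) →
                 Scan c′ n′ w (just ts) → Scan c n (tokenCode t ++ w) (just (t ∷ ts))
    scan-token (digit false)                 eq s = token _ _ _ _ refl eq s
    scan-token (digit true)                  eq s = token _ _ _ _ refl eq s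
    scan-token comma                         eq s = token _ _ _ _ refl eq s
    scan-token semicolon                     eq s = token _ _ _ _ refl eq s
    scan-token (operation complement)        eq s = token _ _ _ _ refl eq s
    scan-token (operation (binary union))    eq s = token _ _ _ _ refl eq s
    scan-token (operation (binary inter))    eq s = token _ _ _ _ refl eq s
    scan-token (operation (binary plus))     eq s = token _ _ _ _ refl eq s
    scan-token (operation (binary times))    eq s = token _ _ _ _ refl eq s
    scan-token (operation (binary quotient)) eq s = token _ _ _ _ refl eq s

  scan-sound : ∀ {c n w r ts} → Scan c n w r → r ≡ just ts →
               w ≡ concatMap tokenCode ts × Accepts c n ts
  scan-sound (finished fin) refl = refl , fin
  scan-sound (token b₁ b₂ b₃ b₄ {r = just ts} eq eq′ s) refl rewrite eq′ =
    let w≡ , acc = scan-sound s refl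
    in  cong₂ _++_ (sym (decodeToken-sound b₁ b₂ b₃ b₄ eq)) w≡ , acc

  scan-complete : ∀ c n ts → Accepts c n ts → Scan c n (concatMap tokenCode ts) (just ts)
  scan-complete c n []       acc = finished acc
  scan-complete c n (t ∷ ts) acc with syntaxStep c n t in eq
  ... | just (c′ , n′) = scan-token t eq (scan-complete c′ n′ ts acc)

-- The stack alphabet and elementary stack programs

-- The marks serve two purposes. On `sT` they stand for commas, semicolons and operators. On `sE` a
-- `separator` closes the name of a gate, and the mark closing its value is `terminator` for a
-- singleton and `absent` for the empty set.
data Mark : Set where
  separator terminator absent : Mark
  operator                    : BinOp → Mark

Mark-finite : Finite Mark
Mark-finite = 8 , mk↔ₛ′ to from
  (λ { 0F → refl ; 1F → refl ; 2F → refl ; 3F → refl ; 4F → refl ; 5F → refl ; 6F → refl ; 7F → refl })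
  (λ { separator → refl ; terminator → refl ; absent → refl
     ; (operator union) → refl ; (operator inter) → refl ; (operator plus) → refl
     ; (operator times) → refl ; (operator quotient) → refl })
  where
  to : Mark → Fin 8
  to separator           = 0F
  to terminator          = 1F
  to absent              = 2F
  to (operator union)    = 3F
  to (operator inter)    = 4F
  to (operator plus)     = 5F
  to (operator times)    = 6F
  to (operator quotient) = 7F
  from : Fin 8 → Mark
  from 0F = separator
  from 1F = terminator
  from 2F = absent
  from 3F = operator union
  from 4F = operator inter
  from 5F = operator plus
  from 6F = operator times
  from 7F = operator quotient

open StackMachine Mark Mark-finite 8

-- The stacks: sD holds the input and later serves as an auxiliary stack, sT the
-- tokens of the circuit, sE the evaluated gates, sF those just inspected, sA and sB
-- the operands, sR and sS the digits already processed, sG the target number.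
pattern sD = 0F
pattern sT = 1F
pattern sE = 2F
pattern sF = 3F
pattern sA = 4F
pattern sB = 5F
pattern sS = 6F
pattern sR = 7F
pattern sG = 8F

bits : List Bool → List Γ
bits = map inj₁

continue-done : ∀ {x : Result Store A} {k : A → Store → Result Store B} {a s r} →
                x ≡ done a s → k a s ≡ r → continue x k ≡ r
continue-done refl eq = eq

-- What ends a run of digits: the bottom of the stack, or a mark with more stack beneath it.
ending : Maybe (Mark × List Γ) → List Γ
ending nothing         = []
ending (just (m , xs)) = inj₂ m ∷ xs

beyond : Maybe (Mark × List Γ) → List Γ
beyond nothing         = []
beyond (just (m , xs)) = xs

moveDigit : Fin stacks → Maybe Γ → Prog (⊤ ⊎ Maybe Mark)
moveDigit j nothing         = ret (inj₂ nothing)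
moveDigit j (just (inj₁ b)) = push j (inj₁ b) >> ret (inj₁ tt)
moveDigit j (just (inj₂ m)) = ret (inj₂ (just m))

moveDigits : Fin stacks → Fin stacks → Prog (Maybe Mark)
moveDigits i j = iter (λ (_ : ⊤) → pop i >>= moveDigit j) tt

updateAt-≔ : ∀ {n} (s : Vec A n) i {f y} → f (lookup s i) ≡ y → Vec.updateAt s i f ≡ s [ i ]≔ y
updateAt-≔ s i eq = Vec.updateAt-cong-local i s eq

moveLoop : ∀ N {i j} → i ≢ j → ∀ m ds e s {zs} → lookup s i ≡ bits ds ++ ending e →
  bits ds ʳ++ lookup s j ≡ zs → length ds < m →
  loop m (λ _ → eval N (pop i >>= moveDigit j)) tt s ≡
  done (Maybe.map proj₁ e) ((s [ i ]≔ beyond e) [ j ]≔ zs)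
moveLoop N {i} {j} i≢j (suc m) [] e s {zs} eq eqz len
  rewrite updateAt-≔ s i {drop 1} (cong (drop 1) eq) | eq = last e
  where
  unchanged : ∀ {xs} → s [ i ]≔ xs ≡ (s [ i ]≔ xs) [ j ]≔ zs
  unchanged {xs} = trans (sym (Vec.[]≔-lookup (s [ i ]≔ xs) j))
    (cong ((s [ i ]≔ xs) [ j ]≔_) (trans (Vec.lookup∘update′ (i≢j ∘ sym) s xs) eqz))
  last : ∀ e → continue (eval N (moveDigit j (head (ending e))) (s [ i ]≔ drop 1 (ending e)))
                 [ loop m (λ _ → eval N (pop i >>= moveDigit j)) , done ]′ ≡
               done (Maybe.map proj₁ e) ((s [ i ]≔ beyond e) [ j ]≔ zs)
  last nothing         = cong (done nothing) unchanged
  last (just (m , xs)) = cong (done (just m)) unchanged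
moveLoop N {i} {j} i≢j (suc m) (b ∷ ds) e s {zs} eq eqz (s≤s len)
  rewrite updateAt-≔ s i {drop 1} (cong (drop 1) eq) | eq
        | updateAt-≔ (s [ i ]≔ (bits ds ++ ending e)) j {inj₁ b ∷_} refl
        | Vec.lookup∘update′ (i≢j ∘ sym) s (bits ds ++ ending e) =
  trans (moveLoop N i≢j m ds e s₁ lookup-i (trans (cong (bits ds ʳ++_) lookup-j) eqz) len)
        (cong (done (Maybe.map proj₁ e)) final-store)
  where
  s₁ : Store
  s₁ = (s [ i ]≔ (bits ds ++ ending e)) [ j ]≔ (inj₁ b ∷ lookup s j)
  lookup-i : lookup s₁ i ≡ bits ds ++ ending e
  lookup-i = trans (Vec.lookup∘update′ i≢j (s [ i ]≔ _) _) (Vec.lookup∘update i s _)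
  lookup-j : lookup s₁ j ≡ inj₁ b ∷ lookup s j
  lookup-j = Vec.lookup∘update j (s [ i ]≔ _) _
  final-store : (s₁ [ i ]≔ beyond e) [ j ]≔ zs ≡ (s [ i ]≔ beyond e) [ j ]≔ zs
  final-store = begin
    (s₁ [ i ]≔ beyond e) [ j ]≔ zs
      ≡⟨ cong (_[ j ]≔ zs) (Vec.[]≔-commutes (s [ i ]≔ _) j i (i≢j ∘ sym)) ⟩
    (((s [ i ]≔ _) [ i ]≔ beyond e) [ j ]≔ _) [ j ]≔ zs
      ≡⟨ Vec.[]≔-idempotent _ j ⟩
    ((s [ i ]≔ _) [ i ]≔ beyond e) [ j ]≔ zs
      ≡⟨ cong (_[ j ]≔ zs) (Vec.[]≔-idempotent s i) ⟩
    (s [ i ]≔ beyond e) [ j ]≔ zs ∎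
    where open ≡-Reasoning

moveDigits-eval : ∀ {N i j} → i ≢ j → ∀ ds e s {zs} → lookup s i ≡ bits ds ++ ending e →
  bits ds ʳ++ lookup s j ≡ zs → length ds < N →
  eval N (moveDigits i j) s ≡ done (Maybe.map proj₁ e) ((s [ i ]≔ beyond e) [ j ]≔ zs)
moveDigits-eval {N} i≢j ds e s = moveLoop N i≢j N ds e s

clearStep : Maybe Γ → Prog (⊤ ⊎ ⊤)
clearStep nothing  = ret (inj₂ tt)
clearStep (just _) = ret (inj₁ tt)

clear : Fin stacks → Prog ⊤
clear i = iter (λ (_ : ⊤) → pop i >>= clearStep) tt

clear-eval : ∀ {N} i s → length (lookup s i) < N → eval N (clear i) s ≡ done tt (s [ i ]≔ [])
clear-eval {N} i s = go N s (lookup s i) refl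
  where
  go : ∀ m s xs → lookup s i ≡ xs → length xs < m →
       loop m (λ _ → eval N (pop i >>= clearStep)) tt s ≡ done tt (s [ i ]≔ [])
  go (suc m) s [] eq len rewrite updateAt-≔ s i {drop 1} (cong (drop 1) eq) | eq = refl
  go (suc m) s (x ∷ xs) eq (s≤s len) rewrite updateAt-≔ s i {drop 1} (cong (drop 1) eq) | eq =
    trans (go m (s [ i ]≔ xs) xs (Vec.lookup∘update i s xs) len)
          (cong (done tt) (Vec.[]≔-idempotent s i))

store : (d t e f a b s r g : List Γ) → Store
store d t e f a b s r g = d ∷ t ∷ e ∷ f ∷ a ∷ b ∷ s ∷ r ∷ g ∷ []

copyDigit : Maybe Γ → Prog (⊤ ⊎ Maybe Mark)
copyDigit nothing         = ret (inj₂ nothing)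
copyDigit (just (inj₁ b)) = push sF (inj₁ b) >> push sA (inj₁ b) >> ret (inj₁ tt)
copyDigit (just (inj₂ m)) = ret (inj₂ (just m))

copyDigits : Prog (Maybe Mark)
copyDigits = iter (λ (_ : ⊤) → pop sE >>= copyDigit) tt

restoreStep : Maybe Γ → Prog (⊤ ⊎ ⊤)
restoreStep nothing  = ret (inj₂ tt)
restoreStep (just x) = push sE x >> ret (inj₁ tt)

restore : Prog ⊤
restore = iter (λ (_ : ⊤) → pop sF >>= restoreStep) tt

copyDigits-eval : ∀ {N} ds en {d t f a b s r g} → length ds < N →
  eval N copyDigits (store d t (bits ds ++ ending en) f a b s r g) ≡
  done (Maybe.map proj₁ en) (store d t (beyond en) (bits ds ʳ++ f) (bits ds ʳ++ a) b s r g)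
copyDigits-eval {N} ds en = go N ds en
  where
  go : ∀ m ds en {d t f a b s r g} → length ds < m →
       loop m (λ _ → eval N (pop sE >>= copyDigit)) tt (store d t (bits ds ++ ending en) f a b s r g) ≡
       done (Maybe.map proj₁ en) (store d t (beyond en) (bits ds ʳ++ f) (bits ds ʳ++ a) b s r g)
  go (suc m) []       nothing         len       = refl
  go (suc m) []       (just (m′ , _)) len       = refl
  go (suc m) (x ∷ ds) en              (s≤s len) = go m ds en len

restore-eval : ∀ {N} f {d t e a b s r g} → length f < N →
  eval N restore (store d t e f a b s r g) ≡ done tt (store d t (f ʳ++ e) [] a b s r g)
restore-eval {N} f = go N f
  where
  go : ∀ m f {d t e a b s r g} → length f < m →
       loop m (λ _ → eval N (pop sF >>= restoreStep)) tt (store d t e f a b s r g) ≡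
       done tt (store d t (f ʳ++ e) [] a b s r g)
  go (suc m) []       len       = refl
  go (suc m) (x ∷ xs) (s≤s len) = go m xs len

bits-reverse : ∀ ds → bits ds ʳ++ [] ≡ bits (reverse ds)
bits-reverse ds = sym (map-ʳ++ inj₁ ds)

bits-unreverse : ∀ ds {xs} → bits (reverse ds) ʳ++ xs ≡ bits ds ++ xs
bits-unreverse ds {xs} = trans (cong (_ʳ++ xs) (sym (bits-reverse ds))) (ʳ++-ʳ++ (bits ds))

bits-unreverse-[] : ∀ ds → bits (reverse ds) ʳ++ [] ≡ bits ds
bits-unreverse-[] ds = trans (bits-unreverse ds) (List.++-identityʳ (bits ds))

length-reverse-< : ∀ (ds : List Bool) {N} → length ds < N → length (reverse ds) < N
length-reverse-< ds {N} = subst (_< N) (sym (length-reverse ds))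

length-bits-< : ∀ ds {N} → length ds < N → length (bits ds) < N
length-bits-< ds {N} = subst (_< N) (sym (length-map inj₁ ds))

-- Arithmetic on the stacks sA and sB

module _ (o : Digitwise) where
  open Digitwise o using (pad; next; emit)

  digitStep : Bool → Maybe Γ → Maybe Γ → Prog (Bool ⊎ Bool)
  digitStep c nothing         nothing         = ret (inj₂ c)
  digitStep c nothing         (just (inj₁ b)) =
    push sS (inj₁ b) >>
    ((if pad then push sR (inj₁ (emit c false b)) else ret tt) >>
    ret (inj₁ (next c false b)))
  digitStep c (just (inj₁ a)) nothing         =
    push sR (inj₁ (emit c a false)) >> ret (inj₁ (next c a false))
  digitStep c (just (inj₁ a)) (just (inj₁ b)) =
    push sS (inj₁ b) >> (push sR (inj₁ (emit c a b)) >> ret (inj₁ (next c a b)))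
  digitStep c _               _               = fail

  digitRound : Bool → Prog (Bool ⊎ Bool)
  digitRound c = pop sA >>= λ a → pop sB >>= digitStep c a

  -- The loop consumes both operands. The output is collected on `sR` and the second operand on
  -- `sS`, both reversed; moving them back restores the order and leaves the second operand on `sB`
  -- for further use.
  combine : Bool → Prog Bool
  combine c = iter digitRound c >>= λ c′ →
    (if pad ∧ c′ then push sR (inj₁ true) else ret tt) >>
    (moveDigits sR sA >>= λ _ → moveDigits sS sB >>= λ _ → ret c′)

-- `r′` is the output without the final carry digit, which `combine` pushes only after the loop.
combine-loop : ∀ o N m c as bs s r {d t e f g} → length as < m → length bs < m →
  ∃[ r′ ]
    (loop m (λ c′ → eval N (digitRound o c′)) c (store d t e f (bits as) (bits bs) (bits s) (bits r) g) ≡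
     done (carry o c as bs) (store d t e f [] [] (bits (bs ʳ++ s)) (bits r′) g) ×
     (if Digitwise.pad o ∧ carry o c as bs then true ∷ r′ else r′) ≡ digitsOut o c as bs ʳ++ r)
combine-loop o@record { pad = false } N (suc m) c [] [] s r las lbs = r , refl , refl
combine-loop o@record { pad = true } N (suc m) false [] [] s r las lbs = r , refl , refl
combine-loop o@record { pad = true } N (suc m) true [] [] s r las lbs = r , refl , refl
combine-loop o@record { pad = false } N (suc m) c [] (b ∷ bs) s r las (s≤s lbs) =
  combine-loop o N m _ [] bs (b ∷ s) r (≤-trans (s≤s z≤n) lbs) lbs
combine-loop o@record { pad = true } N (suc m) c [] (b ∷ bs) s r las (s≤s lbs) =
  combine-loop o N m _ [] bs (b ∷ s) (_ ∷ r) (≤-trans (s≤s z≤n) lbs) lbs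
combine-loop o N (suc m) c (a ∷ as) [] s r (s≤s las) lbs =
  combine-loop o N m _ as [] s (_ ∷ r) las (≤-trans (s≤s z≤n) las)
combine-loop o N (suc m) c (a ∷ as) (b ∷ bs) s r (s≤s las) (s≤s lbs) =
  combine-loop o N m _ as bs (b ∷ s) (_ ∷ r) las lbs

combine-eval : ∀ o {N} c as bs {d t e f g} →
  length as < N → length bs < N → length (digitsOut o c as bs) < N →
  eval N (combine o c) (store d t e f (bits as) (bits bs) [] [] g) ≡
  done (carry o c as bs) (store d t e f (bits (digitsOut o c as bs)) (bits bs) [] [] g)
combine-eval o {N} c as bs {d} {t} {e} {f} {g} las lbs lout
  with r , eq , eqr ← combine-loop o N N c as bs [] [] {d} {t} {e} {f} {g} las lbs =
  continue-done eq
    (continue-done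
      {a = tt} {s = store d t e f [] [] (bits (reverse bs)) (bits (reverse (digitsOut o c as bs))) g}
      (finalCarry (Digitwise.pad o ∧ carry o c as bs) eqr)
      (continue-done
        (moveDigits-eval {i = sR} {sA} (λ ()) (reverse (digitsOut o c as bs)) nothing _
          (sym (List.++-identityʳ _)) (bits-unreverse-[] (digitsOut o c as bs))
          (length-reverse-< (digitsOut o c as bs) lout))
        (continue-done
          (moveDigits-eval {i = sS} {sB} (λ ()) (reverse bs) nothing _
            (sym (List.++-identityʳ _)) (bits-unreverse-[] bs) (length-reverse-< bs lbs))
          refl)))
  where
  finalCarry : ∀ p {r ds} → (if p then true ∷ r else r) ≡ ds →
    eval N (if p then push sR (inj₁ true) else ret tt)
      (store d t e f [] [] (bits (reverse bs)) (bits r) g) ≡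
    done tt (store d t e f [] [] (bits (reverse bs)) (bits ds) g)
  finalCarry true  refl = refl
  finalCarry false refl = refl

equality-eval : ∀ {N} as bs {d t e f g} → length as < N → length bs < N →
  eval N (combine equality true) (store d t e f (bits as) (bits bs) [] [] g) ≡
  done (eqBits as bs) (store d t e f (bits as) (bits bs) [] [] g)
equality-eval {N} as bs {d} {t} {e} {f} {g} las lbs =
  subst (λ ds → eval N (combine equality true) (store d t e f (bits as) (bits bs) [] [] g) ≡
                done (eqBits as bs) (store d t e f (bits ds) (bits bs) [] [] g))
    (equality-output true as bs)
    (combine-eval equality true as bs las lbs (subst (λ ds → length ds < N) (sym (equality-output true as bs)) las))

order-eval : ∀ {N} as bs {d t e f g} → length as < N → length bs < N →
  eval N (combine order true) (store d t e f (bits as) (bits bs) [] [] g) ≡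
  done (leqBits as bs) (store d t e f (bits as) (bits bs) [] [] g)
order-eval {N} as bs {d} {t} {e} {f} {g} las lbs =
  subst (λ ds → eval N (combine order true) (store d t e f (bits as) (bits bs) [] [] g) ≡
                done (leqBits as bs) (store d t e f (bits ds) (bits bs) [] [] g))
    (order-output true as bs)
    (combine-eval order true as bs las lbs (subst (λ ds → length ds < N) (sym (order-output true as bs)) las))

subtractor-eval : ∀ {N} as bs {c d t e f g} → length as < N → length bs < N → borrow as bs ≡ c →
  eval N (combine subtractor false) (store d t e f (bits as) (bits bs) [] [] g) ≡
  done c (store d t e f (bits (sub as bs)) (bits bs) [] [] g)
subtractor-eval {N} as bs las lbs refl =
  combine-eval subtractor false as bs las lbs (subst (_< N) (sym (length-sub false as bs)) las)

Value : Set
Value = Maybe (List Bool)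

valueDigits : Value → List Bool
valueDigits nothing   = []
valueDigits (just bs) = bs

valueBits : Value → List Γ
valueBits v = bits (valueDigits v)

-- The value for union is junk: circuits with ∪-gates are rejected as ill-formed.
applyOp : BinOp → List Bool → List Bool → Value
applyOp union    as bs = nothing
applyOp inter    as bs = if eqBits as bs then just as else nothing
applyOp plus     as bs = just (add as bs)
applyOp times    as bs = just (mul as bs)
applyOp quotient as bs = div as bs

discard : Prog Bool
discard = clear sA >> (clear sB >> ret false)

mulDigit : Maybe Γ → Prog (⊤ ⊎ ⊤)
mulDigit nothing             = ret (inj₂ tt)
mulDigit (just (inj₁ false)) = push sA (inj₁ false) >> ret (inj₁ tt)
mulDigit (just (inj₁ true))  = push sA (inj₁ false) >> (combine adder false >>= λ _ → ret (inj₁ tt))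
mulDigit (just (inj₂ m))     = fail

stripDividend : Maybe Γ → Prog (⊤ ⊎ Bool)
stripDividend nothing             = ret (inj₁ tt)
stripDividend (just (inj₁ false)) = ret (inj₁ tt)
stripDividend (just (inj₁ true))  = ret (inj₂ false)
stripDividend (just (inj₂ m))     = fail

stripDivisor : Maybe Γ → Prog (⊤ ⊎ Bool)
stripDivisor nothing             = ret (inj₂ false)
stripDivisor (just (inj₁ false)) = pop sA >>= stripDividend
stripDivisor (just (inj₁ true))  = push sB (inj₁ true) >> ret (inj₂ true)
stripDivisor (just (inj₂ m))     = fail

quotientDigit : Maybe Γ → Prog (⊤ ⊎ Bool)
quotientDigit nothing             = ret (inj₂ true)
quotientDigit (just (inj₁ false)) = push sD (inj₁ false) >> ret (inj₁ tt)
quotientDigit (just (inj₁ true))  =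
  -- The digit popped for inspection belongs to the dividend and is put back before the subtraction.
  push sA (inj₁ true) >> (combine subtractor false >>= λ c →
    if c then ret (inj₂ false) else (pop sA >>= λ _ → push sD (inj₁ true) >> ret (inj₁ tt)))
quotientDigit (just (inj₂ m))     = fail

collectQuotient : Bool → Prog Bool
collectQuotient true  = clear sB >> (moveDigits sD sA >>= λ _ → ret true)
collectQuotient false = clear sD >> discard

divide : Bool → Prog Bool
divide true  = iter (λ (_ : ⊤) → pop sA >>= quotientDigit) tt >>= collectQuotient
divide false = discard

keepIf : Bool → Prog Bool
keepIf true  = clear sB >> ret true
keepIf false = discard

apply : BinOp → Prog Bool
apply union    = discard
apply inter    = combine equality true >>= keepIf
apply plus     = combine adder false >>= λ _ → clear sB >> ret true
apply times    = moveDigits sA sD >>= λ _ →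
                 iter (λ (_ : ⊤) → pop sD >>= mulDigit) tt >> (clear sB >> ret true)
apply quotient = iter (λ (_ : ⊤) → pop sB >>= stripDivisor) tt >>= divide

discard-eval : ∀ {N} as bs {d t e f s r g} → length as < N → length bs < N →
  eval N discard (store d t e f (bits as) (bits bs) s r g) ≡
  done false (store d t e f [] [] s r g)
discard-eval as bs las lbs =
  continue-done (clear-eval sA _ (length-bits-< as las))
    (continue-done (clear-eval sB _ (length-bits-< bs lbs)) refl)

mulOnto : List Bool → List Bool → List Bool → List Bool
mulOnto bs acc []       = acc
mulOnto bs acc (d ∷ ds) = mulOnto bs (shiftAdd bs d acc) ds

-- `mul` combines digits from the most significant one on, so taking them from the reversed first
-- factor turns its recursion into a loop with an accumulator.
mulOnto-ʳ++ : ∀ bs as ds → mulOnto bs [] (as ʳ++ ds) ≡ mulOnto bs (mul as bs) ds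
mulOnto-ʳ++ bs []       ds = refl
mulOnto-ʳ++ bs (a ∷ as) ds = mulOnto-ʳ++ bs as (a ∷ ds)

-- Each round lengthens the accumulator by at most two digits, one for the shift and one for the
-- carry of the addition; hence the budget `L + 2 * length ds`.
mulLoop : ∀ N m ds acc bs L {t e f g} → length acc ≤ L → length bs ≤ L →
  L + 2 * length ds < N → length ds < m →
  loop m (λ _ → eval N (pop sD >>= mulDigit)) tt
    (store (bits ds) t e f (bits acc) (bits bs) [] [] g) ≡
  done tt (store [] t e f (bits (mulOnto bs acc ds)) (bits bs) [] [] g)
mulLoop N (suc m) [] acc bs L lacc lbs lN lm = refl
mulLoop N (suc m) (false ∷ ds) acc bs L lacc lbs lN (s≤s lm) =
  mulLoop N m ds (false ∷ acc) bs (suc L) (s≤s lacc) (≤-trans lbs (n≤1+n L))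
    (≤-trans (s≤s (≤-trans (n≤1+n _) (≤-reflexive (lemma L (length ds))))) lN) lm
  where
  lemma : ∀ L k → suc (suc L + 2 * k) ≡ L + 2 * suc k
  lemma = solve-∀
mulLoop N (suc m) (true ∷ ds) acc bs L {t} {e} {f} {g} lacc lbs lN (s≤s lm) =
  continue-done
    {a = inj₁ tt} {s = store (bits ds) t e f (bits (add (false ∷ acc) bs)) (bits bs) [] [] g}
    (continue-done (combine-eval adder false (false ∷ acc) bs
        (≤-trans (s≤s (s≤s lacc)) lN′) (≤-trans (s≤s (≤-trans lbs (n≤1+n L))) lN′)
        (≤-trans (s≤s sum≤) lN″))
      refl)
    (mulLoop N m ds (add (false ∷ acc) bs) bs (suc (suc L)) sum≤
      (≤-trans lbs (≤-trans (n≤1+n L) (n≤1+n _))) (subst (_< N) (lemma L (length ds)) lN) lm)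
  where
  lemma : ∀ L k → L + 2 * suc k ≡ suc (suc L) + 2 * k
  lemma = solve-∀
  lN″ : suc (suc L) < N
  lN″ = ≤-trans (s≤s (m≤m+n _ _)) (subst (_< N) (lemma L (length ds)) lN)
  lN′ : suc (suc L) ≤ N
  lN′ = ≤-trans (n≤1+n _) lN″
  sum≤ : length (add (false ∷ acc) bs) ≤ suc (suc L)
  sum≤ = length-output-adder false (false ∷ acc) bs (s≤s lacc) (≤-trans lbs (n≤1+n L))

stripLoop : ∀ N m as bs {d t e f s r g} → length bs < m →
  ∃[ ok ] ∃[ as′ ] ∃[ bs′ ]
    (loop m (λ _ → eval N (pop sB >>= stripDivisor)) tt (store d t e f (bits as) (bits bs) s r g) ≡
     done ok (store d t e f (bits as′) (bits bs′) s r g) ×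
     strip as bs ≡ (if ok then just (as′ , bs′) else nothing) ×
     length as′ ≤ length as × length bs′ ≤ length bs)
stripLoop N (suc m) as []           lm = false , as , [] , refl , refl , ≤-refl , ≤-refl
stripLoop N (suc m) as (true ∷ bs)  lm = true , as , true ∷ bs , refl , refl , ≤-refl , ≤-refl
stripLoop N (suc m) [] (false ∷ bs) (s≤s lm) =
  let ok , as′ , bs′ , eq , eq′ , las , lbs = stripLoop N m [] bs lm
  in  ok , as′ , bs′ , eq , eq′ , las , ≤-trans lbs (n≤1+n _)
stripLoop N (suc m) (false ∷ as) (false ∷ bs) (s≤s lm) =
  let ok , as′ , bs′ , eq , eq′ , las , lbs = stripLoop N m as bs lm
  in  ok , as′ , bs′ , eq , eq′ , ≤-trans las (n≤1+n _) , ≤-trans lbs (n≤1+n _)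
stripLoop N (suc m) (true ∷ as) (false ∷ bs) lm =
  false , as , bs , refl , refl , n≤1+n _ , n≤1+n _

map-∷-ʳ++ : ∀ x q (r : Value) → Maybe.map (_ʳ++ (x ∷ q)) r ≡ Maybe.map (_ʳ++ q) (Maybe.map (x ∷_) r)
map-∷-ʳ++ x q (just cs) = refl
map-∷-ʳ++ x q nothing   = refl

-- `q` holds the quotient digits found so far with the latest on top, so the quotient comes out
-- reversed. On success the dividend is used up; on failure what is left on the stacks is bounded in
-- length, so that it can be cleared.
quotientLoop : ∀ N m as bs q {t e f g} → length as < N → length bs < N → length as < m →
  ∃[ ok ] ∃[ as′ ] ∃[ ds ]
    (loop m (λ _ → eval N (pop sA >>= quotientDigit)) tt
       (store (bits q) t e f (bits as) (bits bs) [] [] g) ≡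
     done ok (store (bits ds) t e f (bits as′) (bits bs) [] [] g) ×
     (∀ n → length as ≤ n → Maybe.map (_ʳ++ q) (oddQuotient n as bs) ≡ (if ok then just ds else nothing)) ×
     (ok ≡ true → as′ ≡ []) ×
     length as′ ≤ length as × length ds ≤ length as + length q)
quotientLoop N (suc m) [] bs q las lbs lm =
  true , [] , q , refl , (λ { zero _ → refl ; (suc n) _ → refl }) , (λ _ → refl) , ≤-refl , ≤-refl
quotientLoop N (suc m) (false ∷ as) bs q las lbs (s≤s lm) =
  let ok , as′ , ds , eq , eq′ , empty , las′ , lds =
        quotientLoop N m as bs (false ∷ q) (≤-trans (n≤1+n _) las) lbs lm
  in  ok , as′ , ds , eq ,
      (λ { (suc n) (s≤s le) → trans (sym (map-∷-ʳ++ false q (oddQuotient n as bs))) (eq′ n le) }) ,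
      empty , ≤-trans las′ (n≤1+n _) ,
      ≤-trans lds (≤-reflexive (+-suc (length as) (length q)))
quotientLoop N (suc m) (true ∷ as) bs q {t} {e} {f} {g} las lbs (s≤s lm)
  with borrow (true ∷ as) bs in eqb
... | true = false , sub (true ∷ as) bs , q ,
      continue-done {a = inj₂ false} {s = store (bits q) t e f (bits (sub (true ∷ as) bs)) (bits bs) [] [] g}
        (continue-done (subtractor-eval (true ∷ as) bs las lbs eqb) refl) refl ,
      (λ { (suc n) (s≤s le) → cong (Maybe.map (_ʳ++ q)) (failing n) }) ,
      (λ ()) , ≤-reflexive length-difference , m≤n+m _ _
  where
  length-difference : length (sub (true ∷ as) bs) ≡ suc (length as)
  length-difference = length-sub false (true ∷ as) bs
  failing : ∀ n → oddQuotient (suc n) (true ∷ as) bs ≡ nothing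
  failing n rewrite eqb = refl
... | false =
  let ok , as′ , ds , eq , eq′ , empty , las′ , lds =
        quotientLoop N m rest bs (true ∷ q) (subst (_< N) (sym length-rest) (≤-trans (n≤1+n _) las)) lbs
          (subst (_< m) (sym length-rest) lm)
  in  ok , as′ , ds ,
      continue-done {a = inj₁ tt} {s = store (bits (true ∷ q)) t e f (bits rest) (bits bs) [] [] g}
        (continue-done (subtractor-eval (true ∷ as) bs las lbs eqb)
          (cong (λ a → done (inj₁ tt) (store (bits (true ∷ q)) t e f a (bits bs) [] [] g)) drop-bits)) eq ,
      (λ { (suc n) (s≤s le) → trans (trans (cong (Maybe.map (_ʳ++ q)) (continuing n))
             (sym (map-∷-ʳ++ true q (oddQuotient n rest bs)))) (eq′ n (≤-trans (≤-reflexive length-rest) le)) }) ,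
      empty , ≤-trans las′ (≤-trans (≤-reflexive length-rest) (n≤1+n _)) ,
      ≤-trans lds (≤-reflexive (trans (+-suc (length rest) (length q)) (cong (λ k → suc (k + length q)) length-rest)))
  where
  rest : List Bool
  rest = drop 1 (sub (true ∷ as) bs)
  length-difference : length (sub (true ∷ as) bs) ≡ suc (length as)
  length-difference = length-sub false (true ∷ as) bs
  length-rest : length rest ≡ length as
  length-rest = trans (List.length-drop 1 (sub (true ∷ as) bs)) (cong (_∸ 1) length-difference)
  drop-bits : drop 1 (bits (sub (true ∷ as) bs)) ≡ bits rest
  drop-bits = List.drop-map 1 (sub (true ∷ as) bs)
  continuing : ∀ n → oddQuotient (suc n) (true ∷ as) bs ≡ Maybe.map (true ∷_) (oddQuotient n rest bs)
  continuing n rewrite eqb = refl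

collect-eval : ∀ {N} ok as bs ds (r : Value) {t e f g} →
  length as < N → length bs < N → length ds < N → (ok ≡ true → as ≡ []) →
  Maybe.map (_ʳ++ []) r ≡ (if ok then just ds else nothing) →
  eval N (collectQuotient ok) (store (bits ds) t e f (bits as) (bits bs) [] [] g) ≡
  done (is-just r) (store [] t e f (valueBits r) [] [] [] g)
collect-eval false as bs ds nothing las lbs lds empty eq =
  continue-done (clear-eval sD _ (length-bits-< ds lds)) (discard-eval as bs las lbs)
collect-eval true as bs ds (just cs) las lbs lds empty refl with refl ← empty refl =
  continue-done (clear-eval sB _ (length-bits-< bs lbs))
    (continue-done (moveDigits-eval {i = sD} {sA} (λ ()) (reverse cs) nothing _
        (sym (List.++-identityʳ _)) (bits-unreverse-[] cs) lds)
      refl)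

quotient-eval : ∀ {N} as bs {t e f g} → length as < N → length bs < N →
  eval N (apply quotient) (store [] t e f (bits as) (bits bs) [] [] g) ≡
  done (is-just (div as bs)) (store [] t e f (valueBits (div as bs)) [] [] [] g)
quotient-eval {N} as bs {t} {e} {f} {g} las lbs
  with stripLoop N N as bs {[]} {t} {e} {f} {[]} {[]} {g} lbs
... | false , as₁ , bs₁ , eq , eqs , las₁ , lbs₁ rewrite eqs =
  continue-done eq (discard-eval as₁ bs₁ (≤-trans (s≤s las₁) las) (≤-trans (s≤s lbs₁) lbs))
... | true , as₁ , bs₁ , eq , eqs , las₁ , lbs₁ rewrite eqs =
  let ok , as₂ , ds , eq₂ , eqq , empty , las₂ , lds =
        quotientLoop N N as₁ bs₁ [] {t} {e} {f} {g} las₁< lbs₁< las₁<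
  in  continue-done eq (continue-done eq₂
        (collect-eval ok as₂ bs₁ ds (oddQuotient (length as₁) as₁ bs₁)
          (≤-trans (s≤s las₂) las₁<) lbs₁<
          (≤-trans (s≤s (≤-trans lds (≤-reflexive (+-identityʳ _)))) las₁<)
          empty (eqq (length as₁) ≤-refl)))
  where
  las₁< : length as₁ < N
  las₁< = ≤-trans (s≤s las₁) las
  lbs₁< : length bs₁ < N
  lbs₁< = ≤-trans (s≤s lbs₁) lbs

times-eval : ∀ {N} as bs {t e f g} → length bs + 2 * length as < N →
  eval N (apply times) (store [] t e f (bits as) (bits bs) [] [] g) ≡
  done true (store [] t e f (bits (mul as bs)) [] [] [] g)
times-eval {N} as bs {t} {e} {f} {g} lN =
  continue-done (moveDigits-eval {i = sA} {sD} (λ ()) as nothing _ (sym (List.++-identityʳ _))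
      (bits-reverse as) las)
    (continue-done
      (trans (mulLoop N N (reverse as) [] bs (length bs) z≤n ≤-refl
               (subst (λ k → length bs + 2 * k < N) (sym (length-reverse as)) lN)
               (length-reverse-< as las))
             (cong (λ ds → done tt (store [] t e f (bits ds) (bits bs) [] [] g)) (mulOnto-ʳ++ bs as [])))
      (continue-done (clear-eval sB _ (length-bits-< bs (≤-trans (s≤s (m≤m+n _ _)) lN))) refl))
  where
  las : length as < N
  las = ≤-trans (s≤s (≤-trans (m≤m+n _ _) (m≤n+m _ (length bs)))) lN

-- One budget for all operations: a sum has at most `suc (length as + length bs)` digits, and
-- multiplication stays within `length bs + 2 * length as`.
apply-eval : ∀ {N} σ as bs {t e f g} → suc (length as + length bs + 2 * length as) < N →
  eval N (apply σ) (store [] t e f (bits as) (bits bs) [] [] g) ≡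
  done (is-just (applyOp σ as bs)) (store [] t e f (valueBits (applyOp σ as bs)) [] [] [] g)
apply-eval {N} σ as bs {t} {e} {f} {g} lN = go σ
  where
  s : Store
  s = store [] t e f (bits as) (bits bs) [] [] g
  las : length as < N
  las = ≤-trans (s≤s (≤-trans (m≤m+n _ _) (≤-trans (m≤m+n _ (2 * length as)) (n≤1+n _)))) lN
  lbs : length bs < N
  lbs = ≤-trans (s≤s (≤-trans (m≤n+m _ (length as)) (≤-trans (m≤m+n _ (2 * length as)) (n≤1+n _)))) lN
  ladd : length (add as bs) < N
  ladd = ≤-trans (s≤s (length-output-adder false as bs (m≤m+n (length as) (length bs)) (m≤n+m (length bs) (length as))))
    (≤-trans (s≤s (s≤s (m≤m+n _ (2 * length as)))) lN)
  keep : ∀ c → eval N (keepIf c) s ≡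
         done (is-just (if c then just as else nothing))
              (store [] t e f (valueBits (if c then just as else nothing)) [] [] [] g)
  keep true  = continue-done (clear-eval sB _ (length-bits-< bs lbs)) refl
  keep false = discard-eval as bs las lbs
  go : ∀ σ → eval N (apply σ) s ≡
       done (is-just (applyOp σ as bs)) (store [] t e f (valueBits (applyOp σ as bs)) [] [] [] g)
  go union    = discard-eval as bs las lbs
  go inter    = continue-done
    (equality-eval as bs las lbs)
    (keep (eqBits as bs))
  go plus     = continue-done (combine-eval adder false as bs las lbs ladd)
    (continue-done (clear-eval sB _ (length-bits-< bs lbs)) refl)
  go times    = times-eval as bs (≤-trans (s≤s (≤-trans (+-monoˡ-≤ (2 * length as) (m≤n+m _ (length as))) (n≤1+n _))) lN)
  go quotient = quotient-eval as bs las lbs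

-- The evaluation of circuits

Env : Set
Env = List (Gate × Value)

valueMark : Value → Mark
valueMark nothing  = absent
valueMark (just _) = terminator

-- Digits are stored with the most significant one on top, so that copying them to
-- another stack puts them into the usual order.
envCode : Env → List Γ
envCode []              = []
envCode ((g , v) ∷ env) =
  bits (reverse (binaryDigits (gateName g))) ++ inj₂ separator ∷
  bits (reverse (valueDigits v)) ++ inj₂ (valueMark v) ∷ envCode env

lookupEnv : ℕ → Env → Maybe Value
lookupEnv k []              = nothing
lookupEnv k ((g , v) ∷ env) =
  if eqBits (binaryDigits (gateName g)) (binaryDigits k) then just v else lookupEnv k env

-- Each of ∩, +, × and / yields the empty set as soon as an operand is empty.
applyValues : BinOp → Value → Value → Value
applyValues σ (just as) (just bs) = applyOp σ as bs
applyValues σ _         _         = nothing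

-- The outer `Maybe` reports malformed circuits, the inner one empty sets. Comparing `p` with `q`
-- checks `ordered`. Since gates are processed from the last one on, finding both names in the
-- environment checks that predecessors are listed later, and hence that there are no cycles.
gateValue : Env → Gate → Maybe Value
gateValue env (constant n l)    = just (just (binaryDigits l))
gateValue env (operate σ p q n) =
  if leqBits (binaryDigits p) (binaryDigits q)
  then (lookupEnv q env Maybe.>>= λ y → Maybe.map (λ x → applyValues σ x y) (lookupEnv p env))
  else nothing

-- Refusing a known name is the check that gate names are distinct.
insertNew : Env → Gate → Value → Maybe Env
insertNew env g v = if is-just (lookupEnv (gateName g) env) then nothing else just ((g , v) ∷ env)

extend : Env → Gate → Maybe Env
extend env g = gateValue env g Maybe.>>= insertNew env g

process : Env → List Gate → Maybe Env
process env []       = just env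
process env (g ∷ gs) = extend env g Maybe.>>= λ env′ → process env′ gs

hits : ℕ → Maybe Value → Bool
hits b (just (just bs)) = eqBits bs (binaryDigits b)
hits b _                = false

-- The contents of sT while the gates are processed from the last one on.
layout : ℕ → List Gate → List Γ
layout o []                       = bits (reverse (binaryDigits o))
layout o (constant n l ∷ gs)      =
  inj₂ separator ∷ bits (reverse (binaryDigits l)) ++
  inj₂ separator ∷ bits (reverse (binaryDigits n)) ++
  inj₂ terminator ∷ layout o gs
layout o (operate σ p q n ∷ gs)   =
  inj₂ separator ∷ bits (reverse (binaryDigits q)) ++
  inj₂ separator ∷ bits (reverse (binaryDigits p)) ++
  inj₂ separator ∷ inj₂ (operator σ) ∷ inj₂ separator ∷ bits (reverse (binaryDigits n)) ++
  inj₂ terminator ∷ layout o gs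

isPresent : Mark → Bool
isPresent terminator = true
isPresent _          = false

foundValue : Maybe Mark → Prog (⊤ ⊎ Maybe Bool)
foundValue nothing  = fail
foundValue (just m) = push sF (inj₂ m) >> ret (inj₂ (just (isPresent m)))

skippedValue : Maybe Mark → Prog (⊤ ⊎ Maybe Bool)
skippedValue nothing  = fail
skippedValue (just m) = push sF (inj₂ m) >> ret (inj₁ tt)

compareName : Maybe Mark → Prog (⊤ ⊎ Maybe Bool)
compareName nothing          = ret (inj₂ nothing)
compareName (just separator) = push sF (inj₂ separator) >> (combine equality true >>= λ eq →
  clear sA >> (if eq then (copyDigits >>= foundValue) else (moveDigits sE sF >>= skippedValue)))
compareName (just _)         = fail

-- Looks up the gate whose name is on sB and copies its value to sA.
find : Prog (Maybe Bool)
find = iter (λ (_ : ⊤) → copyDigits >>= compareName) tt >>= λ r → restore >> ret r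

insertFresh : Bool → Maybe Bool → Prog ⊤
insertFresh p (just _) = fail
insertFresh p nothing  =
  -- The value is reversed on `sD`; since every move reverses, it takes the detour over `sA` to
  -- arrive on `sE` with its most significant digit on top.
  push sE (inj₂ (if p then terminator else absent)) >> (moveDigits sD sA >> (moveDigits sA sE >>
  (push sE (inj₂ separator) >> (moveDigits sB sE >> ret tt))))

insertGate : Bool → Prog ⊤
insertGate p = moveDigits sA sD >> (find >>= insertFresh p)

swapOperands : Prog ⊤
swapOperands =
  moveDigits sA sD >> (moveDigits sB sS >> (moveDigits sD sB >> (moveDigits sS sA >> ret tt)))

haveFirst : BinOp → Bool → Maybe Bool → Prog ⊤
haveFirst σ y nothing  = fail
haveFirst σ y (just x) =
  clear sB >> (moveDigits sD sB >> ((if x ∧ y then apply σ else discard) >>= λ z →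
  moveDigits sT sB >> insertGate z))

haveSecond : BinOp → Maybe Bool → Prog ⊤
haveSecond σ nothing  = fail
haveSecond σ (just y) =
  clear sB >> (moveDigits sD sB >> (moveDigits sA sD >> (find >>= haveFirst σ y)))

operateGate : Maybe Γ → Prog ⊤
-- The symbol popped here is the separator between the operator and the gate name.
operateGate (just (inj₂ (operator σ))) = pop sT >> (combine order true >>= λ le →
  if le then (moveDigits sA sD >> (find >>= haveSecond σ)) else fail)
operateGate _                          = fail

readGate : Maybe Mark → Prog ⊤
-- A constant gate delivers its label to `sB` and its name to `sA`, while `insertGate` expects the
-- value on `sA` and the name on `sB`.
readGate (just terminator) = swapOperands >> insertGate true
readGate (just separator)  = pop sT >>= operateGate
readGate _                 = fail

compareTarget : Maybe Bool → Prog (⊤ ⊎ Bool)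
compareTarget (just true) = clear sB >> (moveDigits sG sD >> (moveDigits sD sB >>
  (combine equality true >>= λ c → ret (inj₂ c))))
compareTarget _           = ret (inj₂ false)

nextGate : Maybe Γ → Prog (⊤ ⊎ Bool)
-- Every gate begins with a separator, so a digit on top means that all gates are processed and only
-- the name of the output is left.
nextGate (just (inj₁ d))         = push sT (inj₁ d) >> (moveDigits sT sB >> (find >>= compareTarget))
nextGate (just (inj₂ separator)) =
  moveDigits sT sB >> (moveDigits sT sA >>= λ m → readGate m >> ret (inj₁ tt))
nextGate _                       = fail

evaluate : Prog Bool
evaluate = iter (λ (_ : ⊤) → pop sT >>= nextGate) tt

-- Correctness of the evaluation program

length-envCode : ∀ env → length env ≤ length (envCode env)
length-envCode []              = z≤n
length-envCode ((g , v) ∷ env) = ≤-trans (s≤s (length-envCode env))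
  (≤-trans (suffix< (bits (reverse (valueDigits v))))
    (<⇒≤ (suffix< (bits (reverse (binaryDigits (gateName g)))))))

foundDigits : Maybe Value → List Bool
foundDigits nothing  = []
foundDigits (just v) = valueDigits v

moveAll-eval : ∀ {N i j} → i ≢ j → ∀ ds s {zs} → lookup s i ≡ bits ds →
  bits ds ʳ++ lookup s j ≡ zs → length ds < N →
  eval N (moveDigits i j) s ≡ done nothing ((s [ i ]≔ []) [ j ]≔ zs)
moveAll-eval i≢j ds s eq = moveDigits-eval i≢j ds nothing s (trans eq (sym (List.++-identityʳ (bits ds))))

prefix-< : ∀ (xs : List Γ) {ys N} → length (xs ++ ys) < N → length xs < N
prefix-< xs {ys} = ≤-trans (s≤s (≤-trans (m≤m+n _ _) (≤-reflexive (sym (length-++ xs)))))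

bits-< : ∀ ds {ys N} → length (bits (reverse ds) ++ ys) < N → length ds < N
bits-< ds {ys} {N} lt = subst (_< N) (trans (length-map inj₁ (reverse ds)) (length-reverse ds))
                                     (prefix-< (bits (reverse ds)) lt)

-- The last equation is the loop invariant: pouring `sF` back onto `sE` always gives the same stack,
-- so `restore` recovers the environment wherever the search stops.
findLoop : ∀ N m k env f {d t g} → length (binaryDigits k) < N → length (envCode env) < N → length env < m →
  ∃[ f′ ] ∃[ e′ ]
    (loop m (λ _ → eval N (copyDigits >>= compareName)) tt
       (store d t (envCode env) f [] (bits (binaryDigits k)) [] [] g) ≡
     done (Maybe.map is-just (lookupEnv k env))
       (store d t e′ f′ (bits (foundDigits (lookupEnv k env))) (bits (binaryDigits k)) [] [] g) ×
     f′ ʳ++ e′ ≡ f ʳ++ envCode env)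
findLoop (suc N) (suc m) k [] f lk lN lm = f , [] , refl , refl
findLoop N (suc m) k ((g , v) ∷ env) f {d} {t} {goal} lk lN (s≤s lm) =
  let f′ , e′ , eq , eq′ = chosen (eqBits name key) in f′ , e′ , trans compared eq , eq′
  where
  name key val : List Bool
  name = binaryDigits (gateName g)
  key  = binaryDigits k
  val  = valueDigits v
  rest rest′ : List Γ
  rest  = bits (reverse val) ++ inj₂ (valueMark v) ∷ envCode env
  rest′ = envCode env
  f₁ f₂ : List Γ
  f₁ = inj₂ separator ∷ (bits (reverse name) ʳ++ f)
  f₂ = inj₂ (valueMark v) ∷ (bits (reverse val) ʳ++ f₁)
  lname : length name < N
  lname = bits-< name lN
  lrest : length rest < N
  lrest = <-trans (suffix< (bits (reverse name))) lN
  lval : length val < N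
  lval = bits-< val lrest
  lrest′ : length rest′ < N
  lrest′ = <-trans (suffix< (bits (reverse val))) lrest
  copyName : eval N copyDigits (store d t (envCode ((g , v) ∷ env)) f [] (bits key) [] [] goal) ≡
             done (just separator) (store d t rest (bits (reverse name) ʳ++ f) (bits name) (bits key) [] [] goal)
  copyName = trans (copyDigits-eval (reverse name) (just (separator , rest)) (length-reverse-< name lname))
    (cong (λ a → done (just separator) (store d t rest (bits (reverse name) ʳ++ f) a (bits key) [] [] goal))
          (bits-unreverse-[] name))
  copyValue : eval N copyDigits (store d t rest f₁ [] (bits key) [] [] goal) ≡
              done (just (valueMark v)) (store d t rest′ (bits (reverse val) ʳ++ f₁) (bits val) (bits key) [] [] goal)
  copyValue = trans (copyDigits-eval (reverse val) (just (valueMark v , rest′)) (length-reverse-< val lval))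
    (cong (λ a → done (just (valueMark v)) (store d t rest′ (bits (reverse val) ʳ++ f₁) a (bits key) [] [] goal))
          (bits-unreverse-[] val))
  skipValue : eval N (moveDigits sE sF) (store d t rest f₁ [] (bits key) [] [] goal) ≡
              done (just (valueMark v)) (store d t rest′ (bits (reverse val) ʳ++ f₁) [] (bits key) [] [] goal)
  skipValue = moveDigits-eval {i = sE} {sF} (λ ()) (reverse val) (just (valueMark v , rest′)) _ refl refl
                              (length-reverse-< val lval)
  shifted : f₂ ʳ++ rest′ ≡ f ʳ++ envCode ((g , v) ∷ env)
  shifted = trans (ʳ++-ʳ++ (bits (reverse val))) (ʳ++-ʳ++ (bits (reverse name)))
  h : ⊤ → Store → Result Store (⊤ ⊎ Maybe Bool)
  h _ = eval N (copyDigits >>= compareName)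
  s₁ : Store
  s₁ = store d t rest f₁ [] (bits key) [] [] goal
  branch : Bool → Prog (⊤ ⊎ Maybe Bool)
  branch c = if c then (copyDigits >>= foundValue) else (moveDigits sE sF >>= skippedValue)
  compared : loop (suc m) h tt (store d t (envCode ((g , v) ∷ env)) f [] (bits key) [] [] goal) ≡
             continue (eval N (branch (eqBits name key)) s₁) [ loop m h , done ]′
  compared = cong (λ x → continue x [ loop m h , done ]′)
    (continue-done copyName
      (continue-done
        (equality-eval name key lname lk)
        (continue-done (clear-eval sA _ (length-bits-< name lname)) refl)))
  presence : ∀ v → isPresent (valueMark v) ≡ is-just v
  presence nothing  = refl
  presence (just _) = refl
  chosen : ∀ c → ∃[ f′ ] ∃[ e′ ]
    (continue (eval N (branch c) s₁) [ loop m h , done ]′ ≡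
     done (Maybe.map is-just (if c then just v else lookupEnv k env))
       (store d t e′ f′ (bits (foundDigits (if c then just v else lookupEnv k env))) (bits key) [] [] goal) ×
     f′ ʳ++ e′ ≡ f ʳ++ envCode ((g , v) ∷ env))
  chosen true = f₂ , rest′ ,
    trans (cong (λ x → continue x [ loop m h , done ]′) (continue-done copyValue refl))
          (cong (λ p → done (just p) (store d t rest′ f₂ (bits val) (bits key) [] [] goal)) (presence v)) ,
    shifted
  chosen false =
    let f′ , e′ , eq , eq′ = findLoop N m k env f₂ lk lrest′ lm
    in  f′ , e′ ,
        trans (cong (λ x → continue x [ loop m h , done ]′) (continue-done skipValue refl)) eq ,
        trans eq′ shifted

find-eval : ∀ {N} k env {d t g} → length (binaryDigits k) < N → length (envCode env) < N →
  eval N find (store d t (envCode env) [] [] (bits (binaryDigits k)) [] [] g) ≡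
  done (Maybe.map is-just (lookupEnv k env))
       (store d t (envCode env) [] (bits (foundDigits (lookupEnv k env))) (bits (binaryDigits k)) [] [] g)
find-eval {N} k env {d} {t} {g} lk lN =
  let f′ , e′ , eq , eq′ = findLoop N N k env [] {d} {t} {g} lk lN (≤-trans (s≤s (length-envCode env)) lN)
  in  continue-done eq
        (continue-done
          (trans (restore-eval f′ (≤-trans (s≤s (≤-trans (m≤m+n (length f′) (length e′))
                   (≤-reflexive (trans (sym (length-ʳ++ f′)) (cong length eq′))))) lN))
                 (cong (λ e → done tt (store d t e [] (bits (foundDigits (lookupEnv k env))) (bits (binaryDigits k)) [] [] g)) eq′))
          refl)

bits-ʳ++ : ∀ ds {xs} → bits ds ʳ++ xs ≡ bits (reverse ds) ++ xs
bits-ʳ++ ds {xs} = trans (List.ʳ++-defn (bits ds)) (cong (_++ xs) (bits-reverse ds))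

outcome : List Γ → List Γ → Maybe Env → Result Store ⊤
outcome t g nothing    = failed
outcome t g (just env) = done tt (store [] t (envCode env) [] [] [] [] [] g)

length-applyOp : ∀ σ as bs → length (valueDigits (applyOp σ as bs)) ≤ suc (length as + length bs + 2 * length as)
length-applyOp union as bs = z≤n
length-applyOp inter as bs with eqBits as bs
... | true  = ≤-trans (≤-trans (m≤m+n _ _) (m≤m+n _ _)) (n≤1+n _)
... | false = z≤n
length-applyOp plus as bs = ≤-trans
  (length-output-adder false as bs (m≤m+n (length as) (length bs)) (m≤n+m (length bs) (length as)))
  (s≤s (m≤m+n _ _))
length-applyOp times as bs = ≤-trans (length-mul as bs) (≤-trans (≤-reflexive (+-comm (2 * length as) (length bs)))
  (≤-trans (+-monoˡ-≤ (2 * length as) (m≤n+m _ (length as))) (n≤1+n _)))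
length-applyOp quotient as bs with div as bs | length-div as bs
... | nothing | le = z≤n
... | just cs | le = ≤-trans (le refl) (≤-trans (≤-trans (m≤m+n _ _) (m≤m+n _ _)) (n≤1+n _))

length-applyValues : ∀ σ x y → length (valueDigits (applyValues σ x y)) ≤
  suc (length (valueDigits x) + length (valueDigits y) + 2 * length (valueDigits x))
length-applyValues σ nothing   y         = z≤n
length-applyValues σ (just as) nothing   = z≤n
length-applyValues σ (just as) (just bs) = length-applyOp σ as bs

insertGate-eval : ∀ {N} env gt v {t g} → length (binaryDigits (gateName gt)) < N →
  length (valueDigits v) < N → length (envCode env) < N →
  eval N (insertGate (is-just v))
    (store [] t (envCode env) [] (valueBits v) (bits (binaryDigits (gateName gt))) [] [] g) ≡
  outcome t g (insertNew env gt v)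
insertGate-eval {N} env gt v {t} {g} lname lv lenv =
  continue-done (moveAll-eval {i = sA} {sD} (λ ()) (valueDigits v) _ refl (bits-reverse (valueDigits v)) lv)
    (continue-done (find-eval (gateName gt) env lname lenv) (inserted (lookupEnv (gateName gt) env)))
  where
  name : List Bool
  name = binaryDigits (gateName gt)
  marked : ∀ v → (if is-just v then terminator else absent) ≡ valueMark v
  marked nothing  = refl
  marked (just _) = refl
  inserted : ∀ r → eval N (insertFresh (is-just v) (Maybe.map is-just r))
      (store (bits (reverse (valueDigits v))) t (envCode env) [] (bits (foundDigits r)) (bits name) [] [] g) ≡
    outcome t g (if is-just r then nothing else just ((gt , v) ∷ env))
  inserted (just _) = refl
  inserted nothing  =
    continue-done (moveAll-eval {i = sD} {sA} (λ ()) (reverse (valueDigits v)) _ refl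
        (bits-unreverse-[] (valueDigits v)) (length-reverse-< (valueDigits v) lv))
      (continue-done (moveAll-eval {i = sA} {sE} (λ ()) (valueDigits v) _ refl
          (trans (bits-ʳ++ (valueDigits v))
                 (cong (λ m → bits (reverse (valueDigits v)) ++ inj₂ m ∷ envCode env) (marked v))) lv)
        (continue-done (moveAll-eval {i = sB} {sE} (λ ()) name _ refl (bits-ʳ++ name) lname)
          refl))

swapOperands-eval : ∀ {N} as bs {t e f g} → length as < N → length bs < N →
  eval N swapOperands (store [] t e f (bits as) (bits bs) [] [] g) ≡
  done tt (store [] t e f (bits bs) (bits as) [] [] g)
swapOperands-eval as bs las lbs =
  continue-done (moveAll-eval {i = sA} {sD} (λ ()) as _ refl (bits-reverse as) las)
  (continue-done (moveAll-eval {i = sB} {sS} (λ ()) bs _ refl (bits-reverse bs) lbs)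
  (continue-done (moveAll-eval {i = sD} {sB} (λ ()) (reverse as) _ refl (bits-unreverse-[] as) (length-reverse-< as las))
  (continue-done (moveAll-eval {i = sS} {sA} (λ ()) (reverse bs) _ refl (bits-unreverse-[] bs) (length-reverse-< bs lbs))
  refl)))

-- The bounds N on loops and V on values under which gates are evaluated.
module Room (N V : ℕ) (room : suc (V + V + 2 * V) < N) where

  ValueFits : Gate × Value → Set
  ValueFits (_ , v) = length (valueDigits v) ≤ V

  EnvFits : Env → Set
  EnvFits env = length (envCode env) < N × All ValueFits env

  NumberFits : ℕ → Set
  NumberFits n = length (binaryDigits n) < N

  GateFits : Gate → Set
  GateFits (constant n l)    = NumberFits n × NumberFits l
  GateFits (operate σ p q n) = NumberFits p × NumberFits q × NumberFits n

  private
    V<N : V < N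
    V<N = ≤-trans (s≤s (≤-trans (≤-trans (m≤m+n V V) (m≤m+n _ _)) (n≤1+n _))) room

  length-found : ∀ k {env} → All ValueFits env → length (foundDigits (lookupEnv k env)) ≤ V
  length-found k []                              = z≤n
  length-found k {(g , v) ∷ env} (fit ∷ fits) with eqBits (binaryDigits (gateName g)) (binaryDigits k)
  ... | true  = fit
  ... | false = length-found k fits

  operateGate-eval : ∀ σ p q n env {t g} → GateFits (operate σ p q n) → EnvFits env →
    eval N (pop sT >>= operateGate)
      (store [] (inj₂ (operator σ) ∷ inj₂ separator ∷ bits (reverse (binaryDigits n)) ++ inj₂ terminator ∷ t)
        (envCode env) [] (bits (binaryDigits p)) (bits (binaryDigits q)) [] [] g) ≡
    outcome t g (extend env (operate σ p q n))
  operateGate-eval σ p q n env {t} {g} (lp , lq , ln) (lenv , fits) =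
    continue-done
      (order-eval (binaryDigits p) (binaryDigits q) lp lq)
      (compared (leqBits (binaryDigits p) (binaryDigits q)))
    where
    e t′ : List Γ
    e  = envCode env
    t′ = bits (reverse (binaryDigits n)) ++ inj₂ terminator ∷ t
    gt : Gate
    gt = operate σ p q n
    applied : ∀ x y → length (valueDigits x) ≤ V → length (valueDigits y) ≤ V →
      eval N (if is-just x ∧ is-just y then apply σ else discard)
        (store [] t′ e [] (valueBits x) (valueBits y) [] [] g) ≡
      done (is-just (applyValues σ x y)) (store [] t′ e [] (valueBits (applyValues σ x y)) [] [] [] g)
    applied nothing   y         lx ly = discard-eval [] (valueDigits y) (≤-trans (s≤s lx) V<N) (≤-trans (s≤s ly) V<N)
    applied (just as) nothing   lx ly = discard-eval as [] (≤-trans (s≤s lx) V<N) (≤-trans (s≤s ly) V<N)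
    applied (just as) (just bs) lx ly = apply-eval σ as bs
      (≤-trans (s≤s (s≤s (+-mono-≤ (+-mono-≤ lx ly) (*-monoʳ-≤ 2 lx)))) room)
    first : ∀ x y → length (foundDigits x) ≤ V → length (valueDigits y) ≤ V →
      eval N (haveFirst σ (is-just y) (Maybe.map is-just x))
        (store (bits (reverse (valueDigits y))) t′ e [] (bits (foundDigits x)) (bits (binaryDigits p)) [] [] g) ≡
      outcome t g (Maybe.map (λ x → applyValues σ x y) x Maybe.>>= insertNew env gt)
    first nothing  y lx ly = refl
    first (just x) y lx ly =
      continue-done (clear-eval sB _ (length-bits-< (binaryDigits p) lp))
      (continue-done (moveAll-eval {i = sD} {sB} (λ ()) (reverse (valueDigits y)) _ refl
          (bits-unreverse-[] (valueDigits y)) (length-reverse-< (valueDigits y) (≤-trans (s≤s ly) V<N)))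
      (continue-done (applied x y lx ly)
      (continue-done (moveDigits-eval {i = sT} {sB} (λ ()) (reverse (binaryDigits n)) (just (terminator , t)) _ refl
          (bits-unreverse-[] (binaryDigits n)) (length-reverse-< (binaryDigits n) ln))
      (insertGate-eval env gt (applyValues σ x y) ln
        (≤-trans (s≤s (≤-trans (length-applyValues σ x y) (s≤s (+-mono-≤ (+-mono-≤ lx ly) (*-monoʳ-≤ 2 lx))))) room)
        lenv))))
    second : ∀ y → length (foundDigits y) ≤ V →
      eval N (haveSecond σ (Maybe.map is-just y))
        (store (bits (reverse (binaryDigits p))) t′ e [] (bits (foundDigits y)) (bits (binaryDigits q)) [] [] g) ≡
      outcome t g ((y Maybe.>>= λ y → Maybe.map (λ x → applyValues σ x y) (lookupEnv p env)) Maybe.>>= insertNew env gt)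
    second nothing  ly = refl
    second (just y) ly =
      continue-done (clear-eval sB _ (length-bits-< (binaryDigits q) lq))
      (continue-done (moveAll-eval {i = sD} {sB} (λ ()) (reverse (binaryDigits p)) _ refl
          (bits-unreverse-[] (binaryDigits p)) (length-reverse-< (binaryDigits p) lp))
      (continue-done (moveAll-eval {i = sA} {sD} (λ ()) (valueDigits y) _ refl
          (bits-reverse (valueDigits y)) (≤-trans (s≤s ly) V<N))
      (continue-done (find-eval p env lp lenv)
      (first (lookupEnv p env) y (length-found p fits) ly))))
    compared : ∀ c →
      eval N (if c then (moveDigits sA sD >> (find >>= haveSecond σ)) else fail)
        (store [] t′ e [] (bits (binaryDigits p)) (bits (binaryDigits q)) [] [] g) ≡
      outcome t g ((if c then (lookupEnv q env Maybe.>>= λ y → Maybe.map (λ x → applyValues σ x y) (lookupEnv p env))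
                         else nothing) Maybe.>>= insertNew env gt)
    compared false = refl
    compared true  =
      continue-done (moveAll-eval {i = sA} {sD} (λ ()) (binaryDigits p) _ refl (bits-reverse (binaryDigits p)) lp)
      (continue-done (find-eval q env lq lenv)
      (second (lookupEnv q env) (length-found q fits)))

  gate-eval : ∀ o gt gs env {g} → GateFits gt → EnvFits env →
    eval N (pop sT >>= nextGate) (store [] (layout o (gt ∷ gs)) (envCode env) [] [] [] [] [] g) ≡
    continue (outcome (layout o gs) g (extend env gt)) (λ _ → done (inj₁ tt))
  gate-eval o (constant n l) gs env {g} (ln , ll) (lenv , fits) =
    continue-done (moveDigits-eval {i = sT} {sB} (λ ()) (reverse (binaryDigits l)) (just (separator , _)) _ refl
        (bits-unreverse-[] (binaryDigits l)) (length-reverse-< (binaryDigits l) ll))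
    (continue-done (moveDigits-eval {i = sT} {sA} (λ ()) (reverse (binaryDigits n)) (just (terminator , _)) _ refl
        (bits-unreverse-[] (binaryDigits n)) (length-reverse-< (binaryDigits n) ln))
    (cong (λ r → continue r (λ _ → done (inj₁ tt)))
      (continue-done (swapOperands-eval (binaryDigits n) (binaryDigits l) ln ll)
        (insertGate-eval env (constant n l) (just (binaryDigits l)) ln ll lenv))))
  gate-eval o (operate σ p q n) gs env {g} (lp , lq , ln) fits =
    continue-done (moveDigits-eval {i = sT} {sB} (λ ()) (reverse (binaryDigits q)) (just (separator , _)) _ refl
        (bits-unreverse-[] (binaryDigits q)) (length-reverse-< (binaryDigits q) lq))
    (continue-done (moveDigits-eval {i = sT} {sA} (λ ()) (reverse (binaryDigits p)) (just (separator , _)) _ refl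
        (bits-unreverse-[] (binaryDigits p)) (length-reverse-< (binaryDigits p) lp))
    (cong (λ r → continue r (λ _ → done (inj₁ tt)))
      (operateGate-eval σ p q n env (lp , lq , ln) fits)))

verdictOf : ℕ → ℕ → Maybe Env → Bool
verdictOf o b nothing    = false
verdictOf o b (just env) = hits b (lookupEnv o env)

continue-final : ∀ {x : Result Store A} {k : A → Store → Result Store Bool} {a s v} →
                 x ≡ done a s → FinalVerdict (k a s) v → FinalVerdict (continue x k) v
continue-final refl fv = fv

binaryDigits-∷ : ∀ n → ∃[ d ] ∃[ ds ] binaryDigits n ≡ d ∷ ds
binaryDigits-∷ zero = _ , _ , refl
binaryDigits-∷ (suc n) with binaryDigits n
... | []         = _ , _ , refl
... | false ∷ ds = _ , _ , refl
... | true ∷ ds  = _ , _ , refl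

module Evaluation (N V : ℕ) (room : suc (V + V + 2 * V) < N) where
  open Room N V room

  -- The bounds are required of exactly those environments that the run reaches.
  Fits : Env → List Gate → Set
  Fits env []       = EnvFits env
  Fits env (g ∷ gs) = EnvFits env × GateFits g × (∀ {env′} → extend env g ≡ just env′ → Fits env′ gs)

  evaluateLoop : ∀ m o b env gs → length gs < m → NumberFits o → NumberFits b → Fits env gs →
    FinalVerdict
      (loop m (λ _ → eval N (pop sT >>= nextGate)) tt
        (store [] (layout o gs) (envCode env) [] [] [] [] [] (bits (binaryDigits b))))
      (verdictOf o b (process env gs))
  evaluateLoop (suc m) o b env [] lm lo lb (lenv , fits) = header (reverse (binaryDigits o)) refl
    where
    e : List Γ
    e = envCode env
    compared : ∀ x → length (foundDigits x) ≤ V →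
      FinalVerdict
        (continue
          (eval N (compareTarget (Maybe.map is-just x))
            (store [] [] e [] (bits (foundDigits x)) (bits (binaryDigits o)) [] [] (bits (binaryDigits b))))
          [ loop m (λ _ → eval N (pop sT >>= nextGate)) , done ]′)
        (hits b x)
    compared nothing          lx = refl
    compared (just nothing)   lx = refl
    compared (just (just bs)) lx =
      continue-final {a = inj₂ (eqBits bs (binaryDigits b))}
        (continue-done (clear-eval sB _ (length-bits-< (binaryDigits o) lo))
        (continue-done (moveAll-eval {i = sG} {sD} (λ ()) (binaryDigits b) _ refl (bits-reverse (binaryDigits b)) lb)
        (continue-done (moveAll-eval {i = sD} {sB} (λ ()) (reverse (binaryDigits b)) _ refl
            (bits-unreverse-[] (binaryDigits b)) (length-reverse-< (binaryDigits b) lb))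
        (continue-done (equality-eval bs (binaryDigits b) lbs lb)
          refl)))) refl
      where
      lbs : length bs < N
      lbs = ≤-trans (s≤s lx) (≤-trans (s≤s (≤-trans (≤-trans (m≤m+n V V) (m≤m+n _ _)) (n≤1+n _))) room)
    header : ∀ rs → rs ≡ reverse (binaryDigits o) →
      FinalVerdict
        (loop (suc m) (λ _ → eval N (pop sT >>= nextGate)) tt
          (store [] (bits rs) e [] [] [] [] [] (bits (binaryDigits b))))
        (hits b (lookupEnv o env))
    -- The program branches on the top symbol of the output name, so its reversed digits have to be
    -- split into cases; numerals are never empty.
    header [] eq with binaryDigits-∷ o
    ... | d , ds , eq′ = contradiction
      (trans (cong length eq) (trans (length-reverse (binaryDigits o)) (cong length eq′))) λ ()
    header (r ∷ rs) eq =
      subst (λ x → FinalVerdict (continue x [ loop m (λ _ → eval N (pop sT >>= nextGate)) , done ]′) (hits b (lookupEnv o env)))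
        (sym (continue-done
          (moveAll-eval {i = sT} {sB} (λ ()) (r ∷ rs) _ refl
            (trans (cong (λ ds → bits ds ʳ++ []) eq) (bits-unreverse-[] (binaryDigits o)))
            (subst (λ ds → length ds < N) (sym eq) (length-reverse-< (binaryDigits o) lo)))
          (continue-done (find-eval o env lo lenv) refl)))
        (compared (lookupEnv o env) (length-found o fits))
  evaluateLoop (suc m) o b env (g ∷ gs) (s≤s lm) lo lb (fits , gfits , next)
    rewrite gate-eval o g gs env {bits (binaryDigits b)} gfits fits
    with extend env g
  ... | nothing   = refl
  ... | just env′ = evaluateLoop m o b env′ gs lm lo lb (next refl)

-- The value for complement is junk: it is rejected before it reaches a stack.
symbol : Token → Γ
symbol (digit b)              = inj₁ b
symbol (operation complement) = inj₂ absent
symbol (operation (binary σ)) = inj₂ (operator σ)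
symbol comma                  = inj₂ separator
symbol semicolon              = inj₂ terminator

symbols-++ : ∀ ts {us xs} → map symbol (ts ++ us) ʳ++ xs ≡ map symbol us ʳ++ (map symbol ts ʳ++ xs)
symbols-++ ts {us} = trans (cong (_ʳ++ _) (List.map-++ symbol ts us)) (List.++-ʳ++ (map symbol ts))

symbols-number : ∀ n ts {xs} → map symbol (number n ++ ts) ʳ++ xs ≡
                 map symbol ts ʳ++ (bits (reverse (binaryDigits n)) ++ xs)
symbols-number n ts {xs} = trans (symbols-++ (number n) {ts}) (cong (map symbol ts ʳ++_)
  (trans (cong (_ʳ++ xs) (sym (List.map-∘ (binaryDigits n)))) (bits-ʳ++ (binaryDigits n))))

symbols-gate : ∀ o g gs → map symbol (tokensOfGate g) ʳ++ (inj₂ terminator ∷ layout o gs) ≡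
               inj₂ terminator ∷ layout o (g ∷ gs)
symbols-gate o (constant n l) gs =
  trans (symbols-number n (comma ∷ number l ++ comma ∷ semicolon ∷ []))
        (symbols-number l (comma ∷ semicolon ∷ []))
symbols-gate o (operate σ p q n) gs =
  trans (symbols-number n (comma ∷ operation (binary σ) ∷ comma ∷ number p ++ comma ∷ number q ++ comma ∷ semicolon ∷ []))
  (trans (symbols-number p (comma ∷ number q ++ comma ∷ semicolon ∷ []))
         (symbols-number q (comma ∷ semicolon ∷ [])))

symbols-gates : ∀ o gs hs → map symbol (concatMap tokensOfGate gs) ʳ++ (inj₂ terminator ∷ layout o hs) ≡
                inj₂ terminator ∷ layout o (gs ʳ++ hs)
symbols-gates o []       hs = refl
symbols-gates o (g ∷ gs) hs = trans (symbols-++ (tokensOfGate g))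
  (trans (cong (map symbol (concatMap tokensOfGate gs) ʳ++_) (symbols-gate o g hs))
         (symbols-gates o gs (g ∷ hs)))

-- Pushing the tokens in reading order puts the end of the word on top: first the target number,
-- then the last gate. This is the order in which evaluation needs them.
symbols-listing : ∀ o gs b → map symbol (tokensOf (listing o gs b)) ʳ++ [] ≡
                  bits (reverse (binaryDigits b)) ++ inj₂ terminator ∷ layout o (reverse gs)
symbols-listing o gs b = begin
  map symbol (number o ++ semicolon ∷ concatMap tokensOfGate gs ++ number b) ʳ++ []
    ≡⟨ symbols-number o (semicolon ∷ concatMap tokensOfGate gs ++ number b) ⟩
  map symbol (concatMap tokensOfGate gs ++ number b) ʳ++ (inj₂ terminator ∷ bits (reverse (binaryDigits o)) ++ [])
    ≡⟨ cong (λ xs → map symbol (concatMap tokensOfGate gs ++ number b) ʳ++ (inj₂ terminator ∷ xs))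
         (List.++-identityʳ (bits (reverse (binaryDigits o)))) ⟩
  map symbol (concatMap tokensOfGate gs ++ number b) ʳ++ (inj₂ terminator ∷ layout o [])
    ≡⟨ symbols-++ (concatMap tokensOfGate gs) ⟩
  map symbol (number b) ʳ++ (map symbol (concatMap tokensOfGate gs) ʳ++ (inj₂ terminator ∷ layout o []))
    ≡⟨ cong (map symbol (number b) ʳ++_) (symbols-gates o gs []) ⟩
  map symbol (number b) ʳ++ (inj₂ terminator ∷ layout o (reverse gs))
    ≡⟨ cong (λ ts → map symbol ts ʳ++ (inj₂ terminator ∷ layout o (reverse gs))) (List.++-identityʳ (number b)) ⟨
  map symbol (number b ++ []) ʳ++ (inj₂ terminator ∷ layout o (reverse gs))
    ≡⟨ symbols-number b [] ⟩
  bits (reverse (binaryDigits b)) ++ inj₂ terminator ∷ layout o (reverse gs) ∎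
  where open ≡-Reasoning

-- The decision procedure

module Decision (allowed : BinOp → Bool) where
  open Syntax allowed

  advance : Token → Maybe SyntaxState → Prog (SyntaxState ⊎ ⊤)
  advance t nothing  = fail
  advance t (just q) = push sT (symbol t) >> ret (inj₁ q)

  acceptToken : SyntaxState → Maybe Token → Prog (SyntaxState ⊎ ⊤)
  acceptToken q       nothing  = fail
  acceptToken (c , n) (just t) = advance t (syntaxStep c n t)

  withBit : (Bool → Prog A) → Maybe Γ → Prog A
  withBit k (just (inj₁ b)) = k b
  withBit k _               = fail

  readToken : SyntaxState → Maybe Γ → Prog (SyntaxState ⊎ ⊤)
  readToken (c , n) nothing          = if final c n then ret (inj₂ tt) else fail
  readToken q       (just (inj₁ b₁)) =
    pop sD >>= withBit λ b₂ → pop sD >>= withBit λ b₃ → pop sD >>= withBit λ b₄ →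
    acceptToken q (decodeToken b₁ b₂ b₃ b₄)
  readToken q       (just (inj₂ m))  = fail

  -- Keeps the program folded in later statements about its machine and its cost.
  opaque
    decide : Prog Bool
    decide = iter (λ q → pop sD >>= readToken q) (inOutput , fresh) >> (moveDigits sT sG >> evaluate)

  scanOutcome : List Γ → Maybe (List Token) → Result Store ⊤
  scanOutcome t nothing   = failed
  scanOutcome t (just ts) = done tt (store [] (map symbol ts ʳ++ t) [] [] [] [] [] [] [])

  scanLoop : ∀ N m c n w r t → Scan c n w r → length w < m →
    loop m (λ q → eval N (pop sD >>= readToken q)) (c , n) (store (bits w) t [] [] [] [] [] [] []) ≡ scanOutcome t r
  scanLoop N (suc m) c n _ _ t (finished fin)   lm rewrite fin = refl
  scanLoop N (suc m) c n _ _ t (unfinished fin) lm rewrite fin = refl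
  scanLoop N (suc m) c n _ _ t (odd₁ b₁)        lm = refl
  scanLoop N (suc m) c n _ _ t (odd₂ b₁ b₂)     lm = refl
  scanLoop N (suc m) c n _ _ t (odd₃ b₁ b₂ b₃)  lm = refl
  scanLoop N (suc m) c n _ _ t (noToken b₁ b₂ b₃ b₄ eq) lm rewrite eq = refl
  scanLoop N (suc m) c n _ _ t (misplaced b₁ b₂ b₃ b₄ eq eq′) lm rewrite eq | eq′ = refl
  scanLoop N (suc m) c n _ _ t (token b₁ b₂ b₃ b₄ {w} {u} {c′} {n′} {r} eq eq′ s) (s≤s lm) rewrite eq | eq′ =
    trans (scanLoop N m c′ n′ w r (symbol u ∷ t) s
             (≤-trans (≤-trans (n≤1+n _) (≤-trans (n≤1+n _) (n≤1+n _))) lm))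
          (rest r)
    where
    rest : ∀ r → scanOutcome (symbol u ∷ t) r ≡ scanOutcome t (Maybe.map (u ∷_) r)
    rest nothing  = refl
    rest (just _) = refl

  opaque
    unfolding decide

    decide-rejects : ∀ {N w} → Scan inOutput fresh w nothing → length w < N →
                     FinalVerdict (eval N decide (inputStore w)) false
    decide-rejects {N} {w} s lw rewrite scanLoop N N inOutput fresh w nothing [] s lw = refl

  module _ (N V : ℕ) (room : suc (V + V + 2 * V) < N) where
    open Room N V room
    open Evaluation N V room

    opaque
      unfolding decide

      decide-listing : ∀ {w} o gs b →
        Scan inOutput fresh w (just (tokensOf (listing o gs b))) → length w < N →
        length gs < N → NumberFits o → NumberFits b → Fits [] (reverse gs) →
        FinalVerdict (eval N decide (inputStore w)) (verdictOf o b (process [] (reverse gs)))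
      decide-listing {w} o gs b s lw lgs lo lb fits =
        continue-final (scanLoop N N inOutput fresh w _ [] s lw)
          (continue-final
            (moveDigits-eval {i = sT} {sG} (λ ()) (reverse (binaryDigits b)) (just (terminator , layout o (reverse gs))) _
              (symbols-listing o gs b) (bits-unreverse-[] (binaryDigits b)) (length-reverse-< (binaryDigits b) lb))
            (evaluateLoop N o b [] (reverse gs) (subst (_< N) (sym (length-reverse gs)) lgs) lo lb fits))

-- The sets computed by circuits

Denotes : Value → NatSet
Denotes nothing   c = ⊥
Denotes (just bs) c = value bs ≡ c

≐-trans : {A B C : NatSet} → A ≐ B → B ≐ C → A ≐ C
≐-trans (to , from) (to′ , from′) = to′ ∘ to , from ∘ from′

⟦⟧-cong : ∀ σ {A A′ B B′ : NatSet} → A ≐ A′ → B ≐ B′ → ⟦ σ ⟧ A B ≐ ⟦ σ ⟧ A′ B′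
⟦⟧-cong union    (f , f′) (g , g′) =
  (λ { (inj₁ x) → inj₁ (f x) ; (inj₂ y) → inj₂ (g y) }) , (λ { (inj₁ x) → inj₁ (f′ x) ; (inj₂ y) → inj₂ (g′ y) })
⟦⟧-cong inter    (f , f′) (g , g′) = (λ (x , y) → f x , g y) , (λ (x , y) → f′ x , g′ y)
⟦⟧-cong plus     (f , f′) (g , g′) =
  (λ (a , b , x , y , eq) → a , b , f x , g y , eq) , (λ (a , b , x , y , eq) → a , b , f′ x , g′ y , eq)
⟦⟧-cong times    (f , f′) (g , g′) =
  (λ (a , b , x , y , eq) → a , b , f x , g y , eq) , (λ (a , b , x , y , eq) → a , b , f′ x , g′ y , eq)
⟦⟧-cong quotient (f , f′) (g , g′) =
  (λ (a , b , x , y , eq) → a , b , f x , g y , eq) , (λ (a , b , x , y , eq) → a , b , f′ x , g′ y , eq)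

applyOp-correct : ∀ σ → σ ≢ union → ∀ as bs →
  ⟦ σ ⟧ (Denotes (just as)) (Denotes (just bs)) ≐ Denotes (applyOp σ as bs)
applyOp-correct union    σ≢ as bs = contradiction refl σ≢
applyOp-correct inter    σ≢ as bs with eqBits as bs | eqBits-sound as bs | eqBits-complete as bs
... | true  | sound | complete = proj₁ , λ eq → eq , trans (sym (sound refl)) eq
... | false | sound | complete =
  (λ (eq , eq′) → contradiction (complete (trans eq (sym eq′))) λ ()) , λ ()
applyOp-correct plus     σ≢ as bs =
  (λ { (_ , _ , refl , refl , refl) → value-add as bs }) ,
  (λ { refl → _ , _ , refl , refl , value-add as bs })
applyOp-correct times    σ≢ as bs =
  (λ { (_ , _ , refl , refl , refl) → value-mul as bs }) ,
  (λ { refl → _ , _ , refl , refl , value-mul as bs })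
applyOp-correct quotient σ≢ as bs with div as bs | div-correct as bs
... | nothing | none       = (λ { {c} (_ , _ , refl , refl , b≢0 , eq) → none b≢0 c eq }) , λ ()
... | just cs | b≢0 , eq =
  (λ { {c} (_ , _ , refl , refl , _ , eq′) →
       *-cancelʳ-≡ _ c (value bs) {{≢-nonZero b≢0}} (trans (sym eq) eq′) }) ,
  (λ { refl → _ , _ , refl , refl , b≢0 , eq })

applyValues-correct : ∀ σ → σ ≢ union → ∀ x y →
  ⟦ σ ⟧ (Denotes x) (Denotes y) ≐ Denotes (applyValues σ x y)
applyValues-correct σ        σ≢ (just as) (just bs) = applyOp-correct σ σ≢ as bs
applyValues-correct union    σ≢ _         _         = contradiction refl σ≢
applyValues-correct inter    σ≢ nothing   y         = (λ ()) , λ ()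
applyValues-correct plus     σ≢ nothing   y         = (λ ()) , λ ()
applyValues-correct times    σ≢ nothing   y         = (λ ()) , λ ()
applyValues-correct quotient σ≢ nothing   y         = (λ ()) , λ ()
applyValues-correct inter    σ≢ (just _)  nothing   = (λ ()) , λ ()
applyValues-correct plus     σ≢ (just _)  nothing   = (λ ()) , λ ()
applyValues-correct times    σ≢ (just _)  nothing   = (λ ()) , λ ()
applyValues-correct quotient σ≢ (just _)  nothing   = (λ ()) , λ ()

nodeResult-cong : ∀ {O V} (v : Node O V) {I J : ∀ {p} → p ∈ predecessors v → NatSet} →
  (∀ {p} (e : p ∈ predecessors v) → I e ≐ J e) → nodeResult v I ≐ nodeResult v J
nodeResult-cong (input n)     eq = id , id
nodeResult-cong (unary _ p)   eq =
  let to , from = eq (here refl) in (λ ∉ ∈ → ∉ (from ∈)) , (λ ∉ ∈ → ∉ (to ∈))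
nodeResult-cong (bin σ _ p q) eq = ⟦⟧-cong σ (eq (here refl)) (eq (there (here refl)))

-- By well-founded induction the equations at the single gates determine all result sets. Both
-- directions of the correctness proof use this, with values read off an environment or computed by
-- recursion along the circuit.
gateResult-denotes : ∀ {O} (C : Circuit O) (val : Fin (Circuit.size C) → Value) →
  (∀ g → nodeResult (Circuit.node C g) (λ {p} _ → Denotes (val p)) ≐ Denotes (val g)) →
  ∀ g → gateResult C g ≐ Denotes (val g)
gateResult-denotes C val local g = go g (⟶-wellFounded g)
  where
  open Circuit C
  go : ∀ g (a : Acc _⟶_ g) → gateResultAcc C g a ≐ Denotes (val g)
  go g (WF.acc rs) = ≐-trans (nodeResult-cong (node g) (λ e → go _ (rs e))) (local g)

hits-sound : ∀ b {v} → hits b (just v) ≡ true → Denotes v b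
hits-sound b {just bs} eq = trans (eqBits-sound bs (binaryDigits b) eq) (value-binaryDigits b)

hits-complete : ∀ b {v} → Denotes v b → hits b (just v) ≡ true
hits-complete b {just bs} eq = eqBits-complete bs (binaryDigits b) (trans eq (sym (value-binaryDigits b)))

lookupEnv-here : ∀ g v env → lookupEnv (gateName g) ((g , v) ∷ env) ≡ just v
lookupEnv-here g v env
  rewrite eqBits-complete (binaryDigits (gateName g)) (binaryDigits (gateName g)) refl = refl

lookupEnv-there : ∀ k g v env → gateName g ≢ k → lookupEnv k ((g , v) ∷ env) ≡ lookupEnv k env
lookupEnv-there k g v env ≢k
  with eqBits (binaryDigits (gateName g)) (binaryDigits k) | eqBits-sound (binaryDigits (gateName g)) (binaryDigits k)
... | false | _     = refl
... | true  | sound = contradiction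
  (trans (sym (value-binaryDigits (gateName g))) (trans (sound refl) (value-binaryDigits k))) ≢k

nameAt : (env : Env) → Fin (length env) → ℕ
nameAt env i = gateName (proj₁ (List.lookup env i))

valueAt : (env : Env) → Fin (length env) → Value
valueAt env i = proj₂ (List.lookup env i)

lookupEnv-sound : ∀ k env {v} → lookupEnv k env ≡ just v → ∃[ i ] (nameAt env i ≡ k × valueAt env i ≡ v)
lookupEnv-sound k ((g , v) ∷ env) eq
  with eqBits (binaryDigits (gateName g)) (binaryDigits k) | eqBits-sound (binaryDigits (gateName g)) (binaryDigits k)
... | true  | sound = zero ,
  trans (sym (value-binaryDigits (gateName g))) (trans (sound refl) (value-binaryDigits k)) , just-injective eq
... | false | _     = let i , eqn , eqv = lookupEnv-sound k env eq in suc i , eqn , eqv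

lookupEnv-nothing : ∀ k env → lookupEnv k env ≡ nothing → ∀ i → nameAt env i ≢ k
lookupEnv-nothing k ((g , v) ∷ env) eq zero refl =
  contradiction (trans (sym (lookupEnv-here g v env)) eq) λ ()
lookupEnv-nothing k ((g , v) ∷ env) eq (suc i)
  with eqBits (binaryDigits (gateName g)) (binaryDigits k)
... | false = lookupEnv-nothing k env eq i

insertNew-just : ∀ env g v {env′} → insertNew env g v ≡ just env′ →
                 lookupEnv (gateName g) env ≡ nothing × env′ ≡ (g , v) ∷ env
insertNew-just env g v eq with lookupEnv (gateName g) env
insertNew-just env g v refl | nothing = refl , refl

extend-just : ∀ env g {env′} → extend env g ≡ just env′ →
              ∃[ v ] (gateValue env g ≡ just v × lookupEnv (gateName g) env ≡ nothing × env′ ≡ (g , v) ∷ env)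
extend-just env g eq with gateValue env g
... | just v = v , refl , insertNew-just env g v eq

-- The successful runs of `process` as an inductive type. The latest gate is at the head, so after
-- processing the reversed listing the entries stand in the order of the listing.
data Evaluated : Env → Set where
  []  : Evaluated []
  _∷_ : ∀ {g v env} → gateValue env g ≡ just v × lookupEnv (gateName g) env ≡ nothing →
        Evaluated env → Evaluated ((g , v) ∷ env)

process-evaluated : ∀ env gs {env′} → process env gs ≡ just env′ → Evaluated env →
                    Evaluated env′ × map proj₁ env′ ≡ gs ʳ++ map proj₁ env
process-evaluated env []       refl ev = ev , refl
process-evaluated env (g ∷ gs) eq   ev with extend env g in eqx
... | just env₁ with extend-just env g eqx
... | v , eqv , fresh′ , refl = process-evaluated ((g , v) ∷ env) gs eq ((eqv , fresh′) ∷ ev)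

evaluated-process : ∀ {env} → Evaluated env → ∀ gs → process [] (map proj₁ env ʳ++ gs) ≡ process env gs
evaluated-process [] gs = refl
evaluated-process (_∷_ {g} {v} {env} (eqv , fresh′) ev) gs =
  trans (evaluated-process ev (g ∷ gs)) (cong (Maybe._>>= λ env′ → process env′ gs) extended)
  where
  extended : extend env g ≡ just ((g , v) ∷ env)
  extended rewrite eqv | fresh′ = refl

module _ {V : Set} (name : V → ℕ) where

  -- The value for complement gates is junk.
  gateOf : ∀ {O} → ℕ → Node O V → Gate
  gateOf n (input l)     = constant n l
  gateOf n (unary _ _)   = constant n 0
  gateOf n (bin σ _ p q) = operate σ (name p) (name q) n

listed : ∀ {O} (C : Circuit O) → Fin (Circuit.size C) → Gate
listed C g = gateOf (Circuit.name C) (Circuit.name C g) (Circuit.node C g)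

tabulate-concatMap : ∀ {A : Set} n (f : A → List Token) (h : Fin n → A) (k : Fin n → List Token) →
  (∀ i → k i ≡ f (h i)) → concatMap k (allFin n) ≡ concatMap f (tabulate h)
tabulate-concatMap n f h k eq = cong List.concat
  (trans (List.map-tabulate id k) (trans (List.tabulate-cong eq) (sym (List.map-tabulate h f))))

module _ {O : List Op} (no-complement : ¬ complement ∈ O) (C : Circuit O) where
  open Circuit C

  gateTokens-listed : ∀ g → gateTokens C g ≡ tokensOfGate (listed C g)
  gateTokens-listed g with node g
  ... | input l        = refl
  ... | unary ¬∈ _     = contradiction ¬∈ no-complement
  ... | bin σ σ∈ p q   = cong (λ ts → number (name g) ++ comma ∷ operation (binary σ) ∷ comma ∷ ts) (begin
    ((number (name p) ++ [ comma ]) ++ (number (name q) ++ [ comma ]) ++ []) ++ [ semicolon ]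
      ≡⟨ ++-assoc (number (name p) ++ [ comma ]) _ _ ⟩
    (number (name p) ++ [ comma ]) ++ ((number (name q) ++ [ comma ]) ++ []) ++ [ semicolon ]
      ≡⟨ ++-assoc (number (name p)) _ _ ⟩
    number (name p) ++ comma ∷ ((number (name q) ++ [ comma ]) ++ []) ++ [ semicolon ]
      ≡⟨ cong (λ ts → number (name p) ++ comma ∷ ts ++ [ semicolon ]) (List.++-identityʳ (number (name q) ++ [ comma ])) ⟩
    number (name p) ++ comma ∷ (number (name q) ++ [ comma ]) ++ [ semicolon ]
      ≡⟨ cong (λ ts → number (name p) ++ comma ∷ ts) (++-assoc (number (name q)) _ _) ⟩
    number (name p) ++ comma ∷ number (name q) ++ comma ∷ semicolon ∷ [] ∎)
    where open ≡-Reasoning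

  encode-listed : ∀ b → encode C b ≡
    concatMap tokenCode (tokensOf (listing (name output) (tabulate (listed C)) b))
  encode-listed b = cong (concatMap tokenCode) (trans (++-assoc (number (name output)) _ _)
    (cong (λ ts → number (name output) ++ semicolon ∷ ts ++ number b)
      (tabulate-concatMap size tokensOfGate (listed C) (gateTokens C) gateTokens-listed)))

-- Soundness and completeness of the evaluation

module Semantics {O : List Op} (allowed : BinOp → Bool)
  (allowed-sound : ∀ σ → allowed σ ≡ true → binary σ ∈ O)
  (allowed-complete : ∀ σ → binary σ ∈ O → allowed σ ≡ true)
  (no-complement : ¬ complement ∈ O) (no-union : allowed union ≡ false) where

  open Syntax allowed

  private
    not-union : ∀ {σ} → allowed σ ≡ true → σ ≢ union
    not-union eq refl = contradiction (trans (sym eq) no-union) λ ()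

  module Sound {env : Env} (evaluated : Evaluated env) (ops : All OpAllowed (map proj₁ env))
               (out : Fin (length env)) where

    -- Names of predecessors resolved to positions in the environment. An entry was evaluated in its
    -- own tail, so the positions `j` and `k` come after `i`; this gives both the reverse
    -- topological order and acyclicity of the circuit constructed below.
    data Resolved : (env : Env) → Fin (length env) → Set where
      constant : ∀ {env i} n l → List.lookup env i ≡ (constant n l , just (binaryDigits l)) → Resolved env i
      operate  : ∀ {env i} σ n j k → allowed σ ≡ true →
                 List.lookup env i ≡ (operate σ (nameAt env j) (nameAt env k) n ,
                                      applyValues σ (valueAt env j) (valueAt env k)) →
                 i Fin.< j → i Fin.< k → nameAt env j ≤ nameAt env k → Resolved env i

    resolved-suc : ∀ {e env i} → Resolved env i → Resolved (e ∷ env) (suc i)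
    resolved-suc (constant n l eq)                = constant n l eq
    resolved-suc (operate σ n j k ok eq i<j i<k le) =
      operate σ n (suc j) (suc k) ok eq (s≤s i<j) (s≤s i<k) le

    resolved-zero : ∀ g {v env} → gateValue env g ≡ just v → OpAllowed g → Resolved ((g , v) ∷ env) zero
    resolved-zero (constant n l) refl ok = constant n l refl
    resolved-zero (operate σ p q n) {v} {env} eq ok
      with leqBits (binaryDigits p) (binaryDigits q) in eql
    ... | true with lookupEnv q env in eqq
    ... | just y with lookupEnv p env in eqp
    ... | just x with lookupEnv-sound q env eqq | lookupEnv-sound p env eqp
    resolved-zero (operate σ p q n) {v} {env} refl ok | true | just _ | just _
      | k , refl , refl | j , refl , refl =
      operate σ n (suc j) (suc k) ok refl (s≤s z≤n) (s≤s z≤n)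
        (subst₂ _≤_ (value-binaryDigits p) (value-binaryDigits q)
          (leqBits-sound (binaryDigits p) (binaryDigits q) eql))

    resolve : ∀ {env} → Evaluated env → All OpAllowed (map proj₁ env) → ∀ i → Resolved env i
    resolve (_∷_ {g} (eqv , _) ev) (ok ∷ ops) zero    = resolved-zero g eqv ok
    resolve (_ ∷ ev)               (ok ∷ ops) (suc i) = resolved-suc (resolve ev ops i)

    nameAt-injective : ∀ {env} → Evaluated env → ∀ {i j} → nameAt env i ≡ nameAt env j → i ≡ j
    nameAt-injective (_ ∷ ev) {zero} {zero} eq = refl
    nameAt-injective (_∷_ {g} {v} {env} (_ , fresh′) ev) {zero} {suc j} eq =
      contradiction (sym eq) (lookupEnv-nothing (gateName g) env fresh′ j)
    nameAt-injective (_∷_ {g} {v} {env} (_ , fresh′) ev) {suc i} {zero} eq =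
      contradiction eq (lookupEnv-nothing (gateName g) env fresh′ i)
    nameAt-injective (_ ∷ ev) {suc i} {suc j} eq = cong suc (nameAt-injective ev eq)

    nodeOf : ∀ {i} → Resolved env i → Node O (Fin (length env))
    nodeOf (constant n l _)              = input l
    nodeOf (operate σ n j k ok _ _ _ _)  = bin σ (allowed-sound σ ok) j k

    nodeAt : Fin (length env) → Node O (Fin (length env))
    nodeAt i = nodeOf (resolve evaluated ops i)

    later : ∀ {p g} → p ∈ predecessors (nodeAt g) → g Fin.< p
    later {p} {g} = go (resolve evaluated ops g)
      where
      go : (r : Resolved env g) → p ∈ predecessors (nodeOf r) → g Fin.< p
      go (operate σ n j k ok eq i<j i<k le) (here refl)         = i<j
      go (operate σ n j k ok eq i<j i<k le) (there (here refl)) = i<k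

    later⁺ : ∀ {p g} → TransClosure (λ p g → p ∈ predecessors (nodeAt g)) p g → g Fin.< p
    later⁺ Closure.[ e ]   = later e
    later⁺ (e Closure.∷ c) = Fin.<-trans (later⁺ c) (later e)

    circuit : Circuit O
    circuit = record
      { size     = length env
      ; name     = nameAt env
      ; name-inj = nameAt-injective evaluated
      ; node     = nodeAt
      ; output   = out
      ; ordered  = λ g → orderedOf (resolve evaluated ops g)
      ; acyclic  = λ g c → Fin.<-irrefl refl (later⁺ c)
      }
      where
      orderedOf : ∀ {i} (r : Resolved env i) →
                  Linked (λ p q → nameAt env p ≤ nameAt env q) (predecessors (nodeOf r))
      orderedOf (constant n l eq)                  = []
      orderedOf (operate σ n j k ok eq i<j i<k le) = le ∷ [-]

    listed-lookup : ∀ i → listed circuit i ≡ proj₁ (List.lookup env i)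
    listed-lookup i = go (resolve evaluated ops i)
      where
      go : (r : Resolved env i) → gateOf (nameAt env) (nameAt env i) (nodeOf r) ≡ proj₁ (List.lookup env i)
      go (constant n l eq) rewrite eq                  = refl
      go (operate σ n j k ok eq i<j i<k le) rewrite eq = refl

    listed-gates : tabulate (listed circuit) ≡ map proj₁ env
    listed-gates = trans (List.tabulate-cong listed-lookup)
      (trans (sym (List.map-tabulate (List.lookup env) proj₁)) (cong (map proj₁) (List.tabulate-lookup env)))

    circuit-result : result circuit ≐ Denotes (valueAt env out)
    circuit-result = gateResult-denotes circuit (valueAt env) (λ g → local g (resolve evaluated ops g)) out
      where
      local : ∀ i (r : Resolved env i) →
              nodeResult (nodeOf r) (λ {p} _ → Denotes (valueAt env p)) ≐ Denotes (valueAt env i)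
      local i (constant n l eq) rewrite eq =
        (λ { refl → value-binaryDigits l }) , (λ { refl → sym (value-binaryDigits l) })
      local i (operate σ n j k ok eq i<j i<k le) rewrite eq =
        applyValues-correct σ (not-union ok) (valueAt env j) (valueAt env k)

  verdict-sound : ∀ o gs b → All OpAllowed gs → verdictOf o b (process [] (reverse gs)) ≡ true →
                  MC O (concatMap tokenCode (tokensOf (listing o gs b)))
  verdict-sound o gs b ops eq with process [] (reverse gs) in eqp
  ... | just env with process-evaluated [] (reverse gs) eqp []
  ... | ev , gates≡ with lookupEnv o env in eqo
  ... | just v with lookupEnv-sound o env eqo
  ... | out , refl , refl = circuit , b , later , encoding , proj₂ circuit-result (hits-sound b eq)
    where
    gates-env : map proj₁ env ≡ gs
    gates-env = trans gates≡ (List.reverse-involutive gs)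
    open Sound ev (subst (All OpAllowed) (sym gates-env) ops) out
    encoding : concatMap tokenCode (tokensOf (listing (nameAt env out) gs b)) ≡ encode circuit b
    encoding = sym (trans (encode-listed no-complement circuit b)
      (cong (λ gs → concatMap tokenCode (tokensOf (listing (nameAt env out) gs b))) (trans listed-gates gates-env)))

  module Complete (C : Circuit O) (later : ReverseTopological C) where
    open Circuit C

    nodeValue : (v : Node O (Fin size)) → (∀ {p} → p ∈ predecessors v → Value) → Value
    nodeValue (input l)     val = just (binaryDigits l)
    nodeValue (unary _ _)   val = nothing
    nodeValue (bin σ _ p q) val = applyValues σ (val (here refl)) (val (there (here refl)))

    nodeValue-cong : ∀ v {val val′ : ∀ {p} → p ∈ predecessors v → Value} →
      (∀ {p} (e : p ∈ predecessors v) → val e ≡ val′ e) → nodeValue v val ≡ nodeValue v val′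
    nodeValue-cong (input l)     eq = refl
    nodeValue-cong (unary _ _)   eq = refl
    nodeValue-cong (bin σ _ p q) eq = cong₂ (applyValues σ) (eq (here refl)) (eq (there (here refl)))

    gateVal-acc : ∀ g → Acc _⟶_ g → Value
    gateVal-acc g (WF.acc rs) = nodeValue (node g) (λ e → gateVal-acc _ (rs e))

    -- Unfolding a gate hands its predecessors accessibility proofs other than the ones that
    -- `⟶-wellFounded` provides for them; the recursion equation `gateVal-unfold` has to identify
    -- the resulting values.
    gateVal-irrelevant : ∀ g (a a′ : Acc _⟶_ g) → gateVal-acc g a ≡ gateVal-acc g a′
    gateVal-irrelevant g (WF.acc rs) (WF.acc rs′) =
      nodeValue-cong (node g) (λ e → gateVal-irrelevant _ (rs e) (rs′ e))

    gateVal : Fin size → Value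
    gateVal g = gateVal-acc g (⟶-wellFounded g)

    gateVal-unfold : ∀ g → gateVal g ≡ nodeValue (node g) (λ {p} _ → gateVal p)
    gateVal-unfold g with ⟶-wellFounded g
    ... | WF.acc rs = nodeValue-cong (node g) (λ {p} e → gateVal-irrelevant p (rs e) (⟶-wellFounded p))

    gateResult-gateVal : ∀ g → gateResult C g ≐ Denotes (gateVal g)
    gateResult-gateVal = gateResult-denotes C gateVal
      (λ g → subst (λ v → nodeResult (node g) (λ {p} _ → Denotes (gateVal p)) ≐ Denotes v)
                   (sym (gateVal-unfold g)) (local (node g)))
      where
      local : ∀ v → nodeResult v (λ {p} _ → Denotes (gateVal p)) ≐ Denotes (nodeValue v (λ {p} _ → gateVal p))
      local (input l)      =
        (λ { refl → value-binaryDigits l }) , (λ { refl → sym (value-binaryDigits l) })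
      local (unary ¬∈ _)   = contradiction ¬∈ no-complement
      local (bin σ σ∈ p q) = applyValues-correct σ (not-union (allowed-complete σ σ∈)) (gateVal p) (gateVal q)

    entryAt : Fin size → Gate × Value
    entryAt g = listed C g , gateVal g

    listed-name : ∀ g → gateName (listed C g) ≡ name g
    listed-name g with node g
    ... | input _     = refl
    ... | unary _ _   = refl
    ... | bin _ _ _ _ = refl

    lookup-absent : ∀ m (f : Fin m → Fin size) g → (∀ i → f i ≢ g) →
                    lookupEnv (name g) (tabulate (entryAt ∘ f)) ≡ nothing
    lookup-absent zero    f g ≢g = refl
    lookup-absent (suc m) f g ≢g =
      trans (lookupEnv-there (name g) (listed C (f zero)) _ (tabulate (entryAt ∘ f ∘ suc))
              (λ eq → ≢g zero (name-inj (trans (sym (listed-name (f zero))) eq))))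
            (lookup-absent m (f ∘ suc) g (≢g ∘ suc))

    lookup-present : ∀ m (f : Fin m → Fin size) → (∀ {i j} → f i ≡ f j → i ≡ j) → ∀ i →
                     lookupEnv (name (f i)) (tabulate (entryAt ∘ f)) ≡ just (gateVal (f i))
    lookup-present (suc m) f inj zero =
      subst (λ n → lookupEnv n (tabulate (entryAt ∘ f)) ≡ just (gateVal (f zero))) (listed-name (f zero))
            (lookupEnv-here (listed C (f zero)) _ (tabulate (entryAt ∘ f ∘ suc)))
    lookup-present (suc m) f inj (suc i) =
      trans (lookupEnv-there (name (f (suc i))) (listed C (f zero)) _ (tabulate (entryAt ∘ f ∘ suc))
              (λ eq → contradiction (inj (name-inj (trans (sym (listed-name (f zero))) eq))) λ ()))
            (lookup-present m (f ∘ suc) (Fin.suc-injective ∘ inj) i)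

    -- f enumerates a final segment of the gates.
    evaluated-tabulate : ∀ m (f : Fin m → Fin size) → (∀ {i j} → f i ≡ f j → i ≡ j) →
      (∀ i p → f i Fin.< p → ∃[ j ] (i Fin.< j × f j ≡ p)) → Evaluated (tabulate (entryAt ∘ f))
    evaluated-tabulate zero    f inj up = []
    evaluated-tabulate (suc m) f inj up =
      (trans (value-listed (node g) later (Circuit.ordered C g)) (cong just (sym (gateVal-unfold g))) ,
       subst (λ n → lookupEnv n env ≡ nothing) (sym (listed-name g))
             (lookup-absent m (f ∘ suc) g (λ i eq → contradiction (inj eq) λ ()))) ∷
      evaluated-tabulate m (f ∘ suc) (Fin.suc-injective ∘ inj)
        (λ i p lt → tail (up (suc i) p lt))
      where
      tail : ∀ {i p} → ∃[ j ] (suc i Fin.< j × f j ≡ p) → ∃[ j ] (i Fin.< j × f (suc j) ≡ p)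
      tail (suc j , s≤s lt , eq) = j , lt , eq
      g : Fin size
      g = f zero
      env : Env
      env = tabulate (entryAt ∘ f ∘ suc)
      found : ∀ p → g Fin.< p → lookupEnv (name p) env ≡ just (gateVal p)
      found p lt with up zero p lt
      ... | suc j , _ , refl = lookup-present m (f ∘ suc) (Fin.suc-injective ∘ inj) j
      value-listed : ∀ v → (∀ {p} → p ∈ predecessors v → g Fin.< p) →
        Linked (λ p q → name p ≤ name q) (predecessors v) →
        gateValue env (gateOf name (name g) v) ≡ just (nodeValue v (λ {p} _ → gateVal p))
      value-listed (input l)      lt ord = refl
      value-listed (unary ¬∈ _)   lt ord = contradiction ¬∈ no-complement
      value-listed (bin σ _ p q)  lt (le ∷ _)
        rewrite leqBits-complete (binaryDigits (name p)) (binaryDigits (name q))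
                  (subst₂ _≤_ (sym (value-binaryDigits (name p))) (sym (value-binaryDigits (name q))) le)
              | found q (lt (there (here refl))) | found p (lt (here refl)) = refl

    ops-listed : All OpAllowed (tabulate (listed C))
    ops-listed = All.tabulate⁺ (λ g → ok (node g))
      where
      ok : ∀ {n} v → OpAllowed (gateOf name n v)
      ok (input l)      = tt
      ok (unary _ _)    = tt
      ok (bin σ σ∈ p q) = allowed-complete σ σ∈

    verdict-listed : ∀ b → result C b →
      verdictOf (name output) b (process [] (reverse (tabulate (listed C)))) ≡ true
    verdict-listed b res = trans (cong (verdictOf (name output) b) processed)
      (trans (cong (hits b) (lookup-present size id id output))
             (hits-complete b (proj₁ (gateResult-gateVal output) res)))
      where
      processed : process [] (reverse (tabulate (listed C))) ≡ just (tabulate entryAt)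
      processed = trans (cong (λ gs → process [] (reverse gs)) (sym (List.map-tabulate entryAt proj₁)))
        (evaluated-process (evaluated-tabulate size id id (λ i p lt → p , lt , refl)) [])

-- Lengths

length-number : ∀ n → length (number n) ≡ length (binaryDigits n)
length-number n = length-map digit (binaryDigits n)

length-code : ∀ ts → length ts ≤ length (concatMap tokenCode ts)
length-code []       = z≤n
length-code (t ∷ ts) = ≤-trans (+-mono-≤ (1≤ t) (length-code ts)) (≤-reflexive (sym (length-++ (tokenCode t))))
  where
  1≤ : ∀ t → 1 ≤ length (tokenCode t)
  1≤ (digit false)                 = s≤s z≤n
  1≤ (digit true)                  = s≤s z≤n
  1≤ comma                         = s≤s z≤n
  1≤ semicolon                     = s≤s z≤n
  1≤ (operation complement)        = s≤s z≤n
  1≤ (operation (binary union))    = s≤s z≤n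
  1≤ (operation (binary inter))    = s≤s z≤n
  1≤ (operation (binary plus))     = s≤s z≤n
  1≤ (operation (binary times))    = s≤s z≤n
  1≤ (operation (binary quotient)) = s≤s z≤n

module _ (n : ℕ) where

  Short : ℕ → Set
  Short k = length (binaryDigits k) ≤ n

  ShortGate : Gate → Set
  ShortGate (constant m l)    = Short m × Short l
  ShortGate (operate σ p q m) = Short p × Short q × Short m

  private
    initialShort : ∀ k {ts} → length (number k ++ ts) ≤ n → Short k
    initialShort k {ts} le = ≤-trans (≤-reflexive (sym (length-number k)))
      (≤-trans (≤-trans (m≤m+n _ _) (≤-reflexive (sym (length-++ (number k))))) le)

    tailShort : ∀ xs {t : Token} {ts} → length (xs ++ t ∷ ts) ≤ n → length ts ≤ n
    tailShort xs le = ≤-trans (<⇒≤ (suffix< xs)) le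

  short-gate : ∀ g → length (tokensOfGate g) ≤ n → ShortGate g
  short-gate (constant m l) le =
    initialShort m {comma ∷ ts} le , initialShort l {comma ∷ semicolon ∷ []} (tailShort (number m) {comma} {ts} le)
    where
    ts : List Token
    ts = number l ++ comma ∷ semicolon ∷ []
  short-gate (operate σ p q m) le =
    initialShort p {comma ∷ ts₂} le₁ ,
    initialShort q {comma ∷ semicolon ∷ []} (tailShort (number p) {comma} {ts₂} le₁) ,
    initialShort m {comma ∷ operation (binary σ) ∷ comma ∷ ts₁} le
    where
    ts₁ ts₂ : List Token
    ts₂ = number q ++ comma ∷ semicolon ∷ []
    ts₁ = number p ++ comma ∷ ts₂
    le₁ : length ts₁ ≤ n
    le₁ = ≤-trans (≤-trans (n≤1+n _) (n≤1+n _))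
      (tailShort (number m) {comma} {operation (binary σ) ∷ comma ∷ ts₁} le)

  short-gates : ∀ gs → length (concatMap tokensOfGate gs) ≤ n → All ShortGate gs
  short-gates []       le = []
  short-gates (g ∷ gs) le =
    short-gate g (≤-trans (m≤m+n _ _) le₁) ∷ short-gates gs (≤-trans (m≤n+m _ (length (tokensOfGate g))) le₁)
    where
    le₁ : length (tokensOfGate g) + length (concatMap tokensOfGate gs) ≤ n
    le₁ = ≤-trans (≤-reflexive (sym (length-++ (tokensOfGate g)))) le

  short-listing : ∀ o gs b → length (tokensOf (listing o gs b)) ≤ n →
                  Short o × Short b × All ShortGate gs × length gs ≤ n
  short-listing o gs b le =
    initialShort o {semicolon ∷ rest} le ,
    ≤-trans (≤-reflexive (sym (length-number b))) (≤-trans (m≤n+m _ (length (concatMap tokensOfGate gs))) le₁) ,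
    short-gates gs le₂ ,
    ≤-trans (count gs) le₂
    where
    rest : List Token
    rest = concatMap tokensOfGate gs ++ number b
    le₁ : length (concatMap tokensOfGate gs) + length (number b) ≤ n
    le₁ = ≤-trans (≤-reflexive (sym (length-++ (concatMap tokensOfGate gs)))) (tailShort (number o) {semicolon} {rest} le)
    le₂ : length (concatMap tokensOfGate gs) ≤ n
    le₂ = ≤-trans (m≤m+n _ _) le₁
    nonempty : ∀ g → 1 ≤ length (tokensOfGate g)
    nonempty (constant m l)    = ≤-trans (s≤s z≤n) (suffix< (number m))
    nonempty (operate σ p q m) = ≤-trans (s≤s z≤n) (suffix< (number m))
    count : ∀ gs → length gs ≤ length (concatMap tokensOfGate gs)
    count []       = z≤n
    count (g ∷ gs) = ≤-trans (+-mono-≤ (nonempty g) (count gs)) (≤-reflexive (sym (length-++ (tokensOfGate g))))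

all-ʳ++ : ∀ {P : Gate → Set} {gs hs} → All P gs → All P hs → All P (gs ʳ++ hs)
all-ʳ++ []         qs = qs
all-ʳ++ (p ∷ ps)   qs = all-ʳ++ ps (p ∷ qs)

all-reverse : ∀ {P : Gate → Set} {gs} → All P gs → All P (reverse gs)
all-reverse ps = all-ʳ++ ps []

-- If an operation extends numbers of at most v digits to at most h v digits,
-- then the value of the i-th gate of a circuit of length n has at most
-- grow h n i digits.
grow : (ℕ → ℕ) → ℕ → ℕ → ℕ
grow h n zero    = n
grow h n (suc i) = h (grow h n i)

-- In `roundBound` the summand in `V` is the room for arithmetic on two values, `n` covers the word
-- and the list of gates, and `n * (n + V + 2)` bounds the stack `sE`: at most `n` entries, each
-- with a name of at most `n` digits, a value of at most `V` digits and two marks.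
valueBound roundBound : (ℕ → ℕ) → ℕ → ℕ
valueBound h n = grow h n n
roundBound h n = 2 + (V + V + 2 * V) + n + n * (n + V + 2)
  where
  V : ℕ
  V = valueBound h n

-- Deciding membership within the round bound

module Bounds {O : List Op} (allowed : BinOp → Bool)
  (allowed-sound : ∀ σ → allowed σ ≡ true → binary σ ∈ O)
  (allowed-complete : ∀ σ → binary σ ∈ O → allowed σ ≡ true)
  (no-complement : ¬ complement ∈ O) (no-union : allowed union ≡ false)
  (h : ℕ → ℕ) (inflationary : ∀ v → v ≤ h v)
  (h-bound : ∀ σ as bs {v} → allowed σ ≡ true → length as ≤ v → length bs ≤ v →
             length (valueDigits (applyOp σ as bs)) ≤ h v) where

  open Syntax allowed
  open Decision allowed
  open Semantics allowed allowed-sound allowed-complete no-complement no-union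

  module _ (n : ℕ) where

    private
      V N : ℕ
      V = valueBound h n
      N = roundBound h n

      room : suc (V + V + 2 * V) < N
      room = ≤-trans (m≤m+n _ n) (m≤m+n _ (n * (n + V + 2)))

      n<N : n < N
      n<N = ≤-trans (s≤s (m≤n+m n (suc (V + V + 2 * V)))) (m≤m+n _ (n * (n + V + 2)))

      code<N : ∀ {k} → k ≤ n * (n + V + 2) → k < N
      code<N le = s≤s (≤-trans le (m≤n+m _ (suc (V + V + 2 * V + n))))

    open Room N V room
    open Evaluation N V room

    grow-mono : ∀ {i j} → i ≤ j → grow h n i ≤ grow h n j
    grow-mono {i} {j} i≤j with ≤⇒≤′ i≤j
    ... | ≤′-refl       = ≤-refl
    ... | ≤′-step i≤′j  = ≤-trans (grow-mono (≤′⇒≤ i≤′j)) (inflationary _)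

    Bounded : ℕ → Gate × Value → Set
    Bounded i (_ , v) = length (valueDigits v) ≤ grow h n i

    bounded-mono : ∀ {i j env} → i ≤ j → All (Bounded i) env → All (Bounded j) env
    bounded-mono {i} i≤j = All.map (λ {e} (le : Bounded i e) → ≤-trans le (grow-mono i≤j))

    bounded-found : ∀ k {i env v} → All (Bounded i) env → lookupEnv k env ≡ just v →
                    length (valueDigits v) ≤ grow h n i
    bounded-found k {env = (g , v) ∷ env} (b ∷ bs) eq with eqBits (binaryDigits (gateName g)) (binaryDigits k)
    bounded-found k (b ∷ bs) refl | true  = b
    bounded-found k {i} (b ∷ bs) eq | false = bounded-found k {i} bs eq

    applyValues-bound : ∀ σ x y {v} → allowed σ ≡ true → length (valueDigits x) ≤ v → length (valueDigits y) ≤ v →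
                        length (valueDigits (applyValues σ x y)) ≤ h v
    applyValues-bound σ nothing   y         ok lx ly = z≤n
    applyValues-bound σ (just as) nothing   ok lx ly = z≤n
    applyValues-bound σ (just as) (just bs) ok lx ly = h-bound σ as bs ok lx ly

    gateValue-bound : ∀ g {i env v} → ShortGate n g → OpAllowed g → All (Bounded i) env →
                      gateValue env g ≡ just v → length (valueDigits v) ≤ grow h n (suc i)
    gateValue-bound (constant m l) {i} (_ , sl) ok bs refl = ≤-trans sl (grow-mono {0} {suc i} z≤n)
    gateValue-bound (operate σ p q m) {env = env} short ok bs eq
      with leqBits (binaryDigits p) (binaryDigits q)
    ... | true with lookupEnv q env in eqq
    ... | just y with lookupEnv p env in eqp
    gateValue-bound (operate σ p q m) {i} short ok bs refl | true | just y | just x =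
      applyValues-bound σ x y ok (bounded-found p {i} bs eqp) (bounded-found q {i} bs eqq)

    gateName-short : ∀ g → ShortGate n g → Short n (gateName g)
    gateName-short (constant m l)    (sm , _)     = sm
    gateName-short (operate σ p q m) (_ , _ , sm) = sm

    gate-fits : ∀ g → ShortGate n g → GateFits g
    gate-fits (constant m l)    (sm , sl)      = ≤-trans (s≤s sm) n<N , ≤-trans (s≤s sl) n<N
    gate-fits (operate σ p q m) (sp , sq , sm) =
      ≤-trans (s≤s sp) n<N , ≤-trans (s≤s sq) n<N , ≤-trans (s≤s sm) n<N

    length-bits-reverse : ∀ ds → length (bits (reverse ds)) ≡ length ds
    length-bits-reverse ds = trans (length-map inj₁ (reverse ds)) (length-reverse ds)

    length-entry : ∀ g v env → length (envCode ((g , v) ∷ env)) ≡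
      length (binaryDigits (gateName g)) + length (valueDigits v) + 2 + length (envCode env)
    length-entry g v env = begin
      length (envCode ((g , v) ∷ env))   ≡⟨ length-++ (bits (reverse (binaryDigits (gateName g)))) ⟩
      length (bits (reverse (binaryDigits (gateName g)))) +
        suc (length (bits (reverse (valueDigits v)) ++ inj₂ (valueMark v) ∷ envCode env))
        ≡⟨ cong₂ (λ x y → x + suc y) (length-bits-reverse (binaryDigits (gateName g)))
             (trans (length-++ (bits (reverse (valueDigits v))))
                    (cong (_+ suc (length (envCode env))) (length-bits-reverse (valueDigits v)))) ⟩
      length (binaryDigits (gateName g)) + suc (length (valueDigits v) + suc (length (envCode env)))
        ≡⟨ lemma (length (binaryDigits (gateName g))) (length (valueDigits v)) (length (envCode env)) ⟩
      length (binaryDigits (gateName g)) + length (valueDigits v) + 2 + length (envCode env) ∎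
      where
      open ≡-Reasoning
      lemma : ∀ x y z → x + suc (y + suc z) ≡ x + y + 2 + z
      lemma = solve-∀

    fits : ∀ i env gs → i + length gs ≤ n → All (Bounded i) env →
           length (envCode env) ≤ i * (n + V + 2) → All (ShortGate n) gs → All OpAllowed gs → Fits env gs
    envFits : ∀ i env → i ≤ n → All (Bounded i) env → length (envCode env) ≤ i * (n + V + 2) → EnvFits env
    envFits i env i≤n bs lc = code<N (≤-trans lc (*-monoˡ-≤ (n + V + 2) i≤n)) , bounded-mono {i} {n} i≤n bs
    fits i env []       li bs lc short ops = envFits i env (≤-trans (m≤m+n i 0) li) bs lc
    fits i env (g ∷ gs) li bs lc (short ∷ shorts) (op ∷ ops) =
      envFits i env (≤-trans (m≤m+n i _) li) bs lc , gate-fits g short , next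
      where
      li′ : suc i + length gs ≤ n
      li′ = ≤-trans (≤-reflexive (sym (+-suc i (length gs)))) li
      next : ∀ {env′} → extend env g ≡ just env′ → Fits env′ gs
      next eq with extend-just env g eq
      ... | v , eqv , _ , refl = fits (suc i) ((g , v) ∷ env) gs li′
        (bound ∷ bounded-mono {i} {suc i} (n≤1+n i) bs)
        (≤-trans (≤-reflexive (length-entry g v env))
          (+-mono-≤ (+-monoˡ-≤ 2 (+-mono-≤ (gateName-short g short)
            (≤-trans bound (grow-mono (≤-trans (m≤m+n (suc i) _) li′))))) lc))
        shorts ops
        where
        bound : length (valueDigits v) ≤ grow h n (suc i)
        bound = gateValue-bound g {i} short op bs eqv

    others-rejected : ∀ {w} → length w ≡ n → Scan inOutput fresh w nothing →
                      Run.finalState (machine decide) (cost N decide) w ≡ reject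
    others-rejected {w} refl s = machine-correct decide N w false (decide-rejects s n<N)

    verdict-correct : ∀ {w} → length w ≡ n → ∀ o gs b → All OpAllowed gs →
      w ≡ concatMap tokenCode (tokensOf (listing o gs b)) →
      Run.finalState (machine decide) (cost N decide) w ≡ verdict (verdictOf o b (process [] (reverse gs)))
    verdict-correct {w} refl o gs b ops w≡ =
      machine-correct decide N w (verdictOf o b (process [] (reverse gs)))
        (decide-listing N V room o gs b scanned′ n<N
          (≤-trans (s≤s (proj₂ (proj₂ (proj₂ short)))) n<N)
          (≤-trans (s≤s (proj₁ short)) n<N) (≤-trans (s≤s (proj₁ (proj₂ short))) n<N)
          (fits 0 [] (reverse gs) (≤-trans (≤-reflexive (length-reverse gs)) (proj₂ (proj₂ (proj₂ short)))) [] z≤n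
            (all-reverse (proj₁ (proj₂ (proj₂ short)))) (all-reverse ops)))
      where
      short : Short n o × Short n b × All (ShortGate n) gs × length gs ≤ n
      short = short-listing n o gs b
        (subst (λ w → length (tokensOf (listing o gs b)) ≤ length w) (sym w≡) (length-code (tokensOf (listing o gs b))))
      scanned′ : Scan inOutput fresh w (just (tokensOf (listing o gs b)))
      scanned′ = subst (λ w → Scan inOutput fresh w (just (tokensOf (listing o gs b)))) (sym w≡)
        (scan-complete inOutput fresh (tokensOf (listing o gs b)) (accepts-tokensOf (listing o gs b) ops))

  module _ {Q : Set} {w : Word} (st : State Q)
    (on-listings : ∀ o gs b → All OpAllowed gs → w ≡ concatMap tokenCode (tokensOf (listing o gs b)) →
                   st ≡ verdict (verdictOf o b (process [] (reverse gs))))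
    (on-others : Scan inOutput fresh w nothing → st ≡ reject) where

    private
      reject≢accept : ¬ _≡_ {A = State Q} reject accept
      reject≢accept ()

      -- Every circuit encoded by `w` gives a listing of `w`, and the one state `st` answers to all
      -- such listings. Rejection therefore refutes all circuits at once, whichever listing the
      -- parser has found.
      member-accepted : MC O w → st ≡ accept
      member-accepted (C , b , later , eq , res) =
        trans (on-listings _ _ b ops-listed (trans eq (encode-listed no-complement C b)))
              (cong verdict (verdict-listed b res))
        where open Complete C later

      nonmember : st ≡ reject → ¬ MC O w
      nonmember eq mem = reject≢accept (trans (sym eq) (member-accepted mem))

    decision : (st ≡ accept × MC O w) ⊎ (st ≡ reject × ¬ MC O w)
    decision with scan inOutput fresh w
    ... | nothing , s = inj₂ (on-others s , nonmember (on-others s))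
    ... | just ts , s with scan-sound s refl
    ... | w≡ , accepted with parse ts accepted
    ... | listing o gs b , refl , ops with verdictOf o b (process [] (reverse gs)) in eqv
    ... | true  = inj₁ (trans (on-listings o gs b ops w≡) (cong verdict eqv) ,
                        subst (MC O) (sym w≡) (verdict-sound o gs b ops eqv))
    ... | false =
      let rejected = trans (on-listings o gs b ops w≡) (cong verdict eqv)
      in  inj₂ (rejected , nonmember rejected)

  decides : DecidesInTime (machine decide) (MC O) (λ n → cost (roundBound h n) decide)
  decides w = decision (Run.finalState (machine decide) (cost (roundBound h (length w)) decide) w)
    (verdict-correct (length w) refl) (others-rejected (length w) refl)

-- Asymptotics

^-distribʳ-* : ∀ d x y → (x * y) ^ d ≡ x ^ d * y ^ d
^-distribʳ-* zero    x y = refl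
^-distribʳ-* (suc d) x y = trans (cong (x * y *_) (^-distribʳ-* d x y)) ([m*n]*[o*p]≡[m*o]*[n*p] x y (x ^ d) (y ^ d))

∘-polynomial : ∀ {f g} → Polynomial f → Polynomial g → Polynomial (f ∘ g)
∘-polynomial {f} {g} (c , d , f≤) (c′ , d′ , g≤) = c * suc c′ ^ d , d′ * d , λ n → begin
  f (g n)                                 ≤⟨ f≤ (g n) ⟩
  c * suc (g n) ^ d                       ≤⟨ *-monoʳ-≤ c (^-monoˡ-≤ d (suc-g≤ n)) ⟩
  c * (suc c′ * suc n ^ d′) ^ d           ≡⟨ cong (c *_) (^-distribʳ-* d (suc c′) (suc n ^ d′)) ⟩
  c * (suc c′ ^ d * (suc n ^ d′) ^ d)     ≡⟨ cong (λ x → c * (suc c′ ^ d * x)) (^-*-assoc (suc n) d′ d) ⟩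
  c * (suc c′ ^ d * suc n ^ (d′ * d))     ≡⟨ *-assoc c _ _ ⟨
  c * suc c′ ^ d * suc n ^ (d′ * d)       ∎
  where
  open ≤-Reasoning
  -- The added 1 is absorbed by a copy of `suc n ^ d′`, hence the constant `suc c′`.
  suc-g≤ : ∀ n → suc (g n) ≤ suc c′ * suc n ^ d′
  suc-g≤ n = +-mono-≤ (>-nonZero⁻¹ (suc n ^ d′) {{m^n≢0 (suc n) d′}}) (g≤ n)

-- For `n ≥ 1` the base `suc n` is at most `2 * n`, at the price of the factor `2 ^ d`; at 0 the
-- power of `n` may vanish, hence the threshold 1.
polynomial-∈O : ∀ {f} → Polynomial f → ∃[ k ] (f ∈O (λ n → n ^ k))
polynomial-∈O {f} (c , d , f≤) = d , c * 2 ^ d , 1 , λ { (suc n) _ → begin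
  f (suc n)                    ≤⟨ f≤ (suc n) ⟩
  c * suc (suc n) ^ d          ≤⟨ *-monoʳ-≤ c (^-monoˡ-≤ d (double n)) ⟩
  c * (2 * suc n) ^ d          ≡⟨ cong (c *_) (^-distribʳ-* d 2 (suc n)) ⟩
  c * (2 ^ d * suc n ^ d)      ≡⟨ *-assoc c (2 ^ d) _ ⟨
  c * 2 ^ d * suc n ^ d        ∎ }
  where
  open ≤-Reasoning
  double : ∀ n → suc (suc n) ≤ 2 * suc n
  double n = s≤s (≤-trans (s≤s (m≤m+n n (n + 0))) (≤-reflexive (sym (+-suc n (n + 0)))))

-- The operations ∩, + and /

linearAllowed : BinOp → Bool
linearAllowed inter    = true
linearAllowed plus     = true
linearAllowed quotient = true
linearAllowed _        = false

linearOps : List Op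
linearOps = ∩-op ∷ +-op ∷ /-op ∷ []

linear-sound : ∀ σ → linearAllowed σ ≡ true → binary σ ∈ linearOps
linear-sound inter    refl = here refl
linear-sound plus     refl = there (here refl)
linear-sound quotient refl = there (there (here refl))

linear-complete : ∀ σ → binary σ ∈ linearOps → linearAllowed σ ≡ true
linear-complete _ (here refl)                 = refl
linear-complete _ (there (here refl))         = refl
linear-complete _ (there (there (here refl))) = refl

linear-no-complement : ¬ complement ∈ linearOps
linear-no-complement (there (there (there ())))

length-quotient : ∀ as bs {v} → length as ≤ v → length (valueDigits (div as bs)) ≤ v
length-quotient as bs le with div as bs | length-div as bs
... | nothing | shorter = z≤n
... | just _  | shorter = ≤-trans (shorter refl) le

length-intersection : ∀ as bs {v} → length as ≤ v → length (valueDigits (applyOp inter as bs)) ≤ v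
length-intersection as bs le with eqBits as bs
... | true  = le
... | false = z≤n

linear-bound : ∀ σ as bs {v} → linearAllowed σ ≡ true → length as ≤ v → length bs ≤ v →
               length (valueDigits (applyOp σ as bs)) ≤ suc v
linear-bound inter    as bs ok las lbs = ≤-trans (length-intersection as bs las) (n≤1+n _)
linear-bound plus     as bs ok las lbs = length-output-adder false as bs las lbs
linear-bound quotient as bs ok las lbs = ≤-trans (length-quotient as bs las) (n≤1+n _)

linear-valueBound : ∀ n i → grow suc n i ≡ i + n
linear-valueBound n zero    = refl
linear-valueBound n (suc i) = cong suc (linear-valueBound n i)

linear-roundBound : Polynomial (roundBound suc)
linear-roundBound =
  +-polynomial (+-polynomial (+-polynomial (const-polynomial 2)
      (+-polynomial (+-polynomial V V) (*-polynomial (const-polynomial 2) V))) id-polynomial)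
    (*-polynomial id-polynomial (+-polynomial (+-polynomial id-polynomial V) (const-polynomial 2)))
  where
  V : Polynomial (valueBound suc)
  V = let c , d , le = +-polynomial id-polynomial id-polynomial
      in  c , d , λ n → ≤-trans (≤-reflexive (linear-valueBound n n)) (le n)

-- The operations ∩, +, × and /

arithmeticAllowed : BinOp → Bool
arithmeticAllowed union = false
arithmeticAllowed _     = true

arithmeticOps : List Op
arithmeticOps = ∩-op ∷ +-op ∷ ×-op ∷ /-op ∷ []

arithmetic-sound : ∀ σ → arithmeticAllowed σ ≡ true → binary σ ∈ arithmeticOps
arithmetic-sound inter    refl = here refl
arithmetic-sound plus     refl = there (here refl)
arithmetic-sound times    refl = there (there (here refl))
arithmetic-sound quotient refl = there (there (there (here refl)))

arithmetic-complete : ∀ σ → binary σ ∈ arithmeticOps → arithmeticAllowed σ ≡ true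
arithmetic-complete _ (here refl)                         = refl
arithmetic-complete _ (there (here refl))                 = refl
arithmetic-complete _ (there (there (here refl)))         = refl
arithmetic-complete _ (there (there (there (here refl)))) = refl

arithmetic-no-complement : ¬ complement ∈ arithmeticOps
arithmetic-no-complement (there (there (there (there ()))))

-- Three lengths bound a product; the successor covers the carry of a sum when `v = 0`.
triple : ℕ → ℕ
triple v = suc (3 * v)

triple-inflationary : ∀ v → v ≤ triple v
triple-inflationary v = ≤-trans (m≤m+n v (2 * v)) (n≤1+n _)

arithmetic-bound : ∀ σ as bs {v} → arithmeticAllowed σ ≡ true → length as ≤ v → length bs ≤ v →
                   length (valueDigits (applyOp σ as bs)) ≤ triple v
arithmetic-bound inter    as bs ok las lbs = ≤-trans (length-intersection as bs las) (triple-inflationary _)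
arithmetic-bound plus     as bs {v} ok las lbs = ≤-trans (length-output-adder false as bs las lbs) (s≤s (m≤m+n v (2 * v)))
arithmetic-bound times    as bs {v} ok las lbs = ≤-trans (length-mul as bs)
  (≤-trans (+-mono-≤ (*-monoʳ-≤ 2 las) lbs) (≤-trans (≤-reflexive (+-comm (2 * v) v)) (n≤1+n _)))
arithmetic-bound quotient as bs ok las lbs = ≤-trans (length-quotient as bs las) (triple-inflationary _)

n<2^n : ∀ n → n < 2 ^ n
n<2^n zero    = s≤s z≤n
n<2^n (suc n) = begin
  suc (suc n)    ≤⟨ s≤s (n<2^n n) ⟩
  1 + 2 ^ n      ≤⟨ +-monoˡ-≤ (2 ^ n) (>-nonZero⁻¹ (2 ^ n) {{m^n≢0 2 n}}) ⟩
  2 ^ n + 2 ^ n  ≡⟨ cong (2 ^ n +_) (+-identityʳ (2 ^ n)) ⟨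
  2 ^ suc n      ∎
  where open ≤-Reasoning

-- With the successor on the left, one step of growth is a multiplication by at most 4: 2 + 3v ≤ 4(1
-- + v). After `i` steps this gives 4^i times the initial bound.
arithmetic-valueBound : ∀ n i → suc (grow triple n i) ≤ 2 ^ (2 * i) * 2 ^ n
arithmetic-valueBound n zero    = ≤-trans (n<2^n n) (≤-reflexive (sym (*-identityˡ (2 ^ n))))
arithmetic-valueBound n (suc i) = begin
  suc (triple (grow triple n i))     ≤⟨ le (grow triple n i) ⟩
  4 * suc (grow triple n i)          ≤⟨ *-monoʳ-≤ 4 (arithmetic-valueBound n i) ⟩
  4 * (2 ^ (2 * i) * 2 ^ n)          ≡⟨ *-assoc 4 (2 ^ (2 * i)) (2 ^ n) ⟨
  2 ^ 2 * 2 ^ (2 * i) * 2 ^ n        ≡⟨ cong (_* 2 ^ n) (^-distribˡ-+-* 2 2 (2 * i)) ⟨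
  2 ^ (2 + 2 * i) * 2 ^ n            ≡⟨ cong (λ k → 2 ^ k * 2 ^ n) (*-distribˡ-+ 2 1 i) ⟨
  2 ^ (2 * suc i) * 2 ^ n            ∎
  where
  open ≤-Reasoning
  le : ∀ v → suc (triple v) ≤ 4 * suc v
  le v = ≤-trans (m≤m+n (2 + 3 * v) (2 + v)) (≤-reflexive (lemma v))
    where
    lemma : ∀ v → 2 + 3 * v + (2 + v) ≡ 4 * suc v
    lemma = solve-∀

-- Both `n` and the value bound are at most u = 2^(3n). The left side is then at most 3 + 7u + 2u²,
-- which is at most 12u² as u ≥ 1; the constant 16 is the next power of two.
arithmetic-roundBound : ∀ n → suc (roundBound triple n) ≤ 2 ^ (4 + 6 * n)
arithmetic-roundBound n = begin
  suc (2 + (V + V + 2 * V) + n + n * (n + V + 2))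
    ≤⟨ s≤s (+-mono-≤ (+-mono-≤ (+-mono-≤ (≤-refl {2}) (+-mono-≤ (+-mono-≤ V≤ V≤) (*-monoʳ-≤ 2 V≤))) n≤)
              (*-mono-≤ n≤ (+-monoˡ-≤ 2 (+-mono-≤ n≤ V≤)))) ⟩
  suc (2 + (u + u + 2 * u) + u + u * (u + u + 2))
    ≤⟨ quadratic u 1≤u ⟩
  16 * (u * u)
    ≡⟨ cong (16 *_) (^-distribˡ-+-* 2 (3 * n) (3 * n)) ⟨
  2 ^ 4 * 2 ^ (3 * n + 3 * n)
    ≡⟨ ^-distribˡ-+-* 2 4 (3 * n + 3 * n) ⟨
  2 ^ (4 + (3 * n + 3 * n))
    ≡⟨ cong (λ k → 2 ^ (4 + k)) (*-distribʳ-+ n 3 3) ⟨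
  2 ^ (4 + 6 * n) ∎
  where
  open ≤-Reasoning
  V u : ℕ
  V = valueBound triple n
  u = 2 ^ (3 * n)
  1≤u : 1 ≤ u
  1≤u = >-nonZero⁻¹ u {{m^n≢0 2 (3 * n)}}
  n≤ : n ≤ u
  n≤ = ≤-trans (<⇒≤ (n<2^n n)) (^-monoʳ-≤ 2 (m≤m+n n (2 * n)))
  V≤ : V ≤ u
  V≤ = ≤-trans (n≤1+n V) (≤-trans (arithmetic-valueBound n n) (≤-reflexive
    (trans (sym (^-distribˡ-+-* 2 (2 * n) n)) (cong (2 ^_) (+-comm (2 * n) n)))))
  quadratic : ∀ u → 1 ≤ u → suc (2 + (u + u + 2 * u) + u + u * (u + u + 2)) ≤ 16 * (u * u)
  -- The added polynomial is the difference of the two sides, expanded in the predecessor of the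
  -- argument, where all coefficients are nonnegative.
  quadratic (suc u) _ = ≤-trans (m≤m+n _ (4 + 21 * u + 14 * (u * u))) (≤-reflexive (lemma u))
    where
    lemma : ∀ u → suc (2 + (suc u + suc u + 2 * suc u) + suc u + suc u * (suc u + suc u + 2)) +
                  (4 + 21 * u + 14 * (u * u)) ≡ 16 * (suc u * suc u)
    lemma = solve-∀

-- A power of 2^(4 + 6n) with fixed exponent `d` is again 2 to a linear function of `n`. For `n ≥ 1`
-- that function is at most `10 * d * n`, since 4 ≤ 4n.
polynomial-exponential : ∀ {f} → Polynomial f →
  ∃[ g ] (g ∈O id × (f ∘ roundBound triple) ∈O (λ n → 2 ^ g n))
polynomial-exponential {f} (c , d , f≤) =
  (λ n → (4 + 6 * n) * d) ,
  (10 * d , 1 , λ { (suc n) _ → ≤-trans (m≤m+n _ (4 * (n * d))) (≤-reflexive (lemma n d)) }) ,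
  (c , 0 , λ n _ → begin
    f (roundBound triple n)               ≤⟨ f≤ (roundBound triple n) ⟩
    c * suc (roundBound triple n) ^ d     ≤⟨ *-monoʳ-≤ c (^-monoˡ-≤ d (arithmetic-roundBound n)) ⟩
    c * (2 ^ (4 + 6 * n)) ^ d             ≡⟨ cong (c *_) (^-*-assoc 2 (4 + 6 * n) d) ⟩
    c * 2 ^ ((4 + 6 * n) * d)             ∎)
  where
  open ≤-Reasoning
  lemma : ∀ n d → (4 + 6 * suc n) * d + 4 * (n * d) ≡ 10 * d * suc n
  lemma = solve-∀

module Linear = Bounds linearAllowed linear-sound linear-complete linear-no-complement refl
  suc n≤1+n linear-bound

module Arithmetic = Bounds arithmeticAllowed arithmetic-sound arithmetic-complete arithmetic-no-complement refl
  triple triple-inflationary arithmetic-bound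

theorem2 : P (MC (∩-op ∷ +-op ∷ /-op ∷ [])) × E (MC (∩-op ∷ +-op ∷ ×-op ∷ /-op ∷ []))
theorem2 = polynomialTime , exponentialTime
  where
  polynomialTime : P (MC linearOps)
  polynomialTime =
    let decide = Decision.decide linearAllowed
        k , f∈O = polynomial-∈O (∘-polynomial (cost-polynomial decide) linear-roundBound)
    in  k , machine decide , _ , f∈O , Linear.decides
  exponentialTime : E (MC arithmeticOps)
  exponentialTime =
    let decide = Decision.decide arithmeticAllowed
        g , g∈O , f∈O = polynomial-exponential (cost-polynomial decide)
    in  g , g∈O , machine decide , _ , f∈O , Arithmetic.decides
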